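{- Let $n$ be a positive integer, let $R$ be a finite commutative symmetric $\mathbb Z/n$-algebra with a fixed non-degenerate linear functional $\psi\colon R\to\mathbb Z/n$, and let $G_R(D)$ be a gcd-graph with $D=\{\mathcal I_1,\dots,\mathcal I_k\}$, where $\mathcal I_1,\dots,\mathcal I_k$ are distinct nonzero principal ideals and $\mathcal I_i=Rx_i$. Then the spectrum of $G_R(D)$ is the multiset $\{\lambda_g\}_{g\in R}$, where $$\lambda_g=\sum_{i=1}^k c(g,R/\operatorname{Ann}_R(x_i)),$$ and where the generalized Ramanujan sums are given explicitly by $$c(g,R/\operatorname{Ann}_R(x_i))=\frac{\varphi(R/\operatorname{Ann}_R(x_i))}{\varphi(R/\operatorname{Ann}_R(gx_i))}\,\mu(R/\operatorname{Ann}_R(gx_i)).$$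
   Context: All rings are finite, commutative, associative and unital. A finite $\mathbb Z/n$-algebra $R$ is symmetric if there is a $\mathbb Z/n$-linear map $\psi\colon R\to\mathbb Z/n$ whose kernel contains no nonzero ideal of $R$; such a $\psi$ is called a non-degenerate linear functional. For a set $D$ of nonzero principal ideals of $R$, the gcd-graph $G_R(D)$ has vertex set $R$, with $x,y$ adjacent if and only if $x-y\in S$, where $S=\{s\in R: Rs\in D\}$. The spectrum of a graph is the multiset of eigenvalues of its adjacency matrix. For $x\in R$, $\operatorname{Ann}_R(x)=\{a\in R: ax=0\}$. Fix a primitive $n$-th root of unity $\zeta_n\in\mathbb C$. For a finite symmetric $\mathbb Z/n$-algebra $R$ with non-degenerate functional $\psi$ and $g\in R$, the generalized Ramanujan sum is $c(g,R)=c_\psi(g,R)=\sum_{a\in R^\times}\zeta_n^{\psi(ga)}$. For $x\in R$ the algebra $R/\operatorname{Ann}_R(x)$ carries the non-degenerate functional $\psi_x(\bar a)=\psi(ax)$ (where $a$ is any lift of $\bar a$), and $c(g,R/\operatorname{Ann}_R(x))$ denotes the generalized Ramanujan sum of the image of $g$ in $R/\operatorname{Ann}_R(x)$ with respect to $\psi_x$, i.e. $\sum_{u\in (R/\operatorname{Ann}_R(x))^\times}\zeta_n^{\psi_x(gu)}$. For a finite ring $T$, $\varphi(T)=|T^\times|$. Writing $T\cong\prod_{i=1}^d T_i$ with $T_i$ local, $\mu(T)=1$ if $|T|=1$; $\mu(T)=0$ if some $T_i$ is not a field; and $\mu(T)=(-1)^d$ otherwise. -}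

module Defs where

open import Algebra.Bundles using (CommutativeRing; RawRing; Ring)
import Algebra.Construct.DirectProduct as DirectProduct
import Algebra.Construct.Terminal as Terminal
import Algebra.Definitions.RawSemiring as RawSemiringDefinitions
open import Algebra.Morphism.Structures using (IsRingHomomorphism; IsRingIsomorphism)
import Algebra.Properties.Ring as RingProperties
import Algebra.Properties.Semiring.Exp as Exponentiation
open import Data.Fin.Base using (Fin; zero; suc; toℕ; punchIn)
import Data.Fin.Properties as Fin
open import Data.Bool.Base using (if_then_else_)
open import Data.Integer.Base as ℤ using (ℤ; +_; 0ℤ; 1ℤ; -1ℤ)
import Data.Integer.Properties as ℤ
open import Data.Integer.DivMod using (_%ℕ_)
open import Data.List.Base as List
  using (List; []; _∷_; [_]; _++_; length; filter; foldr; map; deduplicate; lookup)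
open import Data.List.Properties
  using (length-filter; length-deduplicate; filter-complete)
import Data.List.Membership.Setoid as Membership
open import Data.List.Membership.Setoid.Properties using (∈-filter⁺; index-injective)
open import Data.List.Relation.Unary.All as All using (All; []; _∷_)
open import Data.List.Relation.Unary.All.Properties using (++⁺)
open import Data.List.Relation.Unary.AllPairs using ([]; _∷_)
open import Data.List.Relation.Unary.Any as Any using (Any; here; there; index)
open import Data.List.Relation.Unary.Enumerates.Setoid using (IsEnumeration)
open import Data.List.Relation.Unary.Enumerates.Setoid.Properties using (deduplicate⁺)
open import Data.List.Relation.Unary.Unique.DecSetoid.Properties using (deduplicate-!)
open import Data.List.Relation.Unary.Unique.Setoid using (Unique)
open import Data.Nat.Base as ℕ using (ℕ; zero; suc; NonZero)
open import Data.Nat.Induction using (<-wellFounded)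
import Data.Nat.Properties as ℕ
open import Data.Rational.Base as ℚ using (ℚ; 0ℚ; 1ℚ; ½; ∣_∣)
import Data.Rational.Properties as ℚ
open import Data.Rational.Solver using (module +-*-Solver)
open import Data.Product.Base using (_×_; _,_; ∃; ∃-syntax; proj₁; proj₂)
open import Data.Unit.Polymorphic.Base using (tt)
open import Function.Base using (_∘_)
open import Induction.WellFounded using (Acc; acc)
open import Level using (Level; 0ℓ; _⊔_) renaming (suc to lsuc)
open import Relation.Binary.Core using (Rel; _⇒_)
open import Relation.Binary.Structures using (IsEquivalence)
open import Relation.Binary.Bundles using (Setoid; DecSetoid)
open import Relation.Binary.PropositionalEquality as ≡ using (_≡_; _≢_)
import Relation.Binary.Reasoning.Setoid as ≈-Reasoning
open import Relation.Nullary.Decidable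
  using (Dec; yes; no; does; map′; ¬?; _×-dec_; _→-dec_; decidable-stable)
open import Relation.Nullary.Negation using (¬_; contradiction)
open import Relation.Unary using (Pred; Decidable; _⊆_; _≐_)
open import Relation.Binary.Definitions using (_Respects_) renaming (Decidable to Decidable₂)

-- Real numbers are Cauchy sequences of rationals; _≈ℝ_ identifies sequences
-- whose difference tends to 0.
IsCauchy : (ℕ → ℚ) → Set
IsCauchy s = ∀ ε → 0ℚ ℚ.< ε → ∃ λ N → ∀ m n → N ℕ.≤ m → N ℕ.≤ n →
             ∣ s m ℚ.- s n ∣ ℚ.< ε

record ℝ : Set where
  constructor mkℝ
  field
    seq    : ℕ → ℚ
    cauchy : IsCauchy seq

open ℝ

infix 4 _≈ℝ_
_≈ℝ_ : ℝ → ℝ → Set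
x ≈ℝ y = ∀ ε → 0ℚ ℚ.< ε → ∃ λ N → ∀ n → N ℕ.≤ n →
         ∣ seq x n ℚ.- seq y n ∣ ℚ.< ε

private
  half : ∀ {ε} → 0ℚ ℚ.< ε → 0ℚ ℚ.< ½ ℚ.* ε
  half {ε} 0<ε = ≡.subst (ℚ._< ½ ℚ.* ε) (ℚ.*-zeroʳ ½) (ℚ.*-monoʳ-<-pos ½ 0<ε)

  half+half : ∀ ε → ½ ℚ.* ε ℚ.+ ½ ℚ.* ε ≡ ε
  half+half ε = ≡.trans (≡.sym (ℚ.*-distribʳ-+ ε ½ ½)) (ℚ.*-identityˡ ε)

  ∣+∣<-half : ∀ a b ε → ∣ a ∣ ℚ.< ½ ℚ.* ε → ∣ b ∣ ℚ.< ½ ℚ.* ε → ∣ a ℚ.+ b ∣ ℚ.< ε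
  ∣+∣<-half a b ε a< b< = ℚ.≤-<-trans (ℚ.∣p+q∣≤∣p∣+∣q∣ a b)
    (≡.subst (∣ a ∣ ℚ.+ ∣ b ∣ ℚ.<_) (half+half ε) (ℚ.+-mono-< a< b<))

  both : ∀ {P Q : ℕ → ℕ → Set} →
         (∃ λ N → ∀ m n → N ℕ.≤ m → N ℕ.≤ n → P m n) →
         (∃ λ N → ∀ m n → N ℕ.≤ m → N ℕ.≤ n → Q m n) →
         ∃ λ N → ∀ m n → N ℕ.≤ m → N ℕ.≤ n → P m n × Q m n
  both (M , p) (N , q) = M ℕ.⊔ N , λ m n a b →
    p m n (ℕ.≤-trans (ℕ.m≤m⊔n M N) a) (ℕ.≤-trans (ℕ.m≤m⊔n M N) b) ,
    q m n (ℕ.≤-trans (ℕ.m≤n⊔m M N) a) (ℕ.≤-trans (ℕ.m≤n⊔m M N) b)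

  open +-*-Solver using (solve; _:+_; _:*_; _:-_; :-_; _:=_)

  +-id : ∀ a b c d → (a ℚ.+ b) ℚ.- (c ℚ.+ d) ≡ (a ℚ.- c) ℚ.+ (b ℚ.- d)
  +-id = solve 4 (λ a b c d → (a :+ b) :- (c :+ d) := (a :- c) :+ (b :- d)) ≡.refl

  *-id : ∀ a b c d → a ℚ.* b ℚ.- c ℚ.* d ≡ (a ℚ.- c) ℚ.* b ℚ.+ c ℚ.* (b ℚ.- d)
  *-id = solve 4 (λ a b c d → a :* b :- c :* d := (a :- c) :* b :+ c :* (b :- d)) ≡.refl

  neg-id : ∀ a b → (ℚ.- a) ℚ.- (ℚ.- b) ≡ ℚ.- (a ℚ.- b)
  neg-id = solve 2 (λ a b → (:- a) :- (:- b) := :- (a :- b)) ≡.refl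

  sub-id : ∀ a b → a ≡ (a ℚ.- b) ℚ.+ b
  sub-id = solve 2 (λ a b → a := (a :- b) :+ b) ≡.refl

  0<1 : 0ℚ ℚ.< 1ℚ
  0<1 = ℚ.positive⁻¹ 1ℚ

  bound : ∀ {s} → IsCauchy s → ∃ λ B → ℚ.Positive B ×
          (∃ λ N → ∀ m n → N ℕ.≤ m → N ℕ.≤ n → ∣ s m ∣ ℚ.≤ B × ∣ s n ∣ ℚ.≤ B)
  bound {s} c with c 1ℚ 0<1
  ... | N , close =
    1ℚ ℚ.+ ∣ s N ∣ ,
    ℚ.positive (ℚ.<-≤-trans 0<1 (≡.subst (ℚ._≤ 1ℚ ℚ.+ ∣ s N ∣) (ℚ.+-identityʳ 1ℚ)
                                   (ℚ.+-monoʳ-≤ 1ℚ (ℚ.0≤∣p∣ (s N))))) ,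
    N , λ m n N≤m N≤n → le m N≤m , le n N≤n
    where
    le : ∀ m → N ℕ.≤ m → ∣ s m ∣ ℚ.≤ 1ℚ ℚ.+ ∣ s N ∣
    le m N≤m = ℚ.≤-trans
      (≡.subst (λ z → ∣ z ∣ ℚ.≤ ∣ s m ℚ.- s N ∣ ℚ.+ ∣ s N ∣) (≡.sym (sub-id (s m) (s N)))
        (ℚ.∣p+q∣≤∣p∣+∣q∣ (s m ℚ.- s N) (s N)))
      (ℚ.+-monoˡ-≤ ∣ s N ∣ (ℚ.<⇒≤ (close m N N≤m ℕ.≤-refl)))

  -- ε / B
  scale : ∀ ε B → 0ℚ ℚ.< ε → ℚ.Positive B →
          ∃ λ δ → 0ℚ ℚ.< δ × δ ℚ.* B ≡ ε
  scale ε B 0<ε B>0 = ε ℚ.* 1/B , 0<δ ,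
      ≡.trans (ℚ.*-assoc ε 1/B B)
        (≡.trans (≡.cong (ε ℚ.*_) (ℚ.*-inverseˡ B)) (ℚ.*-identityʳ ε))
    where
    instance
      _ : ℚ.Positive B
      _ = B>0
      _ : ℚ.NonZero B
      _ = ℚ.pos⇒nonZero B
    1/B : ℚ
    1/B = ℚ.1/ B
    0<δ : 0ℚ ℚ.< ε ℚ.* 1/B
    0<δ = ≡.subst (ℚ._< ε ℚ.* 1/B) (ℚ.*-zeroˡ 1/B)
            (ℚ.*-monoˡ-<-pos 1/B {{ℚ.1/pos⇒pos B}} 0<ε)

  prod-< : ∀ a b δ B ε → ∣ a ∣ ℚ.< δ → ∣ b ∣ ℚ.≤ B → ℚ.Positive B → δ ℚ.* B ≡ ε →
           ∣ a ℚ.* b ∣ ℚ.< ε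
  prod-< a b δ B ε a< b≤ B>0 eq =
    ≡.subst (ℚ._< ε) (≡.sym (ℚ.∣p*q∣≡∣p∣*∣q∣ a b))
      (ℚ.≤-<-trans (ℚ.*-monoˡ-≤-nonNeg ∣ a ∣ {{ℚ.∣-∣-nonNeg a}} b≤)
        (≡.subst (∣ a ∣ ℚ.* B ℚ.<_) eq (ℚ.*-monoˡ-<-pos B {{B>0}} a<)))

  const-cauchy : ∀ q → IsCauchy (λ _ → q)
  const-cauchy q ε 0<ε = 0 , λ _ _ _ _ →
    ≡.subst (λ z → ∣ z ∣ ℚ.< ε) (≡.sym (ℚ.+-inverseʳ q)) 0<ε

  +-cauchy : ∀ {s t} → IsCauchy s → IsCauchy t → IsCauchy (λ k → s k ℚ.+ t k)
  +-cauchy {s} {t} cs ct ε 0<ε =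
    let N , close = both (cs (½ ℚ.* ε) (half 0<ε)) (ct (½ ℚ.* ε) (half 0<ε))
    in N , λ m n N≤m N≤n →
    let p , q = close m n N≤m N≤n in
    ≡.subst (λ z → ∣ z ∣ ℚ.< ε) (≡.sym (+-id (s m) (t m) (s n) (t n)))
      (∣+∣<-half (s m ℚ.- s n) (t m ℚ.- t n) ε p q)

  neg-cauchy : ∀ {s} → IsCauchy s → IsCauchy (λ k → ℚ.- s k)
  neg-cauchy {s} cs ε 0<ε =
    let N , close = cs ε 0<ε in N , λ m n N≤m N≤n →
    ≡.subst (ℚ._< ε)
      (≡.sym (≡.trans (≡.cong ∣_∣ (neg-id (s m) (s n))) (ℚ.∣-p∣≡∣p∣ (s m ℚ.- s n))))
      (close m n N≤m N≤n)

  *-cauchy : ∀ {s t} → IsCauchy s → IsCauchy t → IsCauchy (λ k → s k ℚ.* t k)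
  *-cauchy {s} {t} cs ct ε 0<ε =
    let B , B>0 , bs = bound cs
        C , C>0 , bt = bound ct
        δ , 0<δ , δC = scale (½ ℚ.* ε) C (half 0<ε) C>0
        η , 0<η , ηB = scale (½ ℚ.* ε) B (half 0<ε) B>0
        N , close = both (both bs bt) (both (cs δ 0<δ) (ct η 0<η))
    in N , λ m n N≤m N≤n →
    let ((_ , sn≤B) , (tm≤C , _)) , (s< , t<) = close m n N≤m N≤n in
    ≡.subst (λ z → ∣ z ∣ ℚ.< ε) (≡.sym (*-id (s m) (t m) (s n) (t n)))
      (∣+∣<-half ((s m ℚ.- s n) ℚ.* t m) (s n ℚ.* (t m ℚ.- t n)) ε
        (prod-< (s m ℚ.- s n) (t m) δ C (½ ℚ.* ε) s< tm≤C C>0 δC)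
        (≡.subst (λ z → ∣ z ∣ ℚ.< ½ ℚ.* ε) (ℚ.*-comm (t m ℚ.- t n) (s n))
          (prod-< (t m ℚ.- t n) (s n) η B (½ ℚ.* ε) t< sn≤B B>0 ηB)))

ℚ⇒ℝ : ℚ → ℝ
ℚ⇒ℝ q = mkℝ (λ _ → q) (const-cauchy q)

infixl 6 _+ℝ_
infixl 7 _*ℝ_
infix  8 -ℝ_

_+ℝ_ : ℝ → ℝ → ℝ
x +ℝ y = mkℝ (λ k → seq x k ℚ.+ seq y k) (+-cauchy {seq x} {seq y} (cauchy x) (cauchy y))

-ℝ_ : ℝ → ℝ
-ℝ x = mkℝ (λ k → ℚ.- seq x k) (neg-cauchy {seq x} (cauchy x))

_*ℝ_ : ℝ → ℝ → ℝ
x *ℝ y = mkℝ (λ k → seq x k ℚ.* seq y k) (*-cauchy {seq x} {seq y} (cauchy x) (cauchy y))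

record ℂ : Set where
  constructor _+i_
  field
    re im : ℝ

ℂ-rawRing : RawRing 0ℓ 0ℓ
ℂ-rawRing = record
  { Carrier = ℂ
  ; _≈_     = λ { (a +i b) (c +i d) → a ≈ℝ c × b ≈ℝ d }
  ; _+_     = λ { (a +i b) (c +i d) → (a +ℝ c) +i (b +ℝ d) }
  ; _*_     = λ { (a +i b) (c +i d) →
                  (a *ℝ c +ℝ -ℝ (b *ℝ d)) +i (a *ℝ d +ℝ b *ℝ c) }
  ; -_      = λ { (a +i b) → (-ℝ a) +i (-ℝ b) }
  ; 0#      = ℚ⇒ℝ 0ℚ +i ℚ⇒ℝ 0ℚ
  ; 1#      = ℚ⇒ℝ 1ℚ +i ℚ⇒ℝ 0ℚ
  }

ℚ⇒ℂ : ℚ → ℂ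
ℚ⇒ℂ q = ℚ⇒ℝ q +i ℚ⇒ℝ 0ℚ

record Finite {c ℓ} (S : Setoid c ℓ) : Set (c ⊔ ℓ) where
  open Setoid S
  infix 4 _≟_
  field
    _≟_        : Decidable₂ _≈_
    elements   : List Carrier
    enumerates : IsEnumeration S elements
    unique     : Unique S elements

  order : ℕ
  order = length elements

  decSetoid : DecSetoid c ℓ
  decSetoid = record
    { isDecEquivalence = record { isEquivalence = isEquivalence ; _≟_ = _≟_ } }

  module _ {p} {P : Pred Carrier p} (resp : P Respects _≈_) (P? : Decidable P) where

    any⇒∈ : ∃ P → Any P elements
    any⇒∈ (x , px) = Any.map (λ x≈y → resp x≈y px) (enumerates x)

    ∃? : Dec (∃ P)
    ∃? = map′ Any.satisfied any⇒∈ (Any.any? P? elements)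

  ∀? : ∀ {p} {P : Pred Carrier p} → P Respects _≈_ → Decidable P → Dec (∀ x → P x)
  ∀? {P = P} resp P? = map′
    (λ ¬∃¬ x → decidable-stable (P? x) (λ ¬Px → ¬∃¬ (x , ¬Px)))
    (λ all (x , ¬Px) → ¬Px (all x))
    (¬? (∃? {P = λ x → ¬ P x} (λ x≈y ¬Px Py → ¬Px (resp (sym x≈y) Py)) (¬? ∘ P?)))

private
  NonZero-length : ∀ {a p} {A : Set a} {P : Pred A p} {xs : List A} →
                   Any P xs → NonZero (length xs)
  NonZero-length (here _)  = _
  NonZero-length (there _) = _

  module _ {c ℓ} (D : DecSetoid c ℓ) where
    open DecSetoid D renaming (setoid to S)
    open Membership S using (_∈_)

    dedup-id : ∀ xs → length (deduplicate _≟_ xs) ≡ length xs → deduplicate _≟_ xs ≡ xs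
    dedup-id []       eq = ≡.refl
    dedup-id (x ∷ xs) eq = ≡.cong (x ∷_) (≡.trans (filter-complete _ f≡d) ih)
      where
      f≤d = length-filter (¬? ∘ (x ≟_)) (deduplicate _≟_ xs)
      d≤x = length-deduplicate _≟_ xs
      f≡x = ℕ.suc-injective eq
      ih  = dedup-id xs (ℕ.≤-antisym d≤x (≡.subst (ℕ._≤ _) f≡x f≤d))
      f≡d = ≡.trans f≡x (≡.cong length (≡.sym ih))

    All≉ : ∀ {x y xs} → All (λ z → ¬ x ≈ z) xs → y ∈ xs → ¬ x ≈ y
    All≉ (x≉z ∷ _) (here y≈z)  x≈y = x≉z (trans x≈y y≈z)
    All≉ (_ ∷ xs≉) (there y∈)  x≈y = All≉ xs≉ y∈ x≈y

    -- In a list without ≈-repetitions, ≈-related entries sit at the same place.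
    unique-index : ∀ {xs x y} → Unique S xs → (x∈ : x ∈ xs) (y∈ : y ∈ xs) → x ≈ y →
                   index x∈ ≡ index y∈
    unique-index _         (here _)    (here _)    _   = ≡.refl
    unique-index (x≉ ∷ _)  (here x≈z)  (there y∈)  x≈y =
      contradiction (trans (sym x≈z) x≈y) (All≉ x≉ y∈)
    unique-index (y≉ ∷ _)  (there x∈)  (here y≈z)  x≈y =
      contradiction (trans (sym y≈z) (sym x≈y)) (All≉ y≉ x∈)
    unique-index (_ ∷ xs!) (there x∈)  (there y∈)  x≈y =
      ≡.cong suc (unique-index xs! x∈ y∈ x≈y)

private
  module Coarsen {c ℓ ℓ′} {S : Setoid c ℓ} (fin : Finite S)
                 {_~_ : Rel (Setoid.Carrier S) ℓ′} (isEquiv : IsEquivalence _~_)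
                 (_~?_ : Decidable₂ _~_) (≈⇒~ : Setoid._≈_ S ⇒ _~_) where
    open Finite fin
    module S = Setoid S

    decSetoid~ : DecSetoid c ℓ′
    decSetoid~ = record
      { isDecEquivalence = record { isEquivalence = isEquiv ; _≟_ = _~?_ } }

    setoid~ : Setoid c ℓ′
    setoid~ = DecSetoid.setoid decSetoid~

    finite : Finite setoid~
    finite = record
      { _≟_        = _~?_
      ; elements   = deduplicate _~?_ elements
      ; enumerates = deduplicate⁺ decSetoid~ (λ x → Any.map ≈⇒~ (enumerates x))
      ; unique     = deduplicate-! decSetoid~ elements
      }

    order-< : ∀ {x y} → ¬ (x S.≈ y) → x ~ y → Finite.order finite ℕ.< order
    order-< {x} {y} x≉y x~y = ℕ.≤∧≢⇒< (length-deduplicate _~?_ elements) λ same →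
      x≉y (index-injective S (enumerates x) (enumerates y)
        (≡.trans (≡.sym (index~ x)) (≡.trans
          (unique-index decSetoid~
            (≡.subst (Unique setoid~) (dedup-id decSetoid~ elements same)
              (deduplicate-! decSetoid~ elements))
            (Any.map ≈⇒~ (enumerates x)) (Any.map ≈⇒~ (enumerates y)) x~y)
          (index~ y))))
      where
      index-map : ∀ {a p q} {A : Set a} {P : Pred A p} {Q : Pred A q} (f : P ⊆ Q)
                  {xs : List A} (pxs : Any P xs) → index (Any.map f pxs) ≡ index pxs
      index-map f (here _)    = ≡.refl
      index-map f (there pxs) = ≡.cong suc (index-map f pxs)
      index~ : ∀ z → index (Any.map ≈⇒~ (enumerates z)) ≡ index (enumerates z)
      index~ z = index-map ≈⇒~ (enumerates z)

record Ideal {c ℓ} (R : CommutativeRing c ℓ) p : Set (c ⊔ ℓ ⊔ lsuc p) where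
  open CommutativeRing R
  field
    Member   : Pred Carrier p
    resp     : Member Respects _≈_
    0∈       : Member 0#
    +-closed : ∀ {a b} → Member a → Member b → Member (a + b)
    *-closed : ∀ r {a} → Member a → Member (r * a)

  -‿closed : ∀ {a} → Member a → Member (- a)
  -‿closed {a} a∈ = resp (RingProperties.-1*x≈-x ring a) (*-closed (- 1#) a∈)

private
  module _ {c ℓ} (R : CommutativeRing c ℓ) where
    open CommutativeRing R
    open RingProperties ring

    interchange : ∀ a b c d → (a + b) + (c + d) ≈ (a + c) + (b + d)
    interchange a b c d = begin
      (a + b) + (c + d) ≈⟨ +-assoc a b (c + d) ⟩
      a + (b + (c + d)) ≈⟨ +-congˡ (+-assoc b c d) ⟨
      a + ((b + c) + d) ≈⟨ +-congˡ (+-congʳ (+-comm b c)) ⟩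
      a + ((c + b) + d) ≈⟨ +-congˡ (+-assoc c b d) ⟩
      a + (c + (b + d)) ≈⟨ +-assoc a c (b + d) ⟨
      (a + c) + (b + d) ∎
      where open ≈-Reasoning setoid

    -- (a - b) + (b - c) = a - c
    telescope : ∀ a b c → (a - b) + (b - c) ≈ a - c
    telescope a b c = begin
      (a - b) + (b - c)       ≈⟨ +-assoc a (- b) (b - c) ⟩
      a + (- b + (b - c))     ≈⟨ +-congˡ (+-assoc (- b) b (- c)) ⟨
      a + ((- b + b) - c)     ≈⟨ +-congˡ (+-congʳ (-‿inverseˡ b)) ⟩
      a + (0# - c)            ≈⟨ +-congˡ (+-identityˡ (- c)) ⟩
      a - c                   ∎
      where open ≈-Reasoning setoid

    neg-sub : ∀ a b → - (a - b) ≈ b - a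
    neg-sub a b = begin
      - (a - b)       ≈⟨ -‿+-comm a (- b) ⟨
      - a - - b       ≈⟨ +-congˡ (-‿involutive b) ⟩
      - a + b         ≈⟨ +-comm (- a) b ⟩
      b - a           ∎
      where open ≈-Reasoning setoid

    sub-distribˡ : ∀ r a b → r * (a - b) ≈ r * a - r * b
    sub-distribˡ r a b = trans (distribˡ r a (- b)) (+-congˡ (sym (-‿distribʳ-* r b)))

    sub-distribʳ : ∀ r a b → (a - b) * r ≈ a * r - b * r
    sub-distribʳ r a b = trans (distribʳ r a (- b)) (+-congˡ (sym (-‿distribˡ-* b r)))

    sub-zero : ∀ {a b} → a ≈ b → a - b ≈ 0#
    sub-zero {a} {b} a≈b = trans (+-congʳ a≈b) (-‿inverseʳ b)

    sub-zero⁻ : ∀ {a b} → a - b ≈ 0# → a ≈ b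
    sub-zero⁻ {a} {b} eq = begin
      a               ≈⟨ +-identityʳ a ⟨
      a + 0#          ≈⟨ +-congˡ (-‿inverseˡ b) ⟨
      a + (- b + b)   ≈⟨ +-assoc a (- b) b ⟨
      (a - b) + b     ≈⟨ +-congʳ eq ⟩
      0# + b          ≈⟨ +-identityˡ b ⟩
      b               ∎
      where open ≈-Reasoning setoid

module _ {c ℓ} (R : CommutativeRing c ℓ) where
  open CommutativeRing R
  open RingProperties ring

  principal : Carrier → Ideal R (c ⊔ ℓ)
  principal x = record
    { Member   = λ y → ∃[ a ] y ≈ a * x
    ; resp     = λ y≈z (a , y≈ax) → a , trans (sym y≈z) y≈ax
    ; 0∈       = 0# , sym (zeroˡ x)
    ; +-closed = λ (a , y≈ax) (b , z≈bx) →
        a + b , trans (+-cong y≈ax z≈bx) (sym (distribʳ x a b))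
    ; *-closed = λ r (a , y≈ax) → r * a , trans (*-congˡ y≈ax) (sym (*-assoc r a x))
    }

  annihilator : Carrier → Ideal R ℓ
  annihilator x = record
    { Member   = λ a → a * x ≈ 0#
    ; resp     = λ a≈b ax≈0 → trans (*-congʳ (sym a≈b)) ax≈0
    ; 0∈       = zeroˡ x
    ; +-closed = λ {a} {b} ax≈0 bx≈0 →
        trans (distribʳ x a b) (trans (+-cong ax≈0 bx≈0) (+-identityˡ 0#))
    ; *-closed = λ r {a} ax≈0 →
        trans (*-assoc r a x) (trans (*-congˡ ax≈0) (zeroʳ r))
    }

  module _ {p} (I : Ideal R p) where
    open Ideal I

    -- The quotient has the same carrier; equality is congruence modulo I.
    _≡_mod : Carrier → Carrier → Set p
    a ≡ b mod = Member (a - b)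

    ≈⇒mod : ∀ {a b} → a ≈ b → a ≡ b mod
    ≈⇒mod a≈b = resp (sym (sub-zero R a≈b)) 0∈

    quotient : CommutativeRing c p
    quotient = record
      { Carrier = Carrier ; _≈_ = _≡_mod
      ; _+_ = _+_ ; _*_ = _*_ ; -_ = -_ ; 0# = 0# ; 1# = 1#
      ; isCommutativeRing = record
        { isRing = record
          { +-isAbelianGroup = record
            { isGroup = record
              { isMonoid = record
                { isSemigroup = record
                  { isMagma = record
                    { isEquivalence = record
                      { refl  = ≈⇒mod refl
                      ; sym   = λ {a} {b} a-b → resp (neg-sub R a b) (-‿closed a-b)
                      ; trans = λ {a} {b} {d} a-b b-d →
                                  resp (telescope R a b d) (+-closed a-b b-d)
                      }
                    ; ∙-cong = λ {a} {b} {d} {e} a-b d-e →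
                        resp (trans (interchange R a (- b) d (- e))
                                    (+-congˡ (-‿+-comm b e)))
                             (+-closed a-b d-e)
                    }
                  ; assoc = λ a b d → ≈⇒mod (+-assoc a b d)
                  }
                ; identity = (λ a → ≈⇒mod (+-identityˡ a)) , (λ a → ≈⇒mod (+-identityʳ a))
                }
              ; inverse = (λ a → ≈⇒mod (-‿inverseˡ a)) , (λ a → ≈⇒mod (-‿inverseʳ a))
              ; ⁻¹-cong = λ {a} {b} a-b →
                  resp (sym (-‿+-comm a (- b))) (-‿closed a-b)
              }
            ; comm = λ a b → ≈⇒mod (+-comm a b)
            }
          ; *-cong = λ {a} {b} {d} {e} a-b d-e →
              resp (trans (+-cong (trans (*-comm d (a - b)) (sub-distribʳ R d a b))
                                  (sub-distribˡ R b d e))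
                          (telescope R (a * d) (b * d) (b * e)))
                   (+-closed (*-closed d a-b) (*-closed b d-e))
          ; *-assoc    = λ a b d → ≈⇒mod (*-assoc a b d)
          ; *-identity = (λ a → ≈⇒mod (*-identityˡ a)) , (λ a → ≈⇒mod (*-identityʳ a))
          ; distrib    = (λ a b d → ≈⇒mod (distribˡ a b d)) , (λ a b d → ≈⇒mod (distribʳ a b d))
          }
        ; *-comm = λ a b → ≈⇒mod (*-comm a b)
        }
      }

record FiniteRing c ℓ : Set (lsuc (c ⊔ ℓ)) where
  field
    commutativeRing : CommutativeRing c ℓ
    finite          : Finite (CommutativeRing.setoid commutativeRing)
  open CommutativeRing commutativeRing public
  open Finite finite public

  IsUnit : Pred Carrier (c ⊔ ℓ)
  IsUnit a = ∃[ b ] a * b ≈ 1#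

  IsUnit-resp : IsUnit Respects _≈_
  IsUnit-resp a≈b (d , ad≈1) = d , trans (*-congʳ (sym a≈b)) ad≈1

  isUnit? : Decidable IsUnit
  isUnit? a = ∃? (λ b≈d ab≈1 → trans (*-congˡ (sym b≈d)) ab≈1) (λ b → a * b ≟ 1#)

  units : List Carrier
  units = filter isUnit? elements

  φ : ℕ
  φ = length units

  instance
    φ≢0 : NonZero φ
    φ≢0 = NonZero-length
      (∈-filter⁺ setoid isUnit? IsUnit-resp (enumerates 1#) (1# , *-identityˡ 1#))

  IsField : Set (c ⊔ ℓ)
  IsField = ¬ (1# ≈ 0#) × (∀ a → ¬ (a ≈ 0#) → IsUnit a)

  isField? : Dec IsField
  isField? = ¬? (1# ≟ 0#) ×-dec
    ∀? (λ a≈b h b≉0 → IsUnit-resp a≈b (h (b≉0 ∘ trans (sym a≈b))))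
       (λ a → ¬? (a ≟ 0#) →-dec isUnit? a)

module _ {c ℓ} (R : FiniteRing c ℓ) where
  open FiniteRing R

  private
    module Quotient {p} (I : Ideal commutativeRing p) (I? : Decidable (Ideal.Member I)) where
      module Q = CommutativeRing (quotient commutativeRing I)
      open Coarsen finite Q.isEquivalence (λ a b → I? (a - b)) (≈⇒mod commutativeRing I)
        using (order-<) renaming (finite to finiteQ) public

  quotientᶠ : ∀ {p} (I : Ideal commutativeRing p) → Decidable (Ideal.Member I) → FiniteRing c p
  quotientᶠ I I? = record
    { commutativeRing = quotient commutativeRing I
    ; finite          = Quotient.finiteQ I I?
    }

  infix 5 _/Ann_
  _/Ann_ : Carrier → FiniteRing c ℓ
  _/Ann_ x = quotientᶠ (annihilator commutativeRing x) (λ a → a * x ≟ 0#)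

module _ {c ℓ} (R : CommutativeRing c ℓ) {p : Level} where

  IsProper : Pred (Ideal R p) p
  IsProper I = ¬ Ideal.Member I (CommutativeRing.1# R)

  IsMaximal : Pred (Ideal R p) (c ⊔ ℓ ⊔ lsuc p)
  IsMaximal M = IsProper M ×
    (∀ J → IsProper J → Ideal.Member M ⊆ Ideal.Member J → Ideal.Member J ⊆ Ideal.Member M)

IsLocal : ∀ {c ℓ} → FiniteRing c ℓ → Set (lsuc (c ⊔ ℓ))
IsLocal {c} {ℓ} T =
  ∃[ M ] IsMaximal R {c ⊔ ℓ} M ×
         (∀ M′ → IsMaximal R {c ⊔ ℓ} M′ → Ideal.Member M′ ≐ Ideal.Member M)
  where R = FiniteRing.commutativeRing T

∏ : ∀ {c ℓ} → List (FiniteRing c ℓ) → CommutativeRing c ℓ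
∏ {c} {ℓ} [] = record
  { isCommutativeRing = record
    { isRing = Ring.isRing (Terminal.ring {c} {ℓ}) ; *-comm = λ _ _ → tt } }
∏ (T ∷ Ts) = DirectProduct.commutativeRing (FiniteRing.commutativeRing T) (∏ Ts)

record LocalDecomposition {c ℓ} (T : FiniteRing c ℓ) : Set (lsuc (c ⊔ ℓ)) where
  field
    factors : List (FiniteRing c ℓ)
    local   : All (IsLocal {c} {ℓ}) factors
    to      : FiniteRing.Carrier T → CommutativeRing.Carrier (∏ factors)
    to-iso  : IsRingIsomorphism (FiniteRing.rawRing T) (CommutativeRing.rawRing (∏ factors)) to

-- Every finite ring is a product of local rings: split along idempotents.
private
  module _ {c ℓ : Level} where
    private module P (Ts : List (FiniteRing c ℓ)) = CommutativeRing (∏ Ts)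
    open P using () renaming (Carrier to ⟦_⟧)

    module _ {Us : List (FiniteRing c ℓ)} where

      combine : ∀ Ts → ⟦ Ts ⟧ → ⟦ Us ⟧ → ⟦ Ts ++ Us ⟧
      combine []       _        v = v
      combine (T ∷ Ts) (t , ts) v = t , combine Ts ts v

      combine-cong : ∀ Ts {u u′ v v′} → P._≈_ Ts u u′ → P._≈_ Us v v′ →
                     P._≈_ (Ts ++ Us) (combine Ts u v) (combine Ts u′ v′)
      combine-cong []       _        q = q
      combine-cong (T ∷ Ts) (p , ps) q = p , combine-cong Ts ps q

      combine-inj : ∀ Ts {u u′ v v′} →
                    P._≈_ (Ts ++ Us) (combine Ts u v) (combine Ts u′ v′) →
                    P._≈_ Ts u u′ × P._≈_ Us v v′
      combine-inj []       q        = tt , q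
      combine-inj (T ∷ Ts) (p , q) = let ps , r = combine-inj Ts q in (p , ps) , r

      combine-surj : ∀ Ts w → ∃[ u ] ∃[ v ] P._≈_ (Ts ++ Us) (combine Ts u v) w
      combine-surj []       w       = tt , w , P.refl Us
      combine-surj (T ∷ Ts) (t , w) =
        let u , v , eq = combine-surj Ts w in (t , u) , v , FiniteRing.refl T , eq

      combine-+ : ∀ Ts u u′ v v′ → P._≈_ (Ts ++ Us)
                  (combine Ts (P._+_ Ts u u′) (P._+_ Us v v′))
                  (P._+_ (Ts ++ Us) (combine Ts u v) (combine Ts u′ v′))
      combine-+ []       _        _          v v′ = P.refl Us
      combine-+ (T ∷ Ts) (t , u) (t′ , u′) v v′ = FiniteRing.refl T , combine-+ Ts u u′ v v′

      combine-* : ∀ Ts u u′ v v′ → P._≈_ (Ts ++ Us)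
                  (combine Ts (P._*_ Ts u u′) (P._*_ Us v v′))
                  (P._*_ (Ts ++ Us) (combine Ts u v) (combine Ts u′ v′))
      combine-* []       _        _          v v′ = P.refl Us
      combine-* (T ∷ Ts) (t , u) (t′ , u′) v v′ = FiniteRing.refl T , combine-* Ts u u′ v v′

      combine-neg : ∀ Ts u v → P._≈_ (Ts ++ Us)
                    (combine Ts (P.-_ Ts u) (P.-_ Us v)) (P.-_ (Ts ++ Us) (combine Ts u v))
      combine-neg []       _       v = P.refl Us
      combine-neg (T ∷ Ts) (t , u) v = FiniteRing.refl T , combine-neg Ts u v

      combine-0 : ∀ Ts → P._≈_ (Ts ++ Us) (combine Ts (P.0# Ts) (P.0# Us)) (P.0# (Ts ++ Us))
      combine-0 []       = P.refl Us
      combine-0 (T ∷ Ts) = FiniteRing.refl T , combine-0 Ts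

      combine-1 : ∀ Ts → P._≈_ (Ts ++ Us) (combine Ts (P.1# Ts) (P.1# Us)) (P.1# (Ts ++ Us))
      combine-1 []       = P.refl Us
      combine-1 (T ∷ Ts) = FiniteRing.refl T , combine-1 Ts

    module _ (T : FiniteRing c ℓ) where
      open FiniteRing T

      mkIso : ∀ Ts (f : Carrier → ⟦ Ts ⟧) →
        (∀ {a b} → a ≈ b → P._≈_ Ts (f a) (f b)) →
        (∀ a b → P._≈_ Ts (f (a + b)) (P._+_ Ts (f a) (f b))) →
        (∀ a b → P._≈_ Ts (f (a * b)) (P._*_ Ts (f a) (f b))) →
        (∀ a → P._≈_ Ts (f (- a)) (P.-_ Ts (f a))) →
        P._≈_ Ts (f 0#) (P.0# Ts) → P._≈_ Ts (f 1#) (P.1# Ts) →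
        (∀ {a b} → P._≈_ Ts (f a) (f b) → a ≈ b) →
        (∀ w → ∃[ a ] P._≈_ Ts (f a) w) →
        IsRingIsomorphism rawRing (P.rawRing Ts) f
      mkIso Ts f f-cong f+ f* f- f0 f1 inj surj = record
        { isRingMonomorphism = record
          { isRingHomomorphism = record
            { isSemiringHomomorphism = record
              { isNearSemiringHomomorphism = record
                { +-isMonoidHomomorphism = record
                  { isMagmaHomomorphism = record
                    { isRelHomomorphism = record { cong = f-cong } ; homo = f+ }
                  ; ε-homo = f0
                  }
                ; *-homo = f*
                }
              ; 1#-homo = f1
              }
            ; -‿homo = f-
            }
          ; injective = inj
          }
        ; surjective = λ w → let a , fa≈w = surj w in
            a , λ z≈a → P.trans Ts (f-cong z≈a) fa≈w
        }

      trivial : 1# ≈ 0# → LocalDecomposition T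
      trivial 1≈0 = record
        { factors = [] ; local = [] ; to = λ _ → tt
        ; to-iso = mkIso [] (λ _ → tt) (λ _ → tt) (λ _ _ → tt) (λ _ _ → tt) (λ _ → tt) tt tt
            (λ {a} {b} _ → trans (all≈0 a) (sym (all≈0 b))) (λ _ → 0# , tt)
        }
        where
        all≈0 : ∀ a → a ≈ 0#
        all≈0 a = trans (sym (*-identityʳ a)) (trans (*-congˡ 1≈0) (zeroʳ a))

      single : IsLocal T → LocalDecomposition T
      single loc = record
        { factors = [ T ] ; local = loc ∷ [] ; to = λ a → a , tt
        ; to-iso = mkIso [ T ] (λ a → a , tt) (λ a≈b → a≈b , tt) (λ _ _ → refl , tt)
            (λ _ _ → refl , tt) (λ _ → refl , tt) (refl , tt) (refl , tt) proj₁
            (λ (a , _) → a , refl , tt)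
        }

      module _ {e e′ : Carrier} (ee : e * e ≈ e) (e′e′ : e′ * e′ ≈ e′)
               (ee′ : e * e′ ≈ 0#) (e+e′ : e + e′ ≈ 1#)
               (A : LocalDecomposition (T /Ann e)) (B : LocalDecomposition (T /Ann e′)) where
        private
          module A = LocalDecomposition A
          module B = LocalDecomposition B
          module fA = IsRingIsomorphism A.to-iso
          module fB = IsRingIsomorphism B.to-iso
          Ts = A.factors
          Us = B.factors
          open ≈-Reasoning setoid

          combine′ = combine {Us} Ts
          f : Carrier → ⟦ Ts ++ Us ⟧
          f a = combine′ (A.to a) (B.to a)

          via : ∀ {u u′ v v′ w} → P._≈_ Ts u u′ → P._≈_ Us v v′ →
                P._≈_ (Ts ++ Us) (combine′ u′ v′) w → P._≈_ (Ts ++ Us) (combine′ u v) w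
          via p q r = P.trans (Ts ++ Us) (combine-cong Ts p q) r

          ≈A : ∀ {a b} → a ≈ b → FiniteRing._≈_ (T /Ann e) a b
          ≈A = ≈⇒mod commutativeRing (annihilator commutativeRing e)
          ≈B : ∀ {a b} → a ≈ b → FiniteRing._≈_ (T /Ann e′) a b
          ≈B = ≈⇒mod commutativeRing (annihilator commutativeRing e′)

          inj : ∀ {a b} → P._≈_ (Ts ++ Us) (f a) (f b) → a ≈ b
          inj {a} {b} eq = sub-zero⁻ commutativeRing (begin
            a - b                     ≈⟨ *-identityʳ (a - b) ⟨
            (a - b) * 1#              ≈⟨ *-congˡ e+e′ ⟨
            (a - b) * (e + e′)        ≈⟨ distribˡ (a - b) e e′ ⟩
            (a - b) * e + (a - b) * e′ ≈⟨ +-cong (fA.injective (proj₁ same)) (fB.injective (proj₂ same)) ⟩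
            0# + 0#                   ≈⟨ +-identityˡ 0# ⟩
            0#                        ∎)
            where same = combine-inj Ts eq

          glue : ∀ a b {e e′} → e * e ≈ e → e′ * e ≈ 0# → (a * e + b * e′) * e ≈ a * e
          glue a b {e} {e′} ee e′e = begin
            (a * e + b * e′) * e         ≈⟨ distribʳ e (a * e) (b * e′) ⟩
            (a * e) * e + (b * e′) * e   ≈⟨ +-cong (*-assoc a e e) (*-assoc b e′ e) ⟩
            a * (e * e) + b * (e′ * e)   ≈⟨ +-cong (*-congˡ ee) (trans (*-congˡ e′e) (zeroʳ b)) ⟩
            a * e + 0#                   ≈⟨ +-identityʳ (a * e) ⟩
            a * e                        ∎

          mod : ∀ {x a e} → x * e ≈ a * e → (x - a) * e ≈ 0#
          mod {x} {a} {e} eq = trans (sub-distribʳ commutativeRing e x a) (sub-zero commutativeRing eq)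

          surj : ∀ w → ∃[ a ] P._≈_ (Ts ++ Us) (f a) w
          surj w =
            let u , v , eq = combine-surj {Us} Ts w
                a , fa = fA.surjective u
                b , fb = fB.surjective v
            in a * e + b * e′ ,
               via (fA.⟦⟧-cong (mod (glue a b ee (trans (*-comm e′ e) ee′))))
                   (fB.⟦⟧-cong (mod (trans (*-congʳ (+-comm (a * e) (b * e′)))
                                           (glue b a e′e′ ee′))))
                   (via (fa (≈A refl)) (fb (≈B refl)) eq)

        split : LocalDecomposition T
        split = record
          { factors = Ts ++ Us ; local = ++⁺ A.local B.local ; to = f
          ; to-iso = mkIso (Ts ++ Us) f
              (λ a≈b → combine-cong Ts (fA.⟦⟧-cong (≈A a≈b)) (fB.⟦⟧-cong (≈B a≈b)))
              (λ a b → via (fA.+-homo a b) (fB.+-homo a b)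
                           (combine-+ Ts (A.to a) (A.to b) (B.to a) (B.to b)))
              (λ a b → via (fA.*-homo a b) (fB.*-homo a b)
                           (combine-* Ts (A.to a) (A.to b) (B.to a) (B.to b)))
              (λ a → via (fA.-‿homo a) (fB.-‿homo a) (combine-neg Ts (A.to a) (B.to a)))
              (via fA.0#-homo fB.0#-homo (combine-0 Ts))
              (via fA.1#-homo fB.1#-homo (combine-1 Ts))
              inj surj
          }

      order-/Ann : ∀ e {e′} → e′ * e ≈ 0# → ¬ (e′ ≈ 0#) → FiniteRing.order (T /Ann e) ℕ.< order
      order-/Ann e {e′} e′e e′≉0 =
        Coarsen.order-< finite (CommutativeRing.isEquivalence (quotient commutativeRing Ann))
          (λ a b → (a - b) * e ≟ 0#) (≈⇒mod commutativeRing Ann)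
          e′≉0 (trans (*-congʳ e′-0) e′e)
        where
        Ann = annihilator commutativeRing e
        e′-0 : e′ - 0# ≈ e′
        e′-0 = trans (+-congˡ (RingProperties.-0#≈0# ring)) (+-identityʳ e′)

      NontrivialIdempotent : Pred Carrier ℓ
      NontrivialIdempotent e = e * e ≈ e × ¬ (e ≈ 0#) × ¬ (e ≈ 1#)

      nontrivialIdempotent? : Dec (∃ NontrivialIdempotent)
      nontrivialIdempotent? = ∃?
        (λ a≈b (aa , a≉0 , a≉1) →
           trans (*-cong (sym a≈b) (sym a≈b)) (trans aa a≈b) ,
           a≉0 ∘ trans a≈b , a≉1 ∘ trans a≈b)
        (λ e → e * e ≟ e ×-dec ¬? (e ≟ 0#) ×-dec ¬? (e ≟ 1#))

      module _ (1≉0 : ¬ (1# ≈ 0#)) (indecomposable : ¬ ∃ NontrivialIdempotent) where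
        private
          open Exponentiation semiring using (_^_; ^-homo-*)
          open ≈-Reasoning setoid

          -- Some positive power of a is idempotent.
          idempotentPower : ∀ a → ∃[ k ] (a ^ suc k) * (a ^ suc k) ≈ a ^ suc k
          idempotentPower a
            with i , j , i<j , same ← Fin.pigeonhole {order} {suc order} ℕ.≤-refl
                   (λ i → index (enumerates (a ^ toℕ i)))
            = k , idem
            where
            aⁱ≈aʲ : a ^ toℕ i ≈ a ^ toℕ j
            aⁱ≈aʲ = index-injective setoid (enumerates _) (enumerates _) same
            d = toℕ j ℕ.∸ suc (toℕ i)
            p = suc d
            j≡ : toℕ j ≡ p ℕ.+ toℕ i
            j≡ = ≡.trans (≡.sym (ℕ.m∸n+n≡m i<j)) (ℕ.+-suc d (toℕ i))
            shift : ∀ t → a ^ (t ℕ.* p ℕ.+ toℕ i) ≈ a ^ toℕ i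
            shift zero    = refl
            shift (suc t) = begin
              a ^ (p ℕ.+ t ℕ.* p ℕ.+ toℕ i)     ≡⟨ ≡.cong (a ^_) (ℕ.+-assoc p (t ℕ.* p) (toℕ i)) ⟩
              a ^ (p ℕ.+ (t ℕ.* p ℕ.+ toℕ i))   ≈⟨ ^-homo-* a p _ ⟩
              a ^ p * a ^ (t ℕ.* p ℕ.+ toℕ i)   ≈⟨ *-congˡ (shift t) ⟩
              a ^ p * a ^ toℕ i                 ≈⟨ ^-homo-* a p (toℕ i) ⟨
              a ^ (p ℕ.+ toℕ i)                 ≡⟨ ≡.cong (a ^_) j≡ ⟨
              a ^ toℕ j                         ≈⟨ aⁱ≈aʲ ⟨
              a ^ toℕ i                         ∎
            k = d ℕ.+ toℕ i ℕ.* p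
            K = suc (toℕ i) ℕ.* p
            r = K ℕ.∸ toℕ i
            i≤K : toℕ i ℕ.≤ K
            i≤K = ℕ.≤-trans (ℕ.m≤m*n (toℕ i) p) (ℕ.m≤n+m _ p)
            r+i : r ℕ.+ toℕ i ≡ K
            r+i = ℕ.m∸n+n≡m i≤K
            idem : a ^ K * a ^ K ≈ a ^ K
            idem = begin
              a ^ K * a ^ K                   ≡⟨ ≡.cong (λ m → a ^ K * a ^ m) r+i ⟨
              a ^ K * a ^ (r ℕ.+ toℕ i)       ≈⟨ *-congˡ (^-homo-* a r (toℕ i)) ⟩
              a ^ K * (a ^ r * a ^ toℕ i)     ≈⟨ *-congˡ (*-comm (a ^ r) (a ^ toℕ i)) ⟩
              a ^ K * (a ^ toℕ i * a ^ r)     ≈⟨ *-assoc (a ^ K) (a ^ toℕ i) (a ^ r) ⟨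
              a ^ K * a ^ toℕ i * a ^ r       ≈⟨ *-congʳ (^-homo-* a K (toℕ i)) ⟨
              a ^ (K ℕ.+ toℕ i) * a ^ r       ≈⟨ *-congʳ (shift (suc (toℕ i))) ⟩
              a ^ toℕ i * a ^ r               ≈⟨ *-comm (a ^ toℕ i) (a ^ r) ⟩
              a ^ r * a ^ toℕ i               ≈⟨ ^-homo-* a r (toℕ i) ⟨
              a ^ (r ℕ.+ toℕ i)               ≡⟨ ≡.cong (a ^_) r+i ⟩
              a ^ K                           ∎

          nonunit⇒nilpotent : ∀ a → ¬ IsUnit a → ∃[ k ] a ^ k ≈ 0#
          nonunit⇒nilpotent a a∉U with k , idem ← idempotentPower a
            with a ^ suc k ≟ 0# | a ^ suc k ≟ 1#
          ... | yes ≈0 | _      = suc k , ≈0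
          ... | _      | yes ≈1 = contradiction (a ^ k , ≈1) a∉U
          ... | no ≉0  | no ≉1  = contradiction (a ^ suc k , idem , ≉0 , ≉1) indecomposable

          -- (1 - a)(1 + a + ⋯ + aᵏ⁻¹) = 1 - aᵏ
          geometric : ∀ {a b} → a + b ≈ 1# → ∀ k → ∃[ s ] b * s + a ^ k ≈ 1#
          geometric {a} {b} a+b zero    = 0# , trans (+-congʳ (zeroʳ b)) (+-identityˡ 1#)
          geometric {a} {b} a+b (suc k) = let s , eq = geometric a+b k in s + a ^ k , (begin
            b * (s + a ^ k) + a * a ^ k         ≈⟨ +-congʳ (distribˡ b s (a ^ k)) ⟩
            b * s + b * a ^ k + a * a ^ k       ≈⟨ +-assoc (b * s) _ _ ⟩
            b * s + (b * a ^ k + a * a ^ k)     ≈⟨ +-congˡ (distribʳ (a ^ k) b a) ⟨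
            b * s + (b + a) * a ^ k             ≈⟨ +-congˡ (*-congʳ (trans (+-comm b a) a+b)) ⟩
            b * s + 1# * a ^ k                  ≈⟨ +-congˡ (*-identityˡ (a ^ k)) ⟩
            b * s + a ^ k                       ≈⟨ eq ⟩
            1#                                  ∎)

          unit-factor : ∀ {a v} → IsUnit (a * v) → IsUnit a
          unit-factor {a} {v} (d , eq) = v * d , trans (sym (*-assoc a v d)) eq

          +-nonunit : ∀ {a b} → ¬ IsUnit a → ¬ IsUnit b → ¬ IsUnit (a + b)
          +-nonunit {a} {b} a∉U b∉U (v , eq) =
            let k , aᵏ≈0 = nonunit⇒nilpotent (a * v) (a∉U ∘ unit-factor)
                s , bs+aᵏ = geometric (trans (sym (distribʳ v a b)) eq) k
            in b∉U (unit-factor (s , trans (sym (+-identityʳ _)) (trans (+-congˡ (sym aᵏ≈0)) bs+aᵏ)))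

          nonunits : Ideal commutativeRing (c ⊔ ℓ)
          nonunits = record
            { Member   = λ a → ¬ IsUnit a
            ; resp     = λ a≈b a∉U → a∉U ∘ IsUnit-resp (sym a≈b)
            ; 0∈       = λ (d , 0d≈1) → 1≉0 (trans (sym 0d≈1) (zeroˡ d))
            ; +-closed = +-nonunit
            ; *-closed = λ r {a} a∉U → a∉U ∘ unit-factor ∘ IsUnit-resp (*-comm r a)
            }

          proper⊆nonunits : ∀ {p} (J : Ideal commutativeRing p) → IsProper commutativeRing J →
                            ∀ {a} → Ideal.Member J a → ¬ IsUnit a
          proper⊆nonunits J 1∉J {a} a∈J (b , ab≈1) =
            1∉J (Ideal.resp J (trans (*-comm b a) ab≈1) (Ideal.*-closed J b a∈J))

          nonunits-proper : IsProper commutativeRing nonunits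
          nonunits-proper 1∉U = 1∉U (1# , *-identityˡ 1#)

        indecomposable⇒local : IsLocal T
        indecomposable⇒local = nonunits ,
          (nonunits-proper , λ J 1∉J _ → proper⊆nonunits J 1∉J) ,
          λ M (1∉M , max) → proper⊆nonunits M 1∉M ,
            max nonunits nonunits-proper (proper⊆nonunits M 1∉M)

    decompose′ : (T : FiniteRing c ℓ) → Acc ℕ._<_ (FiniteRing.order T) → LocalDecomposition T
    decompose′ T (acc rec) with FiniteRing._≟_ T (FiniteRing.1# T) (FiniteRing.0# T)
    ... | yes 1≈0 = trivial T 1≈0
    ... | no  1≉0 with nontrivialIdempotent? T
    ...   | no  ¬∃e = single T (indecomposable⇒local T 1≉0 ¬∃e)
    ...   | yes (e , ee , e≉0 , e≉1) =
      split T ee (complement-idem ) ee′ e+e′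
        (decompose′ (T /Ann e) (rec (order-/Ann T e (trans (*-comm e′ e) ee′) e′≉0)))
        (decompose′ (T /Ann e′) (rec (order-/Ann T e′ ee′ e≉0)))
      where
      open FiniteRing T
      open ≈-Reasoning setoid
      e′ = 1# - e
      ee′ : e * e′ ≈ 0#
      ee′ = begin
        e * (1# - e)     ≈⟨ sub-distribˡ commutativeRing e 1# e ⟩
        e * 1# - e * e   ≈⟨ sub-zero commutativeRing (trans (*-identityʳ e) (sym ee)) ⟩
        0#               ∎
      e+e′ : e + e′ ≈ 1#
      e+e′ = begin
        e + (1# - e)     ≈⟨ +-comm e (1# - e) ⟩
        1# - e + e       ≈⟨ +-assoc 1# (- e) e ⟩
        1# + (- e + e)   ≈⟨ +-congˡ (-‿inverseˡ e) ⟩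
        1# + 0#          ≈⟨ +-identityʳ 1# ⟩
        1#               ∎
      complement-idem : e′ * e′ ≈ e′
      complement-idem = begin
        e′ * e′            ≈⟨ +-identityˡ (e′ * e′) ⟨
        0# + e′ * e′       ≈⟨ +-congʳ ee′ ⟨
        e * e′ + e′ * e′   ≈⟨ distribʳ e′ e e′ ⟨
        (e + e′) * e′      ≈⟨ *-congʳ e+e′ ⟩
        1# * e′            ≈⟨ *-identityˡ e′ ⟩
        e′                 ∎
      e′≉0 : ¬ (e′ ≈ 0#)
      e′≉0 e′≈0 = e≉1 (sym (sub-zero⁻ commutativeRing e′≈0))

decompose : ∀ {c ℓ} (T : FiniteRing c ℓ) → LocalDecomposition T
decompose T = decompose′ T (<-wellFounded (FiniteRing.order T))

φ-ratio : ∀ {c ℓ} → FiniteRing c ℓ → FiniteRing c ℓ → ℚ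
φ-ratio T U = + FiniteRing.φ T ℚ./ FiniteRing.φ U
  where open FiniteRing U using (φ≢0)

-- μ does not depend on which decomposition into local rings is used.
μ : ∀ {c ℓ} → FiniteRing c ℓ → ℤ
μ T = if does (FiniteRing.order T ℕ.≟ 1) then 1ℤ
      else if does (All.all? FiniteRing.isField? factors) then -1ℤ ℤ.^ length factors
      else 0ℤ
  where open LocalDecomposition (decompose T)

ℤ/_ : ℕ → CommutativeRing 0ℓ 0ℓ
ℤ/ n = quotient ℤ.+-*-commutativeRing (principal ℤ.+-*-commutativeRing (+ n))

-- A finite ℤ/n-algebra (structure map ι) with a fixed non-degenerate functional ψ.
-- Elements of ℤ/n are represented by integers, with equality modulo n.
record SymmetricAlgebra (n : ℕ) c ℓ : Set (lsuc (c ⊔ ℓ)) where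
  field
    finiteRing : FiniteRing c ℓ
  open FiniteRing finiteRing public
  open CommutativeRing (ℤ/ n) using () renaming (_≈_ to _≈ₙ_) public
  field
    ι             : ℤ → Carrier
    ι-isHom       : IsRingHomomorphism (CommutativeRing.rawRing (ℤ/ n)) rawRing ι
    ψ             : Carrier → ℤ
    ψ-cong        : ∀ {a b} → a ≈ b → ψ a ≈ₙ ψ b
    ψ-additive    : ∀ a b → ψ (a + b) ≈ₙ ψ a ℤ.+ ψ b
    ψ-homogeneous : ∀ k a → ψ (ι k * a) ≈ₙ k ℤ.* ψ a
    nondegenerate : (I : Ideal commutativeRing (c ⊔ ℓ)) →
                    (∀ {a} → Ideal.Member I a → ψ a ≈ₙ 0ℤ) →
                    ∀ {a} → Ideal.Member I a → a ≈ 0#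

-- R / Ann(x) with the functional ψₓ(a) = ψ(ax).
infixl 5 _/Annˢ_
_/Annˢ_ : ∀ {n c ℓ} (R : SymmetricAlgebra n c ℓ) → SymmetricAlgebra.Carrier R →
          SymmetricAlgebra n c ℓ
_/Annˢ_ {n} {c} {ℓ} R x = record
  { finiteRing = finiteRing /Ann x
  ; ι       = ι
  ; ι-isHom = record
    { isSemiringHomomorphism = record
      { isNearSemiringHomomorphism = record
        { +-isMonoidHomomorphism = record
          { isMagmaHomomorphism = record
            { isRelHomomorphism = record { cong = λ k≈l → ⇒ (ι.⟦⟧-cong k≈l) }
            ; homo = λ k l → ⇒ (ι.+-homo k l)
            }
          ; ε-homo = ⇒ ι.0#-homo
          }
        ; *-homo = λ k l → ⇒ (ι.*-homo k l)
        }
      ; 1#-homo = ⇒ ι.1#-homo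
      }
    ; -‿homo = λ k → ⇒ (ι.-‿homo k)
    }
  ; ψ             = λ a → ψ (a * x)
  ; ψ-cong        = λ a-b → ψ-cong (⇐ a-b)
  ; ψ-additive    = λ a b → ψ-via (distribʳ x a b) (ψ-additive (a * x) (b * x))
  ; ψ-homogeneous = λ k a → ψ-via (*-assoc (ι k) a x) (ψ-homogeneous k (a * x))
  ; nondegenerate = λ J J⊆ker {a} a∈J → ⇒₀ (nondegenerate (J·x J)
      (λ (b , b∈J , r≈bx) → ψ-via {m = 0ℤ} r≈bx (J⊆ker b∈J)) (a , a∈J , refl))
  }
  where
  open SymmetricAlgebra R
  module ι  = IsRingHomomorphism ι-isHom
  Q = quotient commutativeRing (annihilator commutativeRing x)

  ψ-via : ∀ {a b m} → a ≈ b → ψ b ≈ₙ m → ψ a ≈ₙ m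
  ψ-via {a} {b} {m} a≈b = CommutativeRing.trans (ℤ/ n) {ψ a} {ψ b} {m} (ψ-cong a≈b)

  ⇒ : ∀ {a b} → a ≈ b → (a - b) * x ≈ 0#
  ⇒ = ≈⇒mod commutativeRing (annihilator commutativeRing x)

  ⇐ : ∀ {a b} → (a - b) * x ≈ 0# → a * x ≈ b * x
  ⇐ {a} {b} eq = sub-zero⁻ commutativeRing
    (trans (sym (sub-distribʳ commutativeRing x a b)) eq)

  ⇒₀ : ∀ {a} → a * x ≈ 0# → (a - 0#) * x ≈ 0#
  ⇒₀ {a} ax≈0 = trans (sub-distribʳ commutativeRing x a 0#)
    (sub-zero commutativeRing (trans ax≈0 (sym (zeroˡ x))))

  J·x : Ideal Q (c ⊔ ℓ) → Ideal commutativeRing (c ⊔ ℓ)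
  J·x J = record
    { Member   = λ r → ∃[ b ] J.Member b × r ≈ b * x
    ; resp     = λ r≈s (b , b∈J , r≈bx) → b , b∈J , trans (sym r≈s) r≈bx
    ; 0∈       = 0# , J.0∈ , sym (zeroˡ x)
    ; +-closed = λ (a , a∈J , r≈ax) (b , b∈J , s≈bx) →
        a + b , J.+-closed a∈J b∈J , trans (+-cong r≈ax s≈bx) (sym (distribʳ x a b))
    ; *-closed = λ s (b , b∈J , r≈bx) →
        s * b , J.*-closed s b∈J , trans (*-congˡ r≈bx) (sym (*-assoc s b x))
    }
    where module J = Ideal J

open RawRing ℂ-rawRing public using ()
  renaming (_≈_ to _≈ᶜ_; _+_ to _+ᶜ_; _*_ to _*ᶜ_; -_ to -ᶜ_; 0# to 0ᶜ; 1# to 1ᶜ)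
open RawSemiringDefinitions (RawRing.rawSemiring ℂ-rawRing) public using ()
  renaming (_^_ to _^ᶜ_; sum to ∑)

Matrix : ℕ → Set
Matrix m = Fin m → Fin m → ℂ

-- Laplace expansion along the first row.
det : ∀ {m} → Matrix m → ℂ
det {zero}  A = 1ᶜ
det {suc m} A = ∑ λ j →
  (((-ᶜ 1ᶜ) ^ᶜ toℕ j) *ᶜ A zero j) *ᶜ det (λ i k → A (suc i) (punchIn j k))

-- The characteristic polynomial det(tI - A), as a function of t ∈ ℂ.
charPoly : ∀ {m} → Matrix m → ℂ → ℂ
charPoly A t = det λ i j → (if does (i Fin.≟ j) then t else 0ᶜ) +ᶜ (-ᶜ A i j)

-- The list es is, up to order, the multiset of eigenvalues of A with their
-- multiplicities: det(tI - A) = ∏ (t - e).  As ℂ is infinite, equality at every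
-- t is equality of polynomials.
HasEigenvalues : ∀ {m} → Matrix m → List ℂ → Set
HasEigenvalues A es = ∀ t → charPoly A t ≈ᶜ foldr _*ᶜ_ 1ᶜ (map (λ e → t +ᶜ (-ᶜ e)) es)

IsPrimitiveRoot : ℕ → ℂ → Set
IsPrimitiveRoot n ζ = ζ ^ᶜ n ≈ᶜ 1ᶜ × (∀ m → 0 ℕ.< m → m ℕ.< n → ¬ (ζ ^ᶜ m ≈ᶜ 1ᶜ))

-- The generalized Ramanujan sum: ∑ ζ^ψ(gu) over the units u of R.  The exponent
-- is the residue in {0, …, n-1}.
ramanujan : ∀ {n c ℓ} .{{_ : NonZero n}} → ℂ → (R : SymmetricAlgebra n c ℓ) →
            SymmetricAlgebra.Carrier R → ℂ
ramanujan {n} ζ R g = foldr _+ᶜ_ 0ᶜ (map (λ u → ζ ^ᶜ (ψ (g * u) %ℕ n)) units)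
  where open SymmetricAlgebra R

record Graph c ℓ e : Set (lsuc (c ⊔ ℓ ⊔ e)) where
  field
    vertices : Setoid c ℓ
    finite   : Finite vertices
  open Setoid vertices
  field
    Adj       : Rel Carrier e
    adj?      : Decidable₂ Adj
    adj-resp  : ∀ {x x′ y y′} → x ≈ x′ → y ≈ y′ → Adj x y → Adj x′ y′
    adj-sym   : ∀ {x y} → Adj x y → Adj y x
    adj-irrefl : ∀ {x} → ¬ Adj x x

adjacencyMatrix : ∀ {c ℓ e} (G : Graph c ℓ e) → Matrix (Finite.order (Graph.finite G))
adjacencyMatrix G i j = if does (adj? (lookup elements i) (lookup elements j)) then 1ᶜ else 0ᶜ
  where
  open Graph G
  open Finite finite

IsSpectrum : ∀ {c ℓ e} → Graph c ℓ e → List ℂ → Set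
IsSpectrum G = HasEigenvalues (adjacencyMatrix G)

module _ {c ℓ} (R : FiniteRing c ℓ) where
  open FiniteRing R

  ⟨_⟩ : Carrier → Pred Carrier (c ⊔ ℓ)
  ⟨ x ⟩ = Ideal.Member (principal commutativeRing x)

  -- The set D = {Rx₁, …, Rxₖ}.
  record PrincipalIdeals (k : ℕ) : Set (c ⊔ ℓ) where
    field
      generator : Fin k → Carrier
      nonzero   : ∀ i → ¬ (⟨ generator i ⟩ ⊆ (_≈ 0#))
      distinct  : ∀ {i j} → i ≢ j → ¬ (⟨ generator i ⟩ ≐ ⟨ generator j ⟩)

  private
    ∈⇒⊆ : ∀ {x y} → ⟨ y ⟩ x → ⟨ x ⟩ ⊆ ⟨ y ⟩
    ∈⇒⊆ {x} {y} x∈ (a , z≈ax) = resp (sym z≈ax) (*-closed a x∈)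
      where open Ideal (principal commutativeRing y)

    self∈ : ∀ x → ⟨ x ⟩ x
    self∈ x = 1# , sym (*-identityˡ x)

    ∈? : ∀ x y → Dec (⟨ x ⟩ y)
    ∈? x y = ∃? (λ a≈b y≈ax → trans y≈ax (*-congʳ a≈b)) (λ a → y ≟ a * x)

    ≐? : ∀ x y → Dec (⟨ x ⟩ ≐ ⟨ y ⟩)
    ≐? x y = map′ (λ (x∈ , y∈) → ∈⇒⊆ x∈ , ∈⇒⊆ y∈)
                  (λ (x⊆ , y⊆) → x⊆ (self∈ x) , y⊆ (self∈ y))
                  (∈? y x ×-dec ∈? x y)

    ≈⇒∈ : ∀ {x y} → x ≈ y → ⟨ y ⟩ x
    ≈⇒∈ {x} {y} x≈y = 1# , trans x≈y (sym (*-identityˡ y))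

    neg∈ : ∀ x y → ⟨ x - y ⟩ (y - x)
    neg∈ x y = Ideal.resp P (neg-sub commutativeRing x y) (Ideal.-‿closed P (self∈ (x - y)))
      where P = principal commutativeRing (x - y)

    ≐-∈ : ∀ {x y z} → ⟨ x ⟩ y → ⟨ y ⟩ x → ⟨ x ⟩ ≐ ⟨ z ⟩ → ⟨ y ⟩ ≐ ⟨ z ⟩
    ≐-∈ y∈ x∈ (x⊆ , z⊆) = (λ p → x⊆ (∈⇒⊆ y∈ p)) , (λ p → ∈⇒⊆ x∈ (z⊆ p))

  gcdGraph : ∀ {k} → PrincipalIdeals k → Graph c ℓ (c ⊔ ℓ)
  gcdGraph D = record
    { vertices   = setoid
    ; finite     = finite
    ; Adj        = λ x y → ∃[ i ] ⟨ x - y ⟩ ≐ ⟨ generator i ⟩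
    ; adj?       = λ x y → Fin.any? (λ i → ≐? (x - y) (generator i))
    ; adj-resp   = λ x≈x′ y≈y′ (i , eq) →
        let d = +-cong x≈x′ (-‿cong y≈y′) in i , ≐-∈ (≈⇒∈ (sym d)) (≈⇒∈ d) eq
    ; adj-sym    = λ {x} {y} (i , eq) → i , ≐-∈ (neg∈ x y) (neg∈ y x) eq
    ; adj-irrefl = λ {x} (i , _ , gen⊆) → nonzero i λ y∈ →
        let a , y≈a[x-x] = gen⊆ y∈ in
        trans y≈a[x-x] (trans (*-congˡ (-‿inverseʳ x)) (zeroʳ a))
    }
    where open PrincipalIdeals D

{-# OPTIONS --safe #-}

-- The functions y ↦ ζ^ψ(gy) are eigenvectors of the adjacency matrix: translating
-- y by x turns the row sum at x into ζ^ψ(gx) · ∑ ζ^ψ(gs), where s runs over the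
-- generators of the ideals Rxᵢ, and u ↦ u xᵢ identifies the units of R/Ann(xᵢ)
-- with the generators of Rxᵢ.  Since ψ is non-degenerate, these eigenvectors form
-- a matrix P with P* P = |R| I, which by multiplicativity of determinants fixes
-- the characteristic polynomial.
--
-- For the value of c(g, R/Ann(x)), the units of R/Ann(x) map onto those of
-- R/Ann(gx) with fibres of equal size, which leaves ∑ χ(u) over the units u of a
-- ring with a non-degenerate character χ.  This sum is multiplicative over the
-- local factors.  For a field it is -χ(0) = -1; for any other local ring there is
-- a nonzero non-unit a, translation by r a permutes the units, and χ(r a) ≠ 1 for
-- some r, so the sum vanishes.

module Submission where

open import Defs
open import Algebra.Bundles using (CommutativeRing; Semiring; RawNearSemiring; RawRing; RawSemiring)
import Algebra.Construct.DirectProduct as DirectProduct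
import Algebra.Definitions.RawMonoid
import Algebra.Definitions.RawSemiring
open import Algebra.Morphism.Structures using (IsRingHomomorphism; IsRingIsomorphism)
import Algebra.Properties.CommutativeSemiring.Exp as CommutativeExponentiation
import Algebra.Properties.Ring
import Algebra.Properties.Semiring.Exp as Exponentiation
import Algebra.Properties.Semiring.Sum
open import Data.Bool using (true; false; _∧_; if_then_else_)
open import Data.Fin using (Fin; zero; suc; inject₁; punchIn; punchOut; toℕ; _<_)
import Data.Fin.Induction as Fin
import Data.Fin.Properties as Fin
open import Data.Integer as ℤ using (ℤ; +_; 0ℤ; 1ℤ; -1ℤ)
open import Data.Integer.DivMod using (_%ℕ_; _/ℕ_; a≡a%ℕn+[a/ℕn]*n; n%ℕd<d)
import Data.Integer.Properties as ℤ
import Data.Integer.Solver as ℤSolver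
open import Data.List as List using (List; []; _∷_; _++_; cartesianProduct; filter; foldr; length; map)
open import Data.List.Membership.Propositional.Properties using (∈-lookup)
open import Data.List.Membership.Setoid using (_∈_)
open import Data.List.Membership.Setoid.Properties using (index-injective)
open import Data.List.Properties using (map-∘)
open import Data.List.Relation.Unary.All as All using (All; []; _∷_)
open import Data.List.Relation.Unary.AllPairs using ([]; _∷_)
open import Data.List.Relation.Unary.Any using (here; there; index)
import Data.List.Relation.Unary.Enumerates.Setoid.Properties as Enumerates
open import Data.List.Relation.Unary.Unique.Setoid using (Unique)
import Data.List.Relation.Unary.Unique.Setoid.Properties as Unique
open import Data.Nat as ℕ using (ℕ; zero; suc; NonZero)
import Data.Nat.DivMod as ℕ
import Data.Nat.Properties as ℕ
open import Data.Product using (_×_; _,_; ∃; proj₁; proj₂)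
open import Data.Rational as ℚ using (ℚ; 0ℚ; 1ℚ; ½; ∣_∣)
import Data.Rational.Properties as ℚ
import Data.Rational.Solver as ℚSolver
open import Data.Rational.Unnormalised as ℚᵘ using (mkℚᵘ; *≡*)
import Data.Rational.Unnormalised.Properties as ℚᵘ
open import Data.Sum using (inj₁; inj₂)
open import Data.Unit using (⊤; tt)
import Data.Unit.Polymorphic as Unit
open import Function using (_∘_; id; mk⇔)
open import Level using (Level; _⊔_; 0ℓ)
open import Relation.Binary using (IsEquivalence; Setoid; _Preserves_⟶_; _Respects_)
open import Relation.Binary.Definitions using (tri<; tri≈; tri>)
open import Relation.Binary.PropositionalEquality as ≡ using (_≡_; _≢_)
open import Relation.Nullary using (Dec; ¬_; yes; no; does; contradiction; _×-dec_)
open import Relation.Nullary.Decidable using (decidable-stable; does-⇔; ¬?)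
open import Relation.Unary using (Pred; Decidable; _⊆_; _≐_)

-- Equality on ℂ is undecidable, and an element merely known to be nonzero has no inverse at hand.
-- Divisions are therefore carried as products and undone by cancellation: if xy = 0 and x is not 0,
-- then y = 0. This survives constructively because a Cauchy sequence for which every positive lower
-- bound is refuted already tends to 0. Thus P* P = |R| I yields |R|^|R| det(tI - A) = |R|^|R| ∏ (t
-- - λ), and c(g, R/Ann(x)) is first found multiplied by φ(R/Ann(gx)); characteristic 0 allows both
-- integers to be cancelled.
--
-- The argument runs over a commutative ring K with this cancellation property. Complex conjugation
-- of χ(a) becomes χ(-a), and multiplicativity of determinants comes from the fact that an
-- alternating form is determined by its value at the identity matrix.
--
-- That units of R/Ann(x) reach all units of R/Ann(gx) rests on finiteness: some power of a lift v
-- generates an idempotent on whose factor v is invertible, and off that factor v may be changed to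
-- 1. Existence statements, such as an r with χ(ra) ≠ 1, come from refuting their absence over a
-- finite ring, where search is decidable.

-- Rational sequences tending to 0

module NullSequences where
  open ℚSolver.+-*-Solver using (solve; _:+_; _:*_; _:-_; :-_; _:=_; con)

  Null : (ℕ → ℚ) → Set
  Null s = ∀ ε → 0ℚ ℚ.< ε → ∃ λ N → ∀ n → N ℕ.≤ n → ∣ s n ∣ ℚ.< ε

  -- The positive counterpart of `¬ Null`: estimates that divide by the sequence need the bound δ,
  -- which a mere negation does not provide.
  Apart : (ℕ → ℚ) → Set
  Apart s = ∃ λ δ → 0ℚ ℚ.< δ × ∃ λ N → ∀ n → N ℕ.≤ n → δ ℚ.≤ ∣ s n ∣

  0<-* : ∀ {a b} → 0ℚ ℚ.< a → 0ℚ ℚ.< b → 0ℚ ℚ.< a ℚ.* b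
  0<-* {a} {b} 0<a 0<b = ≡.subst (ℚ._< a ℚ.* b) (ℚ.*-zeroʳ a)
    (ℚ.*-monoʳ-<-pos a {{ℚ.positive 0<a}} 0<b)

  0<½* : ∀ {ε} → 0ℚ ℚ.< ε → 0ℚ ℚ.< ½ ℚ.* ε
  0<½* = 0<-* (ℚ.positive⁻¹ ½)

  split : ∀ a b → a ≡ (a ℚ.- b) ℚ.+ b
  split = solve 2 (λ a b → a := (a :- b) :+ b) ≡.refl

  <⇒≱ : ∀ {a b} → a ℚ.< b → ¬ b ℚ.≤ a
  <⇒≱ a<b b≤a = ℚ.<-irrefl ≡.refl (ℚ.<-≤-trans a<b b≤a)

  halves : ∀ ε → ½ ℚ.* ε ℚ.+ ½ ℚ.* ε ≡ ε
  halves ε = ≡.trans (≡.sym (ℚ.*-distribʳ-+ ε ½ ½)) (ℚ.*-identityˡ ε)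

  *-mono-≤-∣∣ : ∀ {a b} x y → 0ℚ ℚ.< a → 0ℚ ℚ.< b → a ℚ.≤ ∣ x ∣ → b ℚ.≤ ∣ y ∣ →
                a ℚ.* b ℚ.≤ ∣ x ℚ.* y ∣
  *-mono-≤-∣∣ {a} {b} x y 0<a 0<b a≤ b≤ = begin
    a ℚ.* b           ≤⟨ ℚ.*-monoʳ-≤-nonNeg b {{ℚ.nonNegative (ℚ.<⇒≤ 0<b)}} a≤ ⟩
    ∣ x ∣ ℚ.* b       ≤⟨ ℚ.*-monoˡ-≤-nonNeg ∣ x ∣ {{ℚ.∣-∣-nonNeg x}} b≤ ⟩
    ∣ x ∣ ℚ.* ∣ y ∣   ≡⟨ ℚ.∣p*q∣≡∣p∣*∣q∣ x y ⟨
    ∣ x ℚ.* y ∣       ∎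
    where open ℚ.≤-Reasoning

  null-resp : ∀ {s t} → (∀ k → s k ≡ t k) → Null s → Null t
  null-resp s≗t null ε 0<ε = let N , small = null ε 0<ε in
    N , λ n N≤n → ≡.subst (λ z → ∣ z ∣ ℚ.< ε) (s≗t n) (small n N≤n)

  null-0 : Null (λ _ → 0ℚ)
  null-0 ε 0<ε = 0 , λ _ _ → 0<ε

  null-+ : ∀ {s t} → Null s → Null t → Null (λ k → s k ℚ.+ t k)
  null-+ {s} {t} null-s null-t ε 0<ε =
    let M , s< = null-s (½ ℚ.* ε) (0<½* 0<ε)
        N , t< = null-t (½ ℚ.* ε) (0<½* 0<ε)
    in M ℕ.⊔ N , λ n M⊔N≤n → begin-strict
      ∣ s n ℚ.+ t n ∣           ≤⟨ ℚ.∣p+q∣≤∣p∣+∣q∣ (s n) (t n) ⟩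
      ∣ s n ∣ ℚ.+ ∣ t n ∣       <⟨ ℚ.+-mono-< (s< n (ℕ.m⊔n≤o⇒m≤o M N M⊔N≤n))
                                              (t< n (ℕ.m⊔n≤o⇒n≤o M N M⊔N≤n)) ⟩
      ½ ℚ.* ε ℚ.+ ½ ℚ.* ε       ≡⟨ halves ε ⟩
      ε                         ∎
    where open ℚ.≤-Reasoning

  null-neg : ∀ {s} → Null s → Null (λ k → ℚ.- s k)
  null-neg {s} null ε 0<ε = let N , small = null ε 0<ε in
    N , λ n N≤n → ≡.subst (ℚ._< ε) (≡.sym (ℚ.∣-p∣≡∣p∣ (s n))) (small n N≤n)

  cauchy-bounded : ∀ {s} → IsCauchy s →
    ∃ λ B → 0ℚ ℚ.< B × ∃ λ N → ∀ n → N ℕ.≤ n → ∣ s n ∣ ℚ.≤ B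
  cauchy-bounded {s} cauchy = let N , close = cauchy 1ℚ (ℚ.positive⁻¹ 1ℚ) in
    1ℚ ℚ.+ ∣ s N ∣ ,
    ℚ.+-mono-<-≤ (ℚ.positive⁻¹ 1ℚ) (ℚ.0≤∣p∣ (s N)) ,
    N , λ n N≤n → begin
      ∣ s n ∣                           ≡⟨ ≡.cong ∣_∣ (split (s n) (s N)) ⟩
      ∣ (s n ℚ.- s N) ℚ.+ s N ∣         ≤⟨ ℚ.∣p+q∣≤∣p∣+∣q∣ (s n ℚ.- s N) (s N) ⟩
      ∣ s n ℚ.- s N ∣ ℚ.+ ∣ s N ∣       ≤⟨ ℚ.+-monoˡ-≤ ∣ s N ∣ (ℚ.<⇒≤ (close n N N≤n ℕ.≤-refl)) ⟩
      1ℚ ℚ.+ ∣ s N ∣                    ∎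
    where
    open ℚ.≤-Reasoning

  null-*-bounded : ∀ {s t : ℕ → ℚ} {B} → 0ℚ ℚ.< B → (∃ λ N → ∀ n → N ℕ.≤ n → ∣ t n ∣ ℚ.≤ B) →
                   Null s → Null (λ k → s k ℚ.* t k)
  null-*-bounded {s} {t} {B} 0<B (M , t≤) null ε 0<ε =
    let N , s< = null (ε ℚ.* 1/B) (0<-* 0<ε (ℚ.positive⁻¹ 1/B {{ℚ.1/pos⇒pos B}}))
    in M ℕ.⊔ N , λ n M⊔N≤n → begin-strict
      ∣ s n ℚ.* t n ∣         ≡⟨ ℚ.∣p*q∣≡∣p∣*∣q∣ (s n) (t n) ⟩
      ∣ s n ∣ ℚ.* ∣ t n ∣     ≤⟨ ℚ.*-monoˡ-≤-nonNeg ∣ s n ∣ {{ℚ.∣-∣-nonNeg (s n)}}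
                                   (t≤ n (ℕ.m⊔n≤o⇒m≤o M N M⊔N≤n)) ⟩
      ∣ s n ∣ ℚ.* B           <⟨ ℚ.*-monoˡ-<-pos B (s< n (ℕ.m⊔n≤o⇒n≤o M N M⊔N≤n)) ⟩
      ε ℚ.* 1/B ℚ.* B         ≡⟨ ℚ.*-assoc ε 1/B B ⟩
      ε ℚ.* (1/B ℚ.* B)       ≡⟨ ≡.cong (ε ℚ.*_) (ℚ.*-inverseˡ B) ⟩
      ε ℚ.* 1ℚ                ≡⟨ ℚ.*-identityʳ ε ⟩
      ε                       ∎
    where
    open ℚ.≤-Reasoning
    instance
      B-positive : ℚ.Positive B
      B-positive = ℚ.positive 0<B
      B-nonZero : ℚ.NonZero B
      B-nonZero = ℚ.pos⇒nonZero B
    1/B = ℚ.1/ B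

  null-* : ∀ {s t} → IsCauchy t → Null s → Null (λ k → s k ℚ.* t k)
  null-* {s} {t} cauchy = let B , 0<B , t≤ = cauchy-bounded {t} cauchy in
    null-*-bounded {s} {t} 0<B t≤

  -- A late term of `s` of size at least ε would make the product at least ε δ. The order on ℚ is
  -- decidable, so refuting this suffices.
  null-cancel-apart : ∀ {s t} → Apart t → Null (λ k → s k ℚ.* t k) → Null s
  null-cancel-apart {s} {t} (δ , 0<δ , M , δ≤t) null ε 0<ε =
    let N , st< = null (ε ℚ.* δ) (0<-* 0<ε 0<δ) in
    M ℕ.⊔ N , λ n M⊔N≤n → ℚ.≰⇒> λ ε≤s → <⇒≱
      (st< n (ℕ.m⊔n≤o⇒n≤o M N M⊔N≤n))
      (*-mono-≤-∣∣ (s n) (t n) 0<ε 0<δ ε≤s (δ≤t n (ℕ.m⊔n≤o⇒m≤o M N M⊔N≤n)))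

  ¬null-apart : ∀ {s} → Apart s → ¬ Null s
  ¬null-apart (δ , 0<δ , M , δ≤s) null = let N , s< = null δ 0<δ in
    <⇒≱ (s< (M ℕ.⊔ N) (ℕ.m≤n⊔m M N)) (δ≤s (M ℕ.⊔ N) (ℕ.m≤m⊔n M N))

  -- A single rational comparison decides. Choose N with all later terms within ε/4 of `s N`. Either
  -- `s N` is smaller than ε/2 in size, and every later term is below ε, or every later term is at
  -- least ε/4, which is apartness.
  ¬apart⇒null : ∀ {s} → IsCauchy s → ¬ Apart s → Null s
  ¬apart⇒null {s} cauchy ¬apart ε 0<ε
    with cauchy (½ ℚ.* (½ ℚ.* ε)) (0<½* (0<½* 0<ε))
  ... | N , close with ∣ s N ∣ ℚ.<? ½ ℚ.* ε
  ...   | yes s< = N , λ n N≤n → begin-strict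
    ∣ s n ∣                                 ≡⟨ ≡.cong ∣_∣ (split (s n) (s N)) ⟩
    ∣ (s n ℚ.- s N) ℚ.+ s N ∣               ≤⟨ ℚ.∣p+q∣≤∣p∣+∣q∣ (s n ℚ.- s N) (s N) ⟩
    ∣ s n ℚ.- s N ∣ ℚ.+ ∣ s N ∣             <⟨ ℚ.+-mono-< (close n N N≤n ℕ.≤-refl) s< ⟩
    ½ ℚ.* (½ ℚ.* ε) ℚ.+ ½ ℚ.* ε             ≤⟨ ℚ.+-monoˡ-≤ (½ ℚ.* ε) quarter≤half ⟩
    ½ ℚ.* ε ℚ.+ ½ ℚ.* ε                     ≡⟨ halves ε ⟩
    ε                                       ∎
    where
    open ℚ.≤-Reasoning
    quarter≤half : ½ ℚ.* (½ ℚ.* ε) ℚ.≤ ½ ℚ.* ε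
    quarter≤half = ≡.subst (½ ℚ.* (½ ℚ.* ε) ℚ.≤_) (halves (½ ℚ.* ε))
      (≡.subst (ℚ._≤ ½ ℚ.* (½ ℚ.* ε) ℚ.+ ½ ℚ.* (½ ℚ.* ε)) (ℚ.+-identityʳ _)
        (ℚ.+-monoʳ-≤ (½ ℚ.* (½ ℚ.* ε)) (ℚ.<⇒≤ (0<½* (0<½* 0<ε)))))
  ...   | no s≮ = contradiction (η , 0<½* (0<½* 0<ε) , N , bound) ¬apart
    where
    open ℚ.≤-Reasoning
    η = ½ ℚ.* (½ ℚ.* ε)
    bound : ∀ n → N ℕ.≤ n → η ℚ.≤ ∣ s n ∣
    bound n N≤n = ℚ.≮⇒≥ λ s<η → s≮ (begin-strict
      ∣ s N ∣                           ≡⟨ ≡.cong ∣_∣ (split (s N) (s n)) ⟩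
      ∣ (s N ℚ.- s n) ℚ.+ s n ∣         ≤⟨ ℚ.∣p+q∣≤∣p∣+∣q∣ (s N ℚ.- s n) (s n) ⟩
      ∣ s N ℚ.- s n ∣ ℚ.+ ∣ s n ∣       <⟨ ℚ.+-mono-< (close N n ℕ.≤-refl N≤n) s<η ⟩
      η ℚ.+ η                           ≡⟨ halves (½ ℚ.* ε) ⟩
      ½ ℚ.* ε                           ∎)

  -- `¬ Null s` yields no lower bound for `s`, so the roles are exchanged: a lower bound for `t`,
  -- assumed in order to refute it, divides `t` out and makes `s` null.
  null-noZeroDivisors : ∀ {s t} → IsCauchy t → Null (λ k → s k ℚ.* t k) → ¬ Null s → Null t
  null-noZeroDivisors {s} {t} cauchy null ¬null = ¬apart⇒null {t} cauchy λ apart →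
    ¬null (null-cancel-apart {s} {t} apart null)

  0≤∣∣² : ∀ a → 0ℚ ℚ.≤ ∣ a ∣ ℚ.* ∣ a ∣
  0≤∣∣² a = ≡.subst (ℚ._≤ ∣ a ∣ ℚ.* ∣ a ∣) (ℚ.*-zeroʳ ∣ a ∣)
    (ℚ.*-monoˡ-≤-nonNeg ∣ a ∣ {{ℚ.∣-∣-nonNeg a}} (ℚ.0≤∣p∣ a))

  -- Apartness of `s` with bound δ would pass to the sum with bound δ², since adding a square does
  -- not decrease it.
  null-sumOfSquares : ∀ {s t : ℕ → ℚ} → IsCauchy s → Null (λ k → s k ℚ.* s k ℚ.+ t k ℚ.* t k) → Null s
  null-sumOfSquares {s} {t} cauchy null = ¬apart⇒null {s} cauchy λ (δ , 0<δ , N , δ≤s) →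
    ¬null-apart {λ k → s k ℚ.* s k ℚ.+ t k ℚ.* t k} (δ ℚ.* δ , 0<-* 0<δ 0<δ , N , λ n N≤n → begin
      δ ℚ.* δ                               ≤⟨ *-mono-≤-∣∣ (s n) (s n) 0<δ 0<δ (δ≤s n N≤n) (δ≤s n N≤n) ⟩
      ∣ s n ℚ.* s n ∣                       ≡⟨ ℚ.0≤p⇒∣p∣≡p (0≤² (s n)) ⟩
      s n ℚ.* s n                           ≡⟨ ℚ.+-identityʳ (s n ℚ.* s n) ⟨
      s n ℚ.* s n ℚ.+ 0ℚ                    ≤⟨ ℚ.+-monoʳ-≤ (s n ℚ.* s n) (0≤² (t n)) ⟩
      s n ℚ.* s n ℚ.+ t n ℚ.* t n           ≡⟨ ℚ.0≤p⇒∣p∣≡p (ℚ.+-mono-≤ {0ℚ} {s n ℚ.* s n} {0ℚ} (0≤² (s n)) (0≤² (t n))) ⟨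
      ∣ s n ℚ.* s n ℚ.+ t n ℚ.* t n ∣       ∎) null
    where
    open ℚ.≤-Reasoning
    0≤² : ∀ a → 0ℚ ℚ.≤ a ℚ.* a
    0≤² a with ℚ.∣p∣≡p∨∣p∣≡-p a
    ... | inj₁ ∣a∣≡a  = ≡.subst (0ℚ ℚ.≤_) (≡.cong₂ ℚ._*_ ∣a∣≡a ∣a∣≡a) (0≤∣∣² a)
    ... | inj₂ ∣a∣≡-a = ≡.subst (0ℚ ℚ.≤_) (≡.trans (≡.cong₂ ℚ._*_ ∣a∣≡-a ∣a∣≡-a)
      (solve 1 (λ a → (:- a) :* (:- a) := a :* a) ≡.refl a)) (0≤∣∣² a)

-- The complex numbers as a commutative ring without zero divisors

module ComplexNumbers where
  open NullSequences
  open ℚSolver.+-*-Solver using (solve; _:+_; _:*_; _:-_; :-_; _:=_; con)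
  open ℝ
  open ℂ

  -- The ring laws of ℝ hold at every index as laws of ℚ; limits enter only through the equivalence
  -- and the congruences.
  pointwise : ∀ x y → (∀ k → seq x k ≡ seq y k) → x ≈ℝ y
  pointwise x y x≗y = null-resp {λ _ → 0ℚ} {λ k → seq x k ℚ.- seq y k}
    (λ k → ≡.sym (≡.trans (≡.cong (ℚ._- seq y k) (x≗y k)) (ℚ.+-inverseʳ (seq y k)))) null-0

  ≈ℝ-isEquivalence : IsEquivalence _≈ℝ_
  ≈ℝ-isEquivalence = record
    { refl  = λ {x} → pointwise x x λ _ → ≡.refl
    ; sym   = λ {x} {y} x≈y → null-resp {λ k → ℚ.- (seq x k ℚ.- seq y k)}
        (λ k → solve 2 (λ a b → :- (a :- b) := b :- a) ≡.refl (seq x k) (seq y k))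
        (null-neg {λ k → seq x k ℚ.- seq y k} x≈y)
    ; trans = λ {x} {y} {z} x≈y y≈z →
        null-resp {λ k → (seq x k ℚ.- seq y k) ℚ.+ (seq y k ℚ.- seq z k)}
        (λ k → solve 3 (λ a b c → (a :- b) :+ (b :- c) := a :- c) ≡.refl
                 (seq x k) (seq y k) (seq z k))
        (null-+ {λ k → seq x k ℚ.- seq y k} {λ k → seq y k ℚ.- seq z k} x≈y y≈z)
    }

  +ℝ-cong : ∀ {x y u v} → x ≈ℝ y → u ≈ℝ v → x +ℝ u ≈ℝ y +ℝ v
  +ℝ-cong {x} {y} {u} {v} x≈y u≈v =
    null-resp {λ k → (seq x k ℚ.- seq y k) ℚ.+ (seq u k ℚ.- seq v k)}
      (λ k → solve 4 (λ a b c d → (a :- b) :+ (c :- d) := (a :+ c) :- (b :+ d)) ≡.refl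
               (seq x k) (seq y k) (seq u k) (seq v k))
      (null-+ {λ k → seq x k ℚ.- seq y k} {λ k → seq u k ℚ.- seq v k} x≈y u≈v)

  -- The difference of the products splits into two terms, each a null factor times a Cauchy, hence
  -- bounded, one.
  *ℝ-cong : ∀ {x y u v} → x ≈ℝ y → u ≈ℝ v → x *ℝ u ≈ℝ y *ℝ v
  *ℝ-cong {x} {y} {u} {v} x≈y u≈v =
    null-resp {λ k → (seq x k ℚ.- seq y k) ℚ.* seq u k ℚ.+ (seq u k ℚ.- seq v k) ℚ.* seq y k}
      (λ k → solve 4 (λ a b c d → (a :- b) :* c :+ (c :- d) :* b := a :* c :- b :* d) ≡.refl
               (seq x k) (seq y k) (seq u k) (seq v k))
      (null-+ {λ k → (seq x k ℚ.- seq y k) ℚ.* seq u k} {λ k → (seq u k ℚ.- seq v k) ℚ.* seq y k}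
        (null-* {λ k → seq x k ℚ.- seq y k} {seq u} (cauchy u) x≈y)
        (null-* {λ k → seq u k ℚ.- seq v k} {seq y} (cauchy y) u≈v))

  -ℝ-cong : ∀ {x y} → x ≈ℝ y → -ℝ x ≈ℝ -ℝ y
  -ℝ-cong {x} {y} x≈y = null-resp {λ k → ℚ.- (seq x k ℚ.- seq y k)}
    (λ k → solve 2 (λ a b → :- (a :- b) := (:- a) :- (:- b)) ≡.refl (seq x k) (seq y k))
    (null-neg {λ k → seq x k ℚ.- seq y k} x≈y)

  ℝ-commutativeRing : CommutativeRing 0ℓ 0ℓ
  ℝ-commutativeRing = record
    { Carrier = ℝ ; _≈_ = _≈ℝ_ ; _+_ = _+ℝ_ ; _*_ = _*ℝ_ ; -_ = -ℝ_
    ; 0# = ℚ⇒ℝ 0ℚ ; 1# = ℚ⇒ℝ 1ℚ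
    ; isCommutativeRing = record
      { isRing = record
        { +-isAbelianGroup = record
          { isGroup = record
            { isMonoid = record
              { isSemigroup = record
                { isMagma = record
                  { isEquivalence = ≈ℝ-isEquivalence
                  ; ∙-cong = λ {x} {y} {u} {v} → +ℝ-cong {x} {y} {u} {v}
                  }
                ; assoc = λ x y z → pointwise ((x +ℝ y) +ℝ z) (x +ℝ (y +ℝ z))
                    λ k → ℚ.+-assoc (seq x k) (seq y k) (seq z k)
                }
              ; identity = (λ x → pointwise (ℚ⇒ℝ 0ℚ +ℝ x) x λ k → ℚ.+-identityˡ (seq x k))
                         , (λ x → pointwise (x +ℝ ℚ⇒ℝ 0ℚ) x λ k → ℚ.+-identityʳ (seq x k))
              }
            ; inverse = (λ x → pointwise (-ℝ x +ℝ x) (ℚ⇒ℝ 0ℚ) λ k → ℚ.+-inverseˡ (seq x k))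
                      , (λ x → pointwise (x +ℝ -ℝ x) (ℚ⇒ℝ 0ℚ) λ k → ℚ.+-inverseʳ (seq x k))
            ; ⁻¹-cong = λ {x} {y} → -ℝ-cong {x} {y}
            }
          ; comm = λ x y → pointwise (x +ℝ y) (y +ℝ x) λ k → ℚ.+-comm (seq x k) (seq y k)
          }
        ; *-cong = λ {x} {y} {u} {v} → *ℝ-cong {x} {y} {u} {v}
        ; *-assoc = λ x y z → pointwise ((x *ℝ y) *ℝ z) (x *ℝ (y *ℝ z))
            λ k → ℚ.*-assoc (seq x k) (seq y k) (seq z k)
        ; *-identity = (λ x → pointwise (ℚ⇒ℝ 1ℚ *ℝ x) x λ k → ℚ.*-identityˡ (seq x k))
                     , (λ x → pointwise (x *ℝ ℚ⇒ℝ 1ℚ) x λ k → ℚ.*-identityʳ (seq x k))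
        ; distrib = (λ x y z → pointwise (x *ℝ (y +ℝ z)) (x *ℝ y +ℝ x *ℝ z)
                       λ k → ℚ.*-distribˡ-+ (seq x k) (seq y k) (seq z k))
                  , (λ x y z → pointwise ((y +ℝ z) *ℝ x) (y *ℝ x +ℝ z *ℝ x)
                       λ k → ℚ.*-distribʳ-+ (seq x k) (seq y k) (seq z k))
        }
      ; *-comm = λ x y → pointwise (x *ℝ y) (y *ℝ x) λ k → ℚ.*-comm (seq x k) (seq y k)
      }
    }

  module ℝ-ring = CommutativeRing ℝ-commutativeRing

  -- Every ring law of ℂ is, in each component and at each index, a polynomial
  -- identity between rationals.
  ℂ-commutativeRing : CommutativeRing 0ℓ 0ℓ
  ℂ-commutativeRing = record
    { Carrier = ℂ ; _≈_ = _≈ᶜ_ ; _+_ = _+ᶜ_ ; _*_ = _*ᶜ_ ; -_ = -ᶜ_ ; 0# = 0ᶜ ; 1# = 1ᶜ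
    ; isCommutativeRing = record
      { isRing = record
        { +-isAbelianGroup = record
          { isGroup = record
            { isMonoid = record
              { isSemigroup = record
                { isMagma = record
                  { isEquivalence = record
                    { refl  = λ {x} → ℝ-ring.refl {re x} , ℝ-ring.refl {im x}
                    ; sym   = λ {x} {y} (p , q) → ℝ-ring.sym {re x} {re y} p , ℝ-ring.sym {im x} {im y} q
                    ; trans = λ {x} {y} {z} (p , q) (p′ , q′) →
                        ℝ-ring.trans {re x} {re y} {re z} p p′ , ℝ-ring.trans {im x} {im y} {im z} q q′
                    }
                  ; ∙-cong = λ {x} {y} {u} {v} (p , q) (p′ , q′) →
                      ℝ-ring.+-cong {re x} {re y} {re u} {re v} p p′ ,
                      ℝ-ring.+-cong {im x} {im y} {im u} {im v} q q′
                  }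
                ; assoc = λ x y z → ℝ-ring.+-assoc (re x) (re y) (re z) , ℝ-ring.+-assoc (im x) (im y) (im z)
                }
              ; identity = (λ x → ℝ-ring.+-identityˡ (re x) , ℝ-ring.+-identityˡ (im x))
                         , (λ x → ℝ-ring.+-identityʳ (re x) , ℝ-ring.+-identityʳ (im x))
              }
            ; inverse = (λ x → ℝ-ring.-‿inverseˡ (re x) , ℝ-ring.-‿inverseˡ (im x))
                      , (λ x → ℝ-ring.-‿inverseʳ (re x) , ℝ-ring.-‿inverseʳ (im x))
            ; ⁻¹-cong = λ {x} {y} (p , q) →
                ℝ-ring.-‿cong {re x} {re y} p , ℝ-ring.-‿cong {im x} {im y} q
            }
          ; comm = λ x y → ℝ-ring.+-comm (re x) (re y) , ℝ-ring.+-comm (im x) (im y)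
          }
        ; *-cong = λ {x} {y} {u} {v} (p , q) (p′ , q′) →
            ℝ-ring.+-cong {re x *ℝ re u} {re y *ℝ re v} { -ℝ (im x *ℝ im u)} { -ℝ (im y *ℝ im v)}
              (ℝ-ring.*-cong {re x} {re y} {re u} {re v} p p′)
              (ℝ-ring.-‿cong {im x *ℝ im u} {im y *ℝ im v}
                (ℝ-ring.*-cong {im x} {im y} {im u} {im v} q q′)) ,
            ℝ-ring.+-cong {re x *ℝ im u} {re y *ℝ im v} {im x *ℝ re u} {im y *ℝ re v}
              (ℝ-ring.*-cong {re x} {re y} {im u} {im v} p q′)
              (ℝ-ring.*-cong {im x} {im y} {re u} {re v} q p′)
        ; *-assoc = λ x y z →
            pointwise (re ((x *ᶜ y) *ᶜ z)) (re (x *ᶜ (y *ᶜ z))) (λ k →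
              solve 6 (λ a b c d e f →
                  (a :* c :- b :* d) :* e :- (a :* d :+ b :* c) :* f
                  := a :* (c :* e :- d :* f) :- b :* (c :* f :+ d :* e)) ≡.refl
                (seq (re x) k) (seq (im x) k) (seq (re y) k) (seq (im y) k) (seq (re z) k) (seq (im z) k)) ,
            pointwise (im ((x *ᶜ y) *ᶜ z)) (im (x *ᶜ (y *ᶜ z))) (λ k →
              solve 6 (λ a b c d e f →
                  (a :* c :- b :* d) :* f :+ (a :* d :+ b :* c) :* e
                  := a :* (c :* f :+ d :* e) :+ b :* (c :* e :- d :* f)) ≡.refl
                (seq (re x) k) (seq (im x) k) (seq (re y) k) (seq (im y) k) (seq (re z) k) (seq (im z) k))
        ; *-identity = *-identityˡᶜ , λ x → transᶜ {x *ᶜ 1ᶜ} {1ᶜ *ᶜ x} {x} (*-commᶜ x 1ᶜ) (*-identityˡᶜ x)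
        ; distrib = *-distribˡᶜ , λ x y z →
            pointwise (re ((y +ᶜ z) *ᶜ x)) (re (y *ᶜ x +ᶜ z *ᶜ x)) (λ k →
              solve 6 (λ a b c d e f →
                  (c :+ e) :* a :- (d :+ f) :* b := (c :* a :- d :* b) :+ (e :* a :- f :* b)) ≡.refl
                (seq (re x) k) (seq (im x) k) (seq (re y) k) (seq (im y) k) (seq (re z) k) (seq (im z) k)) ,
            pointwise (im ((y +ᶜ z) *ᶜ x)) (im (y *ᶜ x +ᶜ z *ᶜ x)) (λ k →
              solve 6 (λ a b c d e f →
                  (c :+ e) :* b :+ (d :+ f) :* a := (c :* b :+ d :* a) :+ (e :* b :+ f :* a)) ≡.refl
                (seq (re x) k) (seq (im x) k) (seq (re y) k) (seq (im y) k) (seq (re z) k) (seq (im z) k))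
        }
      ; *-comm = *-commᶜ
      }
    }
    where
    transᶜ : ∀ {x y z} → x ≈ᶜ y → y ≈ᶜ z → x ≈ᶜ z
    transᶜ {x} {y} {z} (p , q) (p′ , q′) =
      ℝ-ring.trans {re x} {re y} {re z} p p′ , ℝ-ring.trans {im x} {im y} {im z} q q′

    *-commᶜ : ∀ x y → x *ᶜ y ≈ᶜ y *ᶜ x
    *-commᶜ x y =
      pointwise (re (x *ᶜ y)) (re (y *ᶜ x)) (λ k →
        solve 4 (λ a b c d → a :* c :- b :* d := c :* a :- d :* b) ≡.refl
          (seq (re x) k) (seq (im x) k) (seq (re y) k) (seq (im y) k)) ,
      pointwise (im (x *ᶜ y)) (im (y *ᶜ x)) (λ k →
        solve 4 (λ a b c d → a :* d :+ b :* c := c :* b :+ d :* a) ≡.refl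
          (seq (re x) k) (seq (im x) k) (seq (re y) k) (seq (im y) k))

    *-identityˡᶜ : ∀ x → 1ᶜ *ᶜ x ≈ᶜ x
    *-identityˡᶜ x =
      pointwise (re (1ᶜ *ᶜ x)) (re x) (λ k →
        solve 2 (λ a b → con 1ℚ :* a :- con 0ℚ :* b := a) ≡.refl (seq (re x) k) (seq (im x) k)) ,
      pointwise (im (1ᶜ *ᶜ x)) (im x) (λ k →
        solve 2 (λ a b → con 1ℚ :* b :+ con 0ℚ :* a := b) ≡.refl (seq (re x) k) (seq (im x) k))

    *-distribˡᶜ : ∀ x y z → x *ᶜ (y +ᶜ z) ≈ᶜ x *ᶜ y +ᶜ x *ᶜ z
    *-distribˡᶜ x y z =
      pointwise (re (x *ᶜ (y +ᶜ z))) (re (x *ᶜ y +ᶜ x *ᶜ z)) (λ k →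
        solve 6 (λ a b c d e f →
            a :* (c :+ e) :- b :* (d :+ f) := (a :* c :- b :* d) :+ (a :* e :- b :* f)) ≡.refl
          (seq (re x) k) (seq (im x) k) (seq (re y) k) (seq (im y) k) (seq (re z) k) (seq (im z) k)) ,
      pointwise (im (x *ᶜ (y +ᶜ z))) (im (x *ᶜ y +ᶜ x *ᶜ z)) (λ k →
        solve 6 (λ a b c d e f →
            a :* (d :+ f) :+ b :* (c :+ e) := (a :* d :+ b :* c) :+ (a :* f :+ b :* e)) ≡.refl
          (seq (re x) k) (seq (im x) k) (seq (re y) k) (seq (im y) k) (seq (re z) k) (seq (im z) k))

  -- If xy = 0 then x̄xy = |x|²y = 0 with |x|² real.
  ℂ-noZeroDivisors : ∀ x y → x *ᶜ y ≈ᶜ 0ᶜ → ¬ x ≈ᶜ 0ᶜ → y ≈ᶜ 0ᶜ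
  ℂ-noZeroDivisors (a +i b) (c +i d) (re≈0 , im≈0) x≉0 = component c re-part , component d im-part
    where
    ∣x∣² : ℕ → ℚ
    ∣x∣² k = seq a k ℚ.* seq a k ℚ.+ seq b k ℚ.* seq b k

    drop-0 : ∀ {s} → Null (λ k → s k ℚ.- 0ℚ) → Null s
    drop-0 {s} = null-resp λ k → ℚ.+-identityʳ (s k)

    add-0 : ∀ {s} → Null s → Null (λ k → s k ℚ.- 0ℚ)
    add-0 {s} = null-resp λ k → ≡.sym (ℚ.+-identityʳ (s k))

    p q : ℕ → ℚ
    p k = seq a k ℚ.* seq c k ℚ.- seq b k ℚ.* seq d k
    q k = seq a k ℚ.* seq d k ℚ.+ seq b k ℚ.* seq c k

    re-part : Null (λ k → ∣x∣² k ℚ.* seq c k)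
    re-part = null-resp {λ k → p k ℚ.* seq a k ℚ.+ q k ℚ.* seq b k}
      (λ k → solve 4 (λ a b c d → (a :* c :- b :* d) :* a :+ (a :* d :+ b :* c) :* b
                                  := (a :* a :+ b :* b) :* c) ≡.refl
               (seq a k) (seq b k) (seq c k) (seq d k))
      (null-+ {λ k → p k ℚ.* seq a k} {λ k → q k ℚ.* seq b k}
        (null-* {p} {seq a} (cauchy a) (drop-0 {p} re≈0))
        (null-* {q} {seq b} (cauchy b) (drop-0 {q} im≈0)))

    im-part : Null (λ k → ∣x∣² k ℚ.* seq d k)
    im-part = null-resp {λ k → q k ℚ.* seq a k ℚ.+ ℚ.- (p k ℚ.* seq b k)}
      (λ k → solve 4 (λ a b c d → (a :* d :+ b :* c) :* a :+ :- ((a :* c :- b :* d) :* b)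
                                  := (a :* a :+ b :* b) :* d) ≡.refl
               (seq a k) (seq b k) (seq c k) (seq d k))
      (null-+ {λ k → q k ℚ.* seq a k} {λ k → ℚ.- (p k ℚ.* seq b k)}
        (null-* {q} {seq a} (cauchy a) (drop-0 {q} im≈0))
        (null-neg {λ k → p k ℚ.* seq b k} (null-* {p} {seq b} (cauchy b) (drop-0 {p} re≈0))))

    ∣x∣²-notNull : ¬ Null ∣x∣²
    ∣x∣²-notNull null = x≉0
      ( add-0 {seq a} (null-sumOfSquares {seq a} {seq b} (cauchy a) null)
      , add-0 {seq b} (null-sumOfSquares {seq b} {seq a} (cauchy b)
          (null-resp {∣x∣²} (λ k → ℚ.+-comm (seq a k ℚ.* seq a k) (seq b k ℚ.* seq b k)) null)))

    component : ∀ r → Null (λ k → ∣x∣² k ℚ.* seq r k) → r ≈ℝ ℚ⇒ℝ 0ℚ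
    component r null = add-0 {seq r} (null-noZeroDivisors {∣x∣²} {seq r} (cauchy r) null ∣x∣²-notNull)

  module ℂ-ring = CommutativeRing ℂ-commutativeRing

  ℚ⇒ℂ-cong : ∀ {p q} → p ≡ q → ℚ⇒ℂ p ≈ᶜ ℚ⇒ℂ q
  ℚ⇒ℂ-cong {p} ≡.refl = ℂ-ring.refl {ℚ⇒ℂ p}

  ℚ⇒ℂ-+ : ∀ p q → ℚ⇒ℂ (p ℚ.+ q) ≈ᶜ ℚ⇒ℂ p +ᶜ ℚ⇒ℂ q
  ℚ⇒ℂ-+ p q = ℝ-ring.refl {ℚ⇒ℝ (p ℚ.+ q)} , pointwise (ℚ⇒ℝ 0ℚ) (ℚ⇒ℝ 0ℚ +ℝ ℚ⇒ℝ 0ℚ) λ _ → ≡.refl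

  ℚ⇒ℂ-neg : ∀ p → ℚ⇒ℂ (ℚ.- p) ≈ᶜ -ᶜ ℚ⇒ℂ p
  ℚ⇒ℂ-neg p = ℝ-ring.refl {ℚ⇒ℝ (ℚ.- p)} , pointwise (ℚ⇒ℝ 0ℚ) (-ℝ ℚ⇒ℝ 0ℚ) λ _ → ≡.refl

  ℚ⇒ℂ-* : ∀ p q → ℚ⇒ℂ (p ℚ.* q) ≈ᶜ ℚ⇒ℂ p *ᶜ ℚ⇒ℂ q
  ℚ⇒ℂ-* p q =
    pointwise (ℚ⇒ℝ (p ℚ.* q)) (re (ℚ⇒ℂ p *ᶜ ℚ⇒ℂ q)) (λ _ →
      solve 2 (λ p q → p :* q := p :* q :- con 0ℚ :* con 0ℚ) ≡.refl p q) ,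
    pointwise (ℚ⇒ℝ 0ℚ) (im (ℚ⇒ℂ p *ᶜ ℚ⇒ℂ q)) (λ _ →
      solve 2 (λ p q → con 0ℚ := p :* con 0ℚ :+ con 0ℚ :* q) ≡.refl p q)

  -- Equality with 0 is decidable for a rational, and a nonzero constant sequence is bounded away
  -- from 0 by its own absolute value.
  ℚ⇒ℂ-injective : ∀ {p} → ℚ⇒ℂ p ≈ᶜ 0ᶜ → p ≡ 0ℚ
  ℚ⇒ℂ-injective {p} (p≈0 , _) with p ℚ.≟ 0ℚ
  ... | yes p≡0 = p≡0
  ... | no  p≢0 = contradiction (null-resp {λ _ → p ℚ.- 0ℚ} (λ _ → ℚ.+-identityʳ p) p≈0)
    (¬null-apart (∣ p ∣ , ℚ.≰⇒> (λ ∣p∣≤0 → p≢0 (ℚ.∣p∣≡0⇒p≡0 p (ℚ.≤-antisym ∣p∣≤0 (ℚ.0≤∣p∣ p)))) ,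
                  0 , λ _ _ → ℚ.≤-refl))

-- Index lists with one entry omitted

module PunchIn where

  -- Omitting p and omitting p + 1 leave lists that differ only in place p, which holds p + 1 in one
  -- and p in the other. If rows p and p + 1 are equal, the two minors therefore coincide.
  punchIn-inject₁-self : ∀ {n} (p : Fin n) → punchIn (inject₁ p) p ≡ suc p
  punchIn-inject₁-self zero    = ≡.refl
  punchIn-inject₁-self (suc p) = ≡.cong suc (punchIn-inject₁-self p)

  punchIn-suc-self : ∀ {n} (p : Fin n) → punchIn (suc p) p ≡ inject₁ p
  punchIn-suc-self zero    = ≡.refl
  punchIn-suc-self (suc p) = ≡.cong suc (punchIn-suc-self p)

  punchIn-inject₁-suc : ∀ {n} (p i : Fin n) → i ≢ p → punchIn (inject₁ p) i ≡ punchIn (suc p) i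
  punchIn-inject₁-suc zero    zero    i≢p = contradiction ≡.refl i≢p
  punchIn-inject₁-suc zero    (suc i) i≢p = ≡.refl
  punchIn-inject₁-suc (suc p) zero    i≢p = ≡.refl
  punchIn-inject₁-suc (suc p) (suc i) i≢p =
    ≡.cong suc (punchIn-inject₁-suc p i (i≢p ∘ ≡.cong suc))

  -- Omitting any other index keeps p and p + 1 next to each other, so a minor inherits a pair of
  -- equal adjacent rows.
  punchIn-adjacent : ∀ {n} (j : Fin (suc (suc n))) p → j ≢ inject₁ p → j ≢ suc p →
    ∃ λ q → punchIn j (inject₁ q) ≡ inject₁ p × punchIn j (suc q) ≡ suc p
  punchIn-adjacent zero             zero    j≢p j≢p+1 = contradiction ≡.refl j≢p
  punchIn-adjacent zero             (suc p) j≢p j≢p+1 = p , ≡.refl , ≡.refl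
  punchIn-adjacent (suc zero)       zero    j≢p j≢p+1 = contradiction ≡.refl j≢p+1
  punchIn-adjacent {suc n} (suc (suc j)) zero j≢p j≢p+1 = zero , ≡.refl , ≡.refl
  punchIn-adjacent {suc n} (suc j)  (suc p) j≢p j≢p+1 =
    let q , eq , eq′ = punchIn-adjacent j p (j≢p ∘ ≡.cong suc) (j≢p+1 ∘ ≡.cong suc)
    in suc q , ≡.cong suc eq , ≡.cong suc eq′

-- Alternating forms and determinants over a commutative ring

module Determinants {k κ : Level} (K : CommutativeRing k κ) where
  open import Data.Vec.Functional using (tail; updateAt) renaming (_∷_ to _◂_)
  open import Data.Vec.Functional.Properties using (updateAt-updates; updateAt-minimal)
  open CommutativeRing K hiding (zero)
  open Algebra.Definitions.RawSemiring (Semiring.rawSemiring semiring) using (_^_; product)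
  open Algebra.Properties.Semiring.Sum semiring
  open Algebra.Properties.Ring ring
  open PunchIn
  open import Relation.Binary.Reasoning.Setoid setoid

  Square : ℕ → Set k
  Square n = Fin n → Fin n → Carrier

  determinant : ∀ {n} → Square n → Carrier
  determinant {zero}  A = 1#
  determinant {suc n} A = sum λ j →
    (((- 1#) ^ toℕ j) * A zero j) * determinant (λ i l → A (suc i) (punchIn j l))

  identity : ∀ {n} → Square n
  identity i j = if does (i Fin.≟ j) then 1# else 0#

  identity-diagonal : ∀ {n} (i : Fin n) → identity i i ≡ 1#
  identity-diagonal i with i Fin.≟ i
  ... | yes _  = ≡.refl
  ... | no i≢i = contradiction ≡.refl i≢i

  identity-off : ∀ {n} {i j : Fin n} → i ≢ j → identity i j ≡ 0#
  identity-off {i = i} {j} i≢j with i Fin.≟ j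
  ... | yes i≡j = contradiction i≡j i≢j
  ... | no _    = ≡.refl

  sum-0 : ∀ {n} {t : Fin n → Carrier} → (∀ i → t i ≈ 0#) → sum t ≈ 0#
  sum-0 {n} t≈0 = trans (sum-cong-≋ t≈0) (sum-replicate-zero n)

  sum-identityʳ : ∀ {n} (t : Fin n → Carrier) i → sum (λ j → t j * identity j i) ≈ t i
  sum-identityʳ t zero = begin
    t zero * 1# + sum (λ j → t (suc j) * 0#)   ≈⟨ +-cong (*-identityʳ (t zero)) (sum-0 (λ j → zeroʳ (t (suc j)))) ⟩
    t zero + 0#                                ≈⟨ +-identityʳ (t zero) ⟩
    t zero                                     ∎
  sum-identityʳ t (suc i) = begin
    t zero * 0# + sum (λ j → t (suc j) * identity j i)   ≈⟨ +-cong (zeroʳ (t zero)) (sum-identityʳ (t ∘ suc) i) ⟩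
    0# + t (suc i)                                       ≈⟨ +-identityˡ (t (suc i)) ⟩
    t (suc i)                                            ∎

  identity-sym : ∀ {n} (i j : Fin n) → identity i j ≡ identity j i
  identity-sym i j with i Fin.≟ j
  ... | yes ≡.refl = ≡.sym (identity-diagonal i)
  ... | no i≢j     = ≡.sym (identity-off (i≢j ∘ ≡.sym))

  sum-identityˡ : ∀ {n} (t : Fin n → Carrier) i → sum (λ j → identity i j * t j) ≈ t i
  sum-identityˡ t i = trans
    (sum-cong-≋ λ j → trans (*-comm _ (t j)) (*-congˡ (reflexive (identity-sym i j))))
    (sum-identityʳ t i)

  sum-linear : ∀ {n} c (s t : Fin n → Carrier) → sum (λ i → s i + c * t i) ≈ sum s + c * sum t
  sum-linear c s t = trans (∑-distrib-+ s (λ i → c * t i)) (+-congˡ (sym (*-distribˡ-sum c t)))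

  -- Meant for the expansion of a determinant with rows p and p + 1 equal: only the two terms that
  -- remove one of these rows can survive.
  sum-adjacent : ∀ {n} (t : Fin (suc (suc n)) → Carrier) p →
    (∀ j → j ≢ inject₁ p → j ≢ suc p → t j ≈ 0#) → t (inject₁ p) + t (suc p) ≈ 0# → sum t ≈ 0#
  sum-adjacent t zero others cancel = begin
    t zero + (t (suc zero) + sum (λ j → t (suc (suc j))))   ≈⟨ +-assoc _ _ _ ⟨
    t zero + t (suc zero) + sum (λ j → t (suc (suc j)))     ≈⟨ +-cong cancel (sum-0 (λ j → others (suc (suc j)) (λ ()) (λ ()))) ⟩
    0# + 0#                                                 ≈⟨ +-identityˡ 0# ⟩
    0#                                                      ∎
  sum-adjacent {suc n} t (suc p) others cancel = begin
    t zero + sum (t ∘ suc)   ≈⟨ +-cong (others zero (λ ()) (λ ()))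
                                  (sum-adjacent (t ∘ suc) p
                                    (λ j j≢p j≢p+1 → others (suc j) (j≢p ∘ Fin.suc-injective) (j≢p+1 ∘ Fin.suc-injective))
                                    cancel) ⟩
    0# + 0#                  ≈⟨ +-identityˡ 0# ⟩
    0#                       ∎

  Form : ℕ → Set _
  Form n = Square n → Carrier

  -- Linearity is stated for any three matrices that agree off row `i`: rows are functions, and
  -- matrices obtained in different ways agree only entrywise.
  record IsMultilinear {n} (F : Form n) : Set (k ⊔ κ) where
    field
      cong   : ∀ {A B} → (∀ i l → A i l ≈ B i l) → F A ≈ F B
      linear : ∀ i c {A B C} → (∀ l → A i l ≈ B i l + c * C i l) →
               (∀ j → j ≢ i → ∀ l → A j l ≈ B j l) → (∀ j → j ≢ i → ∀ l → A j l ≈ C j l) →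
               F A ≈ F B + c * F C

  VanishesAt : ∀ {n} → Form n → Fin n → Fin n → Set _
  VanishesAt F i j = ∀ A → (∀ l → A i l ≈ A j l) → F A ≈ 0#

  record IsAlternating {n} (F : Form n) : Set (k ⊔ κ) where
    field
      isMultilinear : IsMultilinear F
      vanish        : ∀ {i j} → i ≢ j → VanishesAt F i j
    open IsMultilinear isMultilinear public

  module _ {n} (A : Square n) {i j : Fin n} (i≢j : i ≢ j) where

    rows : (Fin n → Carrier) → (Fin n → Carrier) → Square n
    rows u v m with m Fin.≟ i | m Fin.≟ j
    ... | yes _ | _     = u
    ... | no _  | yes _ = v
    ... | no _  | no _  = A m

    rows-i : ∀ u v l → rows u v i l ≈ u l
    rows-i u v l with i Fin.≟ i
    ... | yes _  = refl
    ... | no i≢i = contradiction ≡.refl i≢i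

    rows-j : ∀ u v l → rows u v j l ≈ v l
    rows-j u v l with j Fin.≟ i | j Fin.≟ j
    ... | yes j≡i | _      = contradiction (≡.sym j≡i) i≢j
    ... | no _    | yes _  = refl
    ... | no _    | no j≢j = contradiction ≡.refl j≢j

    rows-other : ∀ u v m → m ≢ i → m ≢ j → ∀ l → rows u v m l ≈ A m l
    rows-other u v m m≢i m≢j l with m Fin.≟ i | m Fin.≟ j
    ... | yes m≡i | _       = contradiction m≡i m≢i
    ... | no _    | yes m≡j = contradiction m≡j m≢j
    ... | no _    | no _    = refl

    rows-not-i : ∀ u u′ v m → m ≢ i → ∀ l → rows u v m l ≈ rows u′ v m l
    rows-not-i u u′ v m m≢i l with m Fin.≟ i | m Fin.≟ j
    ... | yes m≡i | _     = contradiction m≡i m≢i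
    ... | no _    | yes _ = refl
    ... | no _    | no _  = refl

    rows-not-j : ∀ u v v′ m → m ≢ j → ∀ l → rows u v m l ≈ rows u v′ m l
    rows-not-j u v v′ m m≢j l with m Fin.≟ i | m Fin.≟ j
    ... | yes _ | _       = refl
    ... | no _  | yes m≡j = contradiction m≡j m≢j
    ... | no _  | no _    = refl

  module _ {n} {F : Form n} (F-multilinear : IsMultilinear F) where
    open IsMultilinear F-multilinear

    private
      module _ (A : Square n) {i j : Fin n} (i≢j : i ≢ j) where

        _+ᵥ_ : (Fin n → Carrier) → (Fin n → Carrier) → Fin n → Carrier
        (u +ᵥ v) l = u l + v l

        additive-i : ∀ u u′ v → F (rows A i≢j (u +ᵥ u′) v) ≈ F (rows A i≢j u v) + F (rows A i≢j u′ v)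
        additive-i u u′ v = trans
          (linear i 1#
            (λ l → trans (rows-i A i≢j _ v l)
                     (+-cong (sym (rows-i A i≢j u v l)) (trans (sym (rows-i A i≢j u′ v l)) (sym (*-identityˡ _)))))
            (rows-not-i A i≢j _ u v) (rows-not-i A i≢j _ u′ v))
          (+-congˡ (*-identityˡ _))

        additive-j : ∀ u v v′ → F (rows A i≢j u (v +ᵥ v′)) ≈ F (rows A i≢j u v) + F (rows A i≢j u v′)
        additive-j u v v′ = trans
          (linear j 1#
            (λ l → trans (rows-j A i≢j u _ l)
                     (+-cong (sym (rows-j A i≢j u v l)) (trans (sym (rows-j A i≢j u v′ l)) (sym (*-identityˡ _)))))
            (rows-not-j A i≢j u _ v) (rows-not-j A i≢j u _ v′))
          (+-congˡ (*-identityˡ _))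

    -- Polarisation: the form vanishes with x + y in both rows. Expanding in each row, the terms
    -- with x twice or y twice vanish as well, and the two mixed terms are left to cancel. Only
    -- vanishing at this pair of rows enters, so the lemma applies before `F` is known to be
    -- alternating.
    swap-rows : ∀ {i j} → i ≢ j → VanishesAt F i j → ∀ {A B} →
      (∀ l → B i l ≈ A j l) → (∀ l → B j l ≈ A i l) →
      (∀ m → m ≢ i → m ≢ j → ∀ l → B m l ≈ A m l) → F B ≈ - F A
    swap-rows {i} {j} i≢j vanish {A} {B} Bi Bj Bm = +-inverseʳ-unique (F A) (F B) (begin
      F A + F B
        ≈⟨ +-cong (cong A-rows) (cong B-rows) ⟩
      F (rows′ x y) + F (rows′ y x)
        ≈⟨ +-cong (+-identityˡ _) (+-identityʳ _) ⟨
      (0# + F (rows′ x y)) + (F (rows′ y x) + 0#)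
        ≈⟨ +-cong (+-congʳ (equal x)) (+-congˡ (equal y)) ⟨
      (F (rows′ x x) + F (rows′ x y)) + (F (rows′ y x) + F (rows′ y y))
        ≈⟨ +-cong (additive-j A i≢j x x y) (additive-j A i≢j y x y) ⟨
      F (rows′ x x+y) + F (rows′ y x+y)
        ≈⟨ additive-i A i≢j x y x+y ⟨
      F (rows′ x+y x+y)
        ≈⟨ equal x+y ⟩
      0# ∎)
      where
      x = A i
      y = A j
      x+y = λ l → x l + y l
      rows′ = rows A i≢j
      equal : ∀ u → F (rows′ u u) ≈ 0#
      equal u = vanish (rows′ u u) λ l → trans (rows-i A i≢j u u l) (sym (rows-j A i≢j u u l))
      A-rows : ∀ m l → A m l ≈ rows′ x y m l
      A-rows m l with m Fin.≟ i | m Fin.≟ j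
      ... | yes ≡.refl | _          = refl
      ... | no _       | yes ≡.refl = refl
      ... | no _       | no _       = refl
      B-rows : ∀ m l → B m l ≈ rows′ y x m l
      B-rows m l with m Fin.≟ i | m Fin.≟ j
      ... | yes ≡.refl | _          = Bi l
      ... | no _       | yes ≡.refl = Bj l
      ... | no m≢i     | no m≢j     = Bm m m≢i m≢j l

  module _ {n} {F : Form (suc n)} (F-multilinear : IsMultilinear F)
           (adjacent : ∀ p → VanishesAt F (inject₁ p) (suc p)) where
    open IsMultilinear F-multilinear

    private
      inject₁≢suc : ∀ {m} (p : Fin m) → inject₁ p ≢ suc p
      inject₁≢suc (suc p) eq = inject₁≢suc p (Fin.suc-injective eq)

      -- Induction on the larger index: if rows i and j + 1 are equal, swapping rows j and j + 1
      -- brings the equal row to place j at the cost of a sign.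
      vanish-< : ∀ j i → i < j → VanishesAt F i j
      vanish-< = Fin.<-weakInduction (λ j → ∀ i → i < j → VanishesAt F i j) (λ _ ()) step
        where
        step : ∀ j → (∀ i → i < inject₁ j → VanishesAt F i (inject₁ j)) →
               ∀ i → i < suc j → VanishesAt F i (suc j)
        step j vanish i (ℕ.s≤s i≤j) A Ai≈Aj+1 with i Fin.≟ inject₁ j
        ... | yes ≡.refl = adjacent j A Ai≈Aj+1
        ... | no i≢j     = begin
          F A          ≈⟨ -‿involutive (F A) ⟨
          - - F A      ≈⟨ -‿cong (swap-rows F-multilinear (inject₁≢suc j) (adjacent j)
                            (λ l → rows-i A (inject₁≢suc j) _ _ l) (λ l → rows-j A (inject₁≢suc j) _ _ l)
                            (λ m m≢ m≢′ l → rows-other A (inject₁≢suc j) _ _ m m≢ m≢′ l)) ⟨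
          - F B        ≈⟨ -‿cong (vanish i i<j B λ l → trans (rows-other A (inject₁≢suc j) _ _ i i≢j i≢j+1 l)
                            (trans (Ai≈Aj+1 l) (sym (rows-i A (inject₁≢suc j) _ _ l)))) ⟩
          - 0#         ≈⟨ -0#≈0# ⟩
          0#           ∎
          where
          B = rows A (inject₁≢suc j) (A (suc j)) (A (inject₁ j))
          i≢j+1 : i ≢ suc j
          i≢j+1 ≡.refl = ℕ.<-irrefl ≡.refl i≤j
          i<j : i < inject₁ j
          i<j = ℕ.≤∧≢⇒< (≡.subst (toℕ i ℕ.≤_) (≡.sym (Fin.toℕ-inject₁ j)) i≤j)
                  (i≢j ∘ Fin.toℕ-injective)

    alternating : IsAlternating F
    alternating = record
      { isMultilinear = F-multilinear
      ; vanish = λ {i} {j} i≢j → vanish-≢ i j i≢j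
      }
      where
      vanish-≢ : ∀ i j → i ≢ j → VanishesAt F i j
      vanish-≢ i j i≢j A Ai≈Aj with Fin.<-cmp i j
      ... | tri< i<j _ _ = vanish-< j i i<j A Ai≈Aj
      ... | tri≈ _ i≡j _ = contradiction i≡j i≢j
      ... | tri> _ _ j<i = vanish-< i j j<i A (sym ∘ Ai≈Aj)

  -- Entries are replaced one at a time from index 0 on. The hypothesis `invariant` changes a single
  -- entry, and `F-cong` accounts for families that agree only pointwise.
  sweep : ∀ {n v r} {V : Set v} (_~_ : V → V → Set r) (F : (Fin n → V) → Carrier) →
    (∀ {A B} → (∀ i → A i ≡ B i) → F A ≈ F B) →
    (∀ i {A B} → (∀ j → j ≢ i → A j ≡ B j) → A i ~ B i → F A ≈ F B) →
    ∀ A B → (∀ i → A i ~ B i) → F A ≈ F B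
  sweep {zero}  _~_ F F-cong invariant A B A~B = F-cong λ ()
  sweep {suc n} _~_ F F-cong invariant A B A~B = begin
    F A                   ≈⟨ invariant zero
                               (λ { zero 0≢0 → contradiction ≡.refl 0≢0 ; (suc j) _ → ≡.refl }) (A~B zero) ⟩
    F (B zero ◂ tail A)   ≈⟨ sweep _~_ (λ C → F (B zero ◂ C))
                               (λ C≗D → F-cong (λ { zero → ≡.refl ; (suc j) → C≗D j }))
                               (λ i C≗D → invariant (suc i)
                                  (λ { zero _ → ≡.refl ; (suc j) j≢i → C≗D j (j≢i ∘ ≡.cong suc) }))
                               (tail A) (tail B) (A~B ∘ suc) ⟩
    F (B zero ◂ tail B)   ≈⟨ F-cong (λ { zero → ≡.refl ; (suc j) → ≡.refl }) ⟩
    F B                   ∎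

  -- Inserts a zero in place `j`; deleting column `j` undoes it.
  pad : ∀ {n} → Fin (suc n) → (Fin n → Carrier) → Fin (suc n) → Carrier
  pad j u l with j Fin.≟ l
  ... | yes _  = 0#
  ... | no j≢l = u (punchOut j≢l)

  pad-cong : ∀ {n} (j : Fin (suc n)) {u v} → (∀ l → u l ≈ v l) → ∀ l → pad j u l ≈ pad j v l
  pad-cong j u≈v l with j Fin.≟ l
  ... | yes _  = refl
  ... | no j≢l = u≈v (punchOut j≢l)

  pad-linear : ∀ {n} (j : Fin (suc n)) c {u v w} → (∀ l → u l ≈ v l + c * w l) →
               ∀ l → pad j u l ≈ pad j v l + c * pad j w l
  pad-linear j c eq l with j Fin.≟ l
  ... | yes _  = sym (trans (+-identityˡ _) (zeroʳ c))
  ... | no j≢l = eq (punchOut j≢l)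

  pad-punchIn : ∀ {n} (j : Fin (suc n)) u l → u l ≈ pad j (u ∘ punchIn j) l + u j * identity j l
  pad-punchIn j u l with j Fin.≟ l
  ... | yes ≡.refl = sym (trans (+-identityˡ _) (*-identityʳ (u j)))
  ... | no j≢l     = sym (trans (+-congˡ (zeroʳ (u j)))
    (trans (+-identityʳ _) (reflexive (≡.cong u (Fin.punchIn-punchOut j≢l)))))

  pad-identity : ∀ {n} (j : Fin (suc n)) i l → pad j (identity i) l ≈ identity (punchIn j i) l
  pad-identity j i l with j Fin.≟ l
  ... | yes ≡.refl = sym (reflexive (identity-off (Fin.punchInᵢ≢i j i)))
  ... | no j≢l with i Fin.≟ punchOut j≢l | punchIn j i Fin.≟ l
  ...   | yes _  | yes _  = refl
  ...   | no _   | no _   = refl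
  ...   | yes eq | no ≢l  = contradiction (≡.trans (≡.cong (punchIn j) eq) (Fin.punchIn-punchOut j≢l)) ≢l
  ...   | no i≢  | yes eq = contradiction
    (Fin.punchIn-injective j _ _ (≡.trans eq (≡.sym (Fin.punchIn-punchOut j≢l)))) i≢

  module _ {n} {F : Form (suc n)} (F-alternating : IsAlternating F) where
    open IsAlternating F-alternating

    private
      ◂-cong : ∀ j {B C : Fin n → Fin (suc n) → Carrier} →
               (∀ i l → B i l ≈ C i l) → F (identity j ◂ B) ≈ F (identity j ◂ C)
      ◂-cong j B≈C = cong λ { zero l → refl ; (suc i) l → B≈C i l }

    -- Bordering `B` by the unit row e_j on top and a zero column at `j` turns a form on larger
    -- matrices into one on smaller matrices, so that induction on the size applies.
    cofactor : Fin (suc n) → Form n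
    cofactor j B = F (identity j ◂ λ i → pad j (B i))

    cofactor-alternating : ∀ j → IsAlternating (cofactor j)
    cofactor-alternating j = record
      { isMultilinear = record
        { cong   = λ A≈B → ◂-cong j (λ i → pad-cong j (A≈B i))
        ; linear = λ i c Ai A≈B A≈C → linear (suc i) c (pad-linear j c Ai)
            (λ { zero _ l → refl ; (suc m) m≢i → pad-cong j (A≈B m (m≢i ∘ ≡.cong suc)) })
            (λ { zero _ l → refl ; (suc m) m≢i → pad-cong j (A≈C m (m≢i ∘ ≡.cong suc)) })
        }
      ; vanish = λ i≢m A Ai≈Am → vanish (i≢m ∘ Fin.suc-injective) _ (pad-cong j Ai≈Am)
      }

    -- Subtracting multiples of the row e_j clears the j-th column.
    clear-column : ∀ j B → F (identity j ◂ B) ≈ cofactor j (λ i l → B i (punchIn j l))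
    clear-column j B = sweep (λ u v → ∃ λ c → ∀ l → u l ≈ v l + c * identity j l)
      (λ C → F (identity j ◂ C))
      (λ C≗D → ◂-cong j (λ i l → reflexive (≡.cong (λ u → u l) (C≗D i))))
      (λ i {C} {D} C≗D (c , Ci) → begin
        F (identity j ◂ C)
          ≈⟨ linear (suc i) c
               (λ l → trans (Ci l) (+-congˡ (*-congˡ (reflexive (≡.cong (λ u → u l) (≡.sym (updateAt-updates i D)))))))
               (λ { zero _ l → refl ; (suc m) m≢i l → reflexive (≡.cong (λ u → u l) (C≗D m (m≢i ∘ ≡.cong suc))) })
               (λ { zero _ l → refl ; (suc m) m≢i l → reflexive (≡.cong (λ u → u l)
                      (≡.trans (C≗D m (m≢i ∘ ≡.cong suc)) (≡.sym (updateAt-minimal m i D (m≢i ∘ ≡.cong suc))))) }) ⟩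
        F (identity j ◂ D) + c * F (identity j ◂ updateAt D i (λ _ → identity j))
          ≈⟨ +-congˡ (*-congˡ (vanish {zero} {suc i} (λ ()) (identity j ◂ updateAt D i (λ _ → identity j))
               (λ l → reflexive (≡.cong (λ u → u l) (≡.sym (updateAt-updates i D)))))) ⟩
        F (identity j ◂ D) + c * 0#
          ≈⟨ trans (+-congˡ (zeroʳ c)) (+-identityʳ _) ⟩
        F (identity j ◂ D) ∎)
      B (λ i → pad j (B i ∘ punchIn j)) (λ i → B i j , pad-punchIn j (B i))

    expand-row : ∀ {m} (c : Fin m → Carrier) (V : Fin m → Fin (suc n) → Carrier) A →
      (∀ l → A zero l ≈ sum (λ j → c j * V j l)) → F A ≈ sum (λ j → c j * F (V j ◂ tail A))
    -- The empty sum makes row 0 zero, so it equals itself plus itself. Linearity then gives F A = F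
    -- A + F A, hence F A = 0.
    expand-row {zero} c V A A0≈ = +-identityʳ-unique (F A) (F A) (begin
      F A + F A         ≈⟨ +-congˡ (*-identityˡ (F A)) ⟨
      F A + 1# * F A    ≈⟨ linear zero 1#
                             (λ l → trans (A0≈ l) (sym (trans (+-cong (A0≈ l) (trans (*-identityˡ _) (A0≈ l))) (+-identityˡ 0#))))
                             (λ _ _ _ → refl) (λ _ _ _ → refl) ⟨
      F A               ∎)
    expand-row {suc m} c V A A0≈ = begin
      F A
        ≈⟨ linear zero (c zero)
             (λ l → trans (A0≈ l) (+-comm (c zero * V zero l) _))
             (λ { zero 0≢0 → contradiction ≡.refl 0≢0 ; (suc i) _ l → refl })
             (λ { zero 0≢0 → contradiction ≡.refl 0≢0 ; (suc i) _ l → refl }) ⟩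
      F (remaining ◂ tail A) + c zero * F (V zero ◂ tail A)
        ≈⟨ +-comm _ _ ⟩
      c zero * F (V zero ◂ tail A) + F (remaining ◂ tail A)
        ≈⟨ +-congˡ (expand-row (c ∘ suc) (V ∘ suc) (remaining ◂ tail A) (λ l → refl)) ⟩
      c zero * F (V zero ◂ tail A) + sum (λ j → c (suc j) * F (V (suc j) ◂ tail A)) ∎
      where
      remaining : Fin (suc n) → Carrier
      remaining l = sum λ j → c (suc j) * V (suc j) l

    -- The row order j, 0, …, j-1, j+1, … differs from the one for j+1 by a single swap.
    cofactor-identity : ∀ j → cofactor j identity ≈ (- 1#) ^ toℕ j * F identity
    cofactor-identity j = trans (◂-cong j (pad-identity j)) (Fin.<-weakInduction P base step j)
      where
      rowsFrom : Fin (suc n) → Square (suc n)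
      rowsFrom j = identity j ◂ λ i → identity (punchIn j i)

      P : Fin (suc n) → Set κ
      P j = F (rowsFrom j) ≈ (- 1#) ^ toℕ j * F identity

      base : P zero
      base = trans (cong λ { zero l → refl ; (suc i) l → refl }) (sym (*-identityˡ (F identity)))

      row : ∀ {i j : Fin (suc n)} → i ≡ j → ∀ l → identity i l ≈ identity j l
      row i≡j l = reflexive (≡.cong (λ i → identity i l) i≡j)

      step : ∀ p → P (inject₁ p) → P (suc p)
      step p ih = begin
        F (rowsFrom (suc p))
          ≈⟨ swap-rows isMultilinear {zero} {suc p} (λ ()) (vanish (λ ()))
               (row (≡.sym (punchIn-inject₁-self p))) (row (punchIn-suc-self p))
               (λ { zero 0≢0 _ → contradiction ≡.refl 0≢0
                  ; (suc i) _ i≢p → row (≡.sym (punchIn-inject₁-suc p i (i≢p ∘ ≡.cong suc))) }) ⟩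
        - F (rowsFrom (inject₁ p))
          ≈⟨ -‿cong ih ⟩
        - ((- 1#) ^ toℕ (inject₁ p) * F identity)
          ≈⟨ -‿distribˡ-* _ _ ⟩
        - ((- 1#) ^ toℕ (inject₁ p)) * F identity
          ≈⟨ *-congʳ (-1*x≈-x _) ⟨
        - 1# * (- 1#) ^ toℕ (inject₁ p) * F identity
          ≡⟨ ≡.cong (λ m → - 1# * (- 1#) ^ m * F identity) (Fin.toℕ-inject₁ p) ⟩
        - 1# * (- 1#) ^ toℕ p * F identity ∎

  -- Expanding row 0 in unit rows leaves cofactors, which are alternating of one size less. By
  -- induction they are minors times their value at the identity, and that value supplies the sign
  -- of the Laplace expansion.
  alternating-determinant : ∀ {n} {F : Form n} → IsAlternating F →
                            ∀ A → F A ≈ determinant A * F identity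
  alternating-determinant {zero} {F} F-alternating A =
    trans (IsAlternating.cong F-alternating (λ ())) (sym (*-identityˡ _))
  alternating-determinant {suc n} {F} F-alternating A = begin
    F A
      ≈⟨ expand-row F-alternating (A zero) identity A (λ l → sym (sum-identityʳ (A zero) l)) ⟩
    sum (λ j → A zero j * F (identity j ◂ tail A))
      ≈⟨ sum-cong-≋ (λ j → term j) ⟩
    sum (λ j → ((- 1#) ^ toℕ j * A zero j) * determinant (minor j) * F identity)
      ≈⟨ *-distribʳ-sum (F identity) (λ j → ((- 1#) ^ toℕ j * A zero j) * determinant (minor j)) ⟨
    determinant A * F identity ∎
    where
    minor : Fin (suc n) → Square n
    minor j i l = A (suc i) (punchIn j l)

    term : ∀ j → A zero j * F (identity j ◂ tail A) ≈
                 ((- 1#) ^ toℕ j * A zero j) * determinant (minor j) * F identity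
    term j = begin
      a * F (identity j ◂ tail A)         ≈⟨ *-congˡ (clear-column F-alternating j (tail A)) ⟩
      a * cofactor F-alternating j (minor j)
                                          ≈⟨ *-congˡ (alternating-determinant (cofactor-alternating F-alternating j) (minor j)) ⟩
      a * (d * cofactor F-alternating j identity)
                                          ≈⟨ *-congˡ (*-congˡ (cofactor-identity F-alternating j)) ⟩
      a * (d * (s * F identity))          ≈⟨ *-congˡ (*-assoc d s _) ⟨
      a * (d * s * F identity)            ≈⟨ *-assoc a _ _ ⟨
      a * (d * s) * F identity            ≈⟨ *-congʳ (*-congˡ (*-comm d s)) ⟩
      a * (s * d) * F identity            ≈⟨ *-congʳ (*-assoc a s d) ⟨
      a * s * d * F identity              ≈⟨ *-congʳ (*-congʳ (*-comm a s)) ⟩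
      s * a * d * F identity              ∎
      where
      a = A zero j
      d = determinant (minor j)
      s = (- 1#) ^ toℕ j

  -- In terms of `A` this is the Laplace expansion along the first column. All rows enter it alike,
  -- whereas `determinant` singles out row 0, so the alternating property in the rows follows by a
  -- uniform induction.
  detᵀ : ∀ {n} → Form n
  detᵀ A = determinant λ i j → A j i

  private
    sign : ∀ {n} → Fin n → Carrier
    sign j = (- 1#) ^ toℕ j

    minorᵀ : ∀ {n} → Fin (suc n) → Square (suc n) → Square n
    minorᵀ j A i l = A (punchIn j i) (suc l)

    detᵀ-cong : ∀ {n} {A B : Square n} → (∀ i l → A i l ≈ B i l) → detᵀ A ≈ detᵀ B
    detᵀ-cong {zero}  A≈B = refl
    detᵀ-cong {suc n} A≈B = sum-cong-≋ λ j →
      *-cong (*-congˡ {sign j} (A≈B j zero)) (detᵀ-cong λ i l → A≈B (punchIn j i) (suc l))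

    -- In each term of the expansion row `i` occurs once: it is the removed row and supplies the
    -- linear coefficient, or it lies in the minor and the induction hypothesis applies there.
    detᵀ-linear : ∀ {n} i c {A B C : Square n} → (∀ l → A i l ≈ B i l + c * C i l) →
      (∀ j → j ≢ i → ∀ l → A j l ≈ B j l) → (∀ j → j ≢ i → ∀ l → A j l ≈ C j l) →
      detᵀ A ≈ detᵀ B + c * detᵀ C
    detᵀ-linear {suc n} i c {A} {B} {C} Ai A≈B A≈C =
      trans (sum-cong-≋ term) (sum-linear c (expansion B) (expansion C))
      where
      expansion : Square (suc n) → Fin (suc n) → Carrier
      expansion A j = (sign j * A j zero) * detᵀ (minorᵀ j A)

      term : ∀ j → expansion A j ≈ expansion B j + c * expansion C j
      term j with j Fin.≟ i
      ... | yes ≡.refl = begin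
        (s * A j zero) * detᵀ (minorᵀ j A)
          ≈⟨ *-congʳ (trans (*-congˡ (Ai zero)) (distribˡ s _ _)) ⟩
        (s * B j zero + s * (c * C j zero)) * detᵀ (minorᵀ j A)
          ≈⟨ distribʳ _ _ _ ⟩
        (s * B j zero) * detᵀ (minorᵀ j A) + (s * (c * C j zero)) * detᵀ (minorᵀ j A)
          ≈⟨ +-cong (*-congˡ (detᵀ-cong (λ m l → A≈B (punchIn j m) (Fin.punchInᵢ≢i j m) (suc l))))
                    (*-cong (trans (sym (*-assoc s c _)) (trans (*-congʳ (*-comm s c)) (*-assoc c s _)))
                            (detᵀ-cong (λ m l → A≈C (punchIn j m) (Fin.punchInᵢ≢i j m) (suc l)))) ⟩
        expansion B j + c * (s * C j zero) * detᵀ (minorᵀ j C)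
          ≈⟨ +-congˡ (*-assoc c _ _) ⟩
        expansion B j + c * expansion C j ∎
        where s = sign j
      ... | no j≢i = begin
        (s * A j zero) * detᵀ (minorᵀ j A)
          ≈⟨ *-congˡ (detᵀ-linear q c
               (λ l → trans (at-q A l) (trans (Ai (suc l)) (sym (+-cong (at-q B l) (*-congˡ (at-q C l))))))
               (λ m m≢q l → A≈B (punchIn j m) (off-q m m≢q) (suc l))
               (λ m m≢q l → A≈C (punchIn j m) (off-q m m≢q) (suc l))) ⟩
        (s * A j zero) * (detᵀ (minorᵀ j B) + c * detᵀ (minorᵀ j C))
          ≈⟨ distribˡ _ _ _ ⟩
        (s * A j zero) * detᵀ (minorᵀ j B) + (s * A j zero) * (c * detᵀ (minorᵀ j C))
          ≈⟨ +-cong (*-congʳ (*-congˡ (A≈B j j≢i zero))) (*-congʳ (*-congˡ (A≈C j j≢i zero))) ⟩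
        expansion B j + (s * C j zero) * (c * detᵀ (minorᵀ j C))
          ≈⟨ +-congˡ (trans (sym (*-assoc _ c _)) (trans (*-congʳ (*-comm _ c)) (*-assoc c _ _))) ⟩
        expansion B j + c * expansion C j ∎
        where
        s = sign j
        q = punchOut j≢i
        at-q : ∀ (D : Square (suc n)) l → minorᵀ j D q l ≈ D i (suc l)
        at-q D l = reflexive (≡.cong (λ m → D m (suc l)) (Fin.punchIn-punchOut j≢i))
        off-q : ∀ m → m ≢ q → punchIn j m ≢ i
        off-q m m≢q eq = m≢q (Fin.punchIn-injective j m q (≡.trans eq (≡.sym (Fin.punchIn-punchOut j≢i))))

    -- A term that removes another row keeps the equal pair in its minor and vanishes by induction.
    -- The two terms that remove a row of the pair have equal minors and opposite signs.
    detᵀ-adjacent : ∀ {n} (p : Fin n) → VanishesAt (detᵀ {suc n}) (inject₁ p) (suc p)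
    detᵀ-adjacent {suc n} p A Ap≈Ap+1 = sum-adjacent _ p others cancel
      where
      others : ∀ j → j ≢ inject₁ p → j ≢ suc p → (sign j * A j zero) * detᵀ (minorᵀ j A) ≈ 0#
      others j j≢p j≢p+1 with q , eq , eq′ ← punchIn-adjacent j p j≢p j≢p+1 =
        trans (*-congˡ (detᵀ-adjacent q (minorᵀ j A) λ l → begin
          A (punchIn j (inject₁ q)) (suc l)   ≡⟨ ≡.cong (λ m → A m (suc l)) eq ⟩
          A (inject₁ p) (suc l)               ≈⟨ Ap≈Ap+1 (suc l) ⟩
          A (suc p) (suc l)                   ≡⟨ ≡.cong (λ m → A m (suc l)) eq′ ⟨
          A (punchIn j (suc q)) (suc l)       ∎)) (zeroʳ _)

      same-minor : ∀ i l → minorᵀ (inject₁ p) A i l ≈ minorᵀ (suc p) A i l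
      same-minor i l with i Fin.≟ p
      ... | no i≢p     = reflexive (≡.cong (λ m → A m (suc l)) (punchIn-inject₁-suc p i i≢p))
      ... | yes ≡.refl = begin
        A (punchIn (inject₁ p) p) (suc l)   ≡⟨ ≡.cong (λ m → A m (suc l)) (punchIn-inject₁-self p) ⟩
        A (suc p) (suc l)                   ≈⟨ Ap≈Ap+1 (suc l) ⟨
        A (inject₁ p) (suc l)               ≡⟨ ≡.cong (λ m → A m (suc l)) (punchIn-suc-self p) ⟨
        A (punchIn (suc p) p) (suc l)       ∎

      s = (- 1#) ^ toℕ p
      a = A (suc p) zero
      d = detᵀ (minorᵀ (suc p) A)

      cancel : (sign (inject₁ p) * A (inject₁ p) zero) * detᵀ (minorᵀ (inject₁ p) A) +
               (sign (suc p) * a) * d ≈ 0#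
      cancel = begin
        (sign (inject₁ p) * A (inject₁ p) zero) * detᵀ (minorᵀ (inject₁ p) A) + ((- 1# * s) * a) * d
          ≈⟨ +-cong (*-cong (*-cong (reflexive (≡.cong ((- 1#) ^_) (Fin.toℕ-inject₁ p))) (Ap≈Ap+1 zero))
                            (detᵀ-cong same-minor))
                    (trans (*-congʳ (*-assoc (- 1#) s a)) (*-assoc (- 1#) (s * a) d)) ⟩
        (s * a) * d + - 1# * ((s * a) * d)
          ≈⟨ +-congˡ (-1*x≈-x _) ⟩
        (s * a) * d - (s * a) * d
          ≈⟨ -‿inverseʳ _ ⟩
        0# ∎

  detᵀ-multilinear : ∀ {n} → IsMultilinear (detᵀ {n})
  detᵀ-multilinear = record { cong = detᵀ-cong ; linear = detᵀ-linear }

  detᵀ-alternating : ∀ {n} → IsAlternating (detᵀ {n})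
  detᵀ-alternating {zero}  = record { isMultilinear = detᵀ-multilinear ; vanish = λ { {()} } }
  detᵀ-alternating {suc n} = alternating detᵀ-multilinear detᵀ-adjacent

  determinant-cong : ∀ {n} {A B : Square n} → (∀ i l → A i l ≈ B i l) → determinant A ≈ determinant B
  determinant-cong A≈B = detᵀ-cong λ i l → A≈B l i

  determinant-scaleRows : ∀ {n} (c : Fin n → Carrier) (A : Square n) →
    determinant (λ i l → c i * A i l) ≈ product c * determinant A
  determinant-scaleRows {zero}  c A = sym (*-identityˡ 1#)
  determinant-scaleRows {suc n} c A = begin
    sum (λ j → (sign j * (c zero * A zero j)) * determinant (λ i l → c (suc i) * minor j i l))
      ≈⟨ sum-cong-≋ term ⟩
    sum (λ j → product c * ((sign j * A zero j) * determinant (minor j)))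
      ≈⟨ *-distribˡ-sum (product c) (λ j → (sign j * A zero j) * determinant (minor j)) ⟨
    product c * determinant A ∎
    where
    minor : Fin (suc n) → Square n
    minor j i l = A (suc i) (punchIn j l)

    term : ∀ j → (sign j * (c zero * A zero j)) * determinant (λ i l → c (suc i) * minor j i l) ≈
                 product c * ((sign j * A zero j) * determinant (minor j))
    term j = begin
      (s * (c zero * a)) * determinant (λ i l → c (suc i) * minor j i l)
        ≈⟨ *-congˡ (determinant-scaleRows (c ∘ suc) (minor j)) ⟩
      (s * (c zero * a)) * (product (c ∘ suc) * d)
        ≈⟨ *-congʳ (trans (sym (*-assoc s _ a)) (trans (*-congʳ (*-comm s _)) (*-assoc _ s a))) ⟩
      (c zero * (s * a)) * (product (c ∘ suc) * d)
        ≈⟨ *-assoc (c zero) _ _ ⟩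
      c zero * ((s * a) * (product (c ∘ suc) * d))
        ≈⟨ *-congˡ (trans (sym (*-assoc _ _ d)) (trans (*-congʳ (*-comm _ _)) (*-assoc _ _ d))) ⟩
      c zero * (product (c ∘ suc) * ((s * a) * d))
        ≈⟨ *-assoc (c zero) _ _ ⟨
      product c * ((s * a) * d) ∎
      where
      s = sign j
      a = A zero j
      d = determinant (minor j)

  determinant-identity : ∀ {n} → determinant (identity {n}) ≈ 1#
  determinant-identity {zero}  = refl
  determinant-identity {suc n} = begin
    sum (λ j → (sign j * identity zero j) * determinant (minor j))
      ≈⟨ +-congˡ (sum-0 {n} λ j → trans (*-congʳ (zeroʳ (sign (suc j)))) (zeroˡ (determinant (minor (suc j))))) ⟩
    (1# * 1#) * determinant (identity {n}) + 0#
      ≈⟨ trans (+-identityʳ _) (trans (*-congʳ (*-identityʳ 1#)) (*-identityˡ _)) ⟩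
    determinant (identity {n})
      ≈⟨ determinant-identity {n} ⟩
    1# ∎
    where
    minor : Fin (suc n) → Square n
    minor j i l = identity (suc i) (punchIn j l)

  _⊡_ : ∀ {n} → Square n → Square n → Square n
  (A ⊡ B) i l = sum λ j → A i j * B j l

  module _ {n} (P : Square n) where

    detᵀ-⊡-alternating : IsAlternating (λ A → detᵀ (A ⊡ P))
    detᵀ-⊡-alternating = record
      { isMultilinear = record
        { cong   = λ A≈B → cong λ i l → sum-cong-≋ λ j → *-congʳ (A≈B i j)
        ; linear = λ i c {A} {B} {C} Ai A≈B A≈C → linear i c
            (λ l → begin
              sum (λ j → A i j * P j l)
                ≈⟨ sum-cong-≋ (λ j → trans (*-congʳ (Ai j))
                     (trans (distribʳ (P j l) (B i j) (c * C i j)) (+-congˡ (*-assoc c (C i j) (P j l))))) ⟩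
              sum (λ j → B i j * P j l + c * (C i j * P j l))
                ≈⟨ sum-linear c (λ j → B i j * P j l) (λ j → C i j * P j l) ⟩
              (B ⊡ P) i l + c * (C ⊡ P) i l ∎)
            (λ m m≢i l → sum-cong-≋ λ j → *-congʳ (A≈B m m≢i j))
            (λ m m≢i l → sum-cong-≋ λ j → *-congʳ (A≈C m m≢i j))
        }
      ; vanish = λ i≢m A Ai≈Am → vanish i≢m (A ⊡ P) λ l → sum-cong-≋ λ j → *-congʳ (Ai≈Am j)
      }
      where open IsAlternating (detᵀ-alternating {n})

    -- For fixed `P` the left side is alternating in `A`, with value `detᵀ P` at the identity.
    detᵀ-⊡ : ∀ A → detᵀ (A ⊡ P) ≈ determinant A * detᵀ P
    detᵀ-⊡ A = trans (alternating-determinant detᵀ-⊡-alternating A)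
      (*-congˡ (detᵀ-cong λ i l → sum-identityˡ (λ j → P j l) i))

  -- From M P = P Λ and Q P = c I, take determinants of the first and multiply by that of `Q`: the
  -- product of the determinants of `Q` and `P` is the n-th power of c. This power stays on both
  -- sides, since nothing can be cancelled in an arbitrary commutative ring.
  determinant-diagonalized : ∀ {n} (M P Q : Square n) (eigenvalue : Fin n → Carrier) c →
    (∀ i l → (M ⊡ P) i l ≈ eigenvalue l * P i l) → (∀ i l → (Q ⊡ P) i l ≈ c * identity i l) →
    product {n} (λ _ → c) * determinant M ≈ product {n} (λ _ → c) * product eigenvalue
  determinant-diagonalized {n} M P Q eigenvalue c MP≈Pλ QP≈c = begin
    product {n} (λ _ → c) * determinant M
      ≈⟨ *-congʳ cⁿ≈ ⟩
    (determinant Q * detᵀ P) * determinant M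
      ≈⟨ trans (*-assoc _ _ _) (*-congˡ (*-comm _ _)) ⟩
    determinant Q * (determinant M * detᵀ P)
      ≈⟨ *-congˡ (detᵀ-⊡ P M) ⟨
    determinant Q * detᵀ (M ⊡ P)
      -- The eigenvalues scale the columns of `P`, which are the rows of the matrix that `detᵀ`
      -- hands to `determinant`.
      ≈⟨ *-congˡ (trans (detᵀ-cong MP≈Pλ) (determinant-scaleRows eigenvalue (λ l i → P i l))) ⟩
    determinant Q * (product eigenvalue * detᵀ P)
      ≈⟨ trans (*-congˡ (*-comm _ _)) (sym (*-assoc _ _ _)) ⟩
    (determinant Q * detᵀ P) * product eigenvalue
      ≈⟨ *-congʳ cⁿ≈ ⟨
    product {n} (λ _ → c) * product eigenvalue ∎
    where
    cⁿ≈ : product {n} (λ _ → c) ≈ determinant Q * detᵀ P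
    cⁿ≈ = begin
      product {n} (λ _ → c)
        ≈⟨ *-identityʳ _ ⟨
      product {n} (λ _ → c) * 1#
        ≈⟨ *-congˡ (determinant-identity {n}) ⟨
      product {n} (λ _ → c) * determinant (identity {n})
        ≈⟨ determinant-scaleRows {n} (λ _ → c) (identity {n}) ⟨
      determinant {n} (λ i l → c * identity i l)
        ≈⟨ determinant-cong {n} {λ i l → c * identity i l} {λ i l → c * identity l i} (λ i l → *-congˡ (reflexive (identity-sym i l))) ⟩
      detᵀ {n} (λ i l → c * identity i l)
        ≈⟨ detᵀ-cong {n} QP≈c ⟨
      detᵀ (Q ⊡ P)
        ≈⟨ detᵀ-⊡ P Q ⟩
      determinant Q * detᵀ P ∎

  laplace : ∀ {n} → (Square n → Carrier) → Square (suc n) → Carrier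
  laplace D A = sum λ j → (((- 1#) ^ toℕ j) * A zero j) * D (λ i l → A (suc i) (punchIn j l))

  -- The hypotheses are the two defining clauses, so another determinant is identified through its
  -- recursion alone.
  determinant-unique : (D : ∀ {n} → Square n → Carrier) → (∀ A → D {zero} A ≡ 1#) →
    (∀ {n} A → D {suc n} A ≡ laplace D A) → ∀ {n} (A : Square n) → D A ≈ determinant A
  determinant-unique D D-zero D-suc {zero}  A = reflexive (D-zero A)
  determinant-unique D D-zero D-suc {suc n} A = trans (reflexive (D-suc A))
    (sum-cong-≋ λ j → *-congˡ {((- 1#) ^ toℕ j) * A zero j} (determinant-unique D D-zero D-suc λ i l → A (suc i) (punchIn j l)))

-- Sums over enumerated setoids

module FiniteSums {k κ : Level} (K : CommutativeRing k κ) where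
  open CommutativeRing K hiding (zero)
  open Algebra.Properties.Semiring.Sum semiring
  open import Relation.Binary.Reasoning.Setoid setoid

  opaque
    -- The Iverson bracket in K: conditions become factors, so that sums over subsets are full sums
    -- whose order can be interchanged.
    indicator : ∀ {p} {P : Set p} → Dec P → Carrier
    indicator d = if does d then 1# else 0#

    indicator-if : ∀ {p} {P : Set p} (d : Dec P) → (if does d then 1# else 0#) ≡ indicator d
    indicator-if d = ≡.refl

  module _ {p} {P : Set p} where
    opaque
      unfolding indicator

      indicator-yes : (d : Dec P) → P → indicator d ≈ 1#
      indicator-yes (yes _) p = refl
      indicator-yes (no ¬p) p = contradiction p ¬p

      indicator-no : (d : Dec P) → ¬ P → indicator d ≈ 0#
      indicator-no (yes p) ¬p = contradiction p ¬p
      indicator-no (no _)  ¬p = refl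

      indicator-⇔ : ∀ {q} {Q : Set q} (d : Dec P) (e : Dec Q) →
                    (P → Q) → (Q → P) → indicator d ≈ indicator e
      indicator-⇔ d e P⇒Q Q⇒P =
        reflexive (≡.cong (λ b → if b then 1# else 0#) (does-⇔ (mk⇔ P⇒Q Q⇒P) d e))

      indicator-× : ∀ {q} {Q : Set q} (d : Dec P) (e : Dec Q) →
                    indicator (d ×-dec e) ≈ indicator d * indicator e
      indicator-× (yes _) e = sym (*-identityˡ _)
      indicator-× (no _)  e = sym (zeroˡ _)

  opaque
    -- Summing over positions makes distributivity and interchange of sums over `Fin` available for
    -- lists.
    sumList : ∀ {a} {A : Set a} → (A → Carrier) → List A → Carrier
    sumList f xs = sum λ i → f (List.lookup xs i)

    sumList-lookup : ∀ {a} {A : Set a} (f : A → Carrier) xs →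
                     sum (λ i → f (List.lookup xs i)) ≡ sumList f xs
    sumList-lookup f xs = ≡.refl

  module _ {a} {A : Set a} where
    opaque
      unfolding sumList indicator

      foldr-sumList : ∀ (f : A → Carrier) xs → foldr _+_ 0# (map f xs) ≡ sumList f xs
      foldr-sumList f []       = ≡.refl
      foldr-sumList f (x ∷ xs) = ≡.cong (λ s → f x + s) (foldr-sumList f xs)

      sumList-cong : ∀ {f g : A → Carrier} → (∀ x → f x ≈ g x) → ∀ xs → sumList f xs ≈ sumList g xs
      sumList-cong f≈g xs = sum-cong-≋ λ i → f≈g (List.lookup xs i)

      sumList-∷ : ∀ (f : A → Carrier) x xs → sumList f (x ∷ xs) ≡ f x + sumList f xs
      sumList-∷ f x xs = ≡.refl

      sumList-0 : ∀ {f : A → Carrier} xs → All (λ x → f x ≈ 0#) xs → sumList f xs ≈ 0#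
      sumList-0 []       []           = refl
      sumList-0 (x ∷ xs) (fx≈0 ∷ rest) = trans (+-cong fx≈0 (sumList-0 xs rest)) (+-identityˡ 0#)

      *-sumListˡ : ∀ c (f : A → Carrier) xs → c * sumList f xs ≈ sumList (λ x → c * f x) xs
      *-sumListˡ c f xs = *-distribˡ-sum c λ i → f (List.lookup xs i)

      *-sumListʳ : ∀ c (f : A → Carrier) xs → sumList f xs * c ≈ sumList (λ x → f x * c) xs
      *-sumListʳ c f xs = *-distribʳ-sum c λ i → f (List.lookup xs i)

      sumList-[] : ∀ (f : A → Carrier) → sumList f [] ≡ 0#
      sumList-[] f = ≡.refl

      sumList-+ : ∀ (f g : A → Carrier) xs →
                  sumList (λ x → f x + g x) xs ≈ sumList f xs + sumList g xs
      sumList-+ f g xs = ∑-distrib-+ (λ i → f (List.lookup xs i)) (λ i → g (List.lookup xs i))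

      sumList-comm : ∀ {b} {B : Set b} (f : A → B → Carrier) xs ys →
        sumList (λ x → sumList (f x) ys) xs ≈ sumList (λ y → sumList (λ x → f x y) xs) ys
      sumList-comm f xs ys = ∑-comm λ i j → f (List.lookup xs i) (List.lookup ys j)

      sumList-sum : ∀ {m} (f : Fin m → A → Carrier) xs →
        sumList (λ x → sum (λ i → f i x)) xs ≈ sum (λ i → sumList (f i) xs)
      sumList-sum f xs = ∑-comm λ j i → f i (List.lookup xs j)

      sumList-++ : ∀ (f : A → Carrier) xs ys → sumList f (xs ++ ys) ≈ sumList f xs + sumList f ys
      sumList-++ f []       ys = sym (+-identityˡ _)
      sumList-++ f (x ∷ xs) ys = trans (+-congˡ (sumList-++ f xs ys)) (sym (+-assoc (f x) _ _))

      sumList-map : ∀ {b} {B : Set b} (f : A → Carrier) (g : B → A) xs →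
                    sumList f (map g xs) ≡ sumList (f ∘ g) xs
      sumList-map f g []       = ≡.refl
      sumList-map f g (x ∷ xs) = ≡.cong (λ s → f (g x) + s) (sumList-map f g xs)

      sumList-filter : ∀ {p} {P : Pred A p} (P? : Decidable P) f xs →
        sumList f (filter P? xs) ≈ sumList (λ x → indicator (P? x) * f x) xs
      sumList-filter P? f []       = refl
      sumList-filter P? f (x ∷ xs) with does (P? x)
      ... | true  = +-cong (sym (*-identityˡ (f x))) (sumList-filter P? f xs)
      ... | false = trans (sumList-filter P? f xs) (sym (trans (+-congʳ (zeroˡ (f x))) (+-identityˡ _)))

  opaque
    unfolding sumList

    sumList-cartesianProduct : ∀ {a b} {A : Set a} {B : Set b} (f : A × B → Carrier) xs ys →
      sumList f (cartesianProduct xs ys) ≈ sumList (λ x → sumList (λ y → f (x , y)) ys) xs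
    sumList-cartesianProduct f []       ys = refl
    sumList-cartesianProduct f (x ∷ xs) ys = trans (sumList-++ f (map (x ,_) ys) _)
      (+-cong (reflexive (sumList-map f (x ,_) ys)) (sumList-cartesianProduct f xs ys))

  sumOver : ∀ {c ℓ} {S : Setoid c ℓ} → Finite S → (Setoid.Carrier S → Carrier) → Carrier
  sumOver S f = sumList f (Finite.elements S)

  module _ {c ℓ} {S : Setoid c ℓ} (fin : Finite S) where
    open Finite fin renaming (_≟_ to _≟ₛ_)
    open Setoid S using () renaming (Carrier to A; _≈_ to _~_; trans to ~-trans; sym to ~-sym)

    sumOver-cong : ∀ {f g : A → Carrier} → (∀ x → f x ≈ g x) → sumOver fin f ≈ sumOver fin g
    sumOver-cong f≈g = sumList-cong f≈g elements

    -- Exactly one entry of the enumeration equals `a`, by `unique`, and it does so only up to the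
    -- setoid, which is where `f-cong` enters.
    sumOver-δ : ∀ {f : A → Carrier} → f Preserves _~_ ⟶ _≈_ → ∀ a →
                sumOver fin (λ x → indicator (a ≟ₛ x) * f x) ≈ f a
    sumOver-δ {f} f-cong a = go elements unique (enumerates a)
      where
      go : ∀ xs → Unique S xs → _∈_ S a xs → sumList (λ x → indicator (a ≟ₛ x) * f x) xs ≈ f a
      go (x ∷ xs) (x≁xs ∷ _) (here a~x) = begin
        sumList (λ x → indicator (a ≟ₛ x) * f x) (x ∷ xs)
          ≡⟨ sumList-∷ _ x xs ⟩
        indicator (a ≟ₛ x) * f x + sumList (λ x → indicator (a ≟ₛ x) * f x) xs
          ≈⟨ +-cong (trans (*-congʳ (indicator-yes (a ≟ₛ x) a~x)) (*-identityˡ (f x)))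
                    (sumList-0 xs (All.map (λ {y} x≁y → trans (*-congʳ (indicator-no (a ≟ₛ y)
                       (λ a~y → x≁y (~-trans (~-sym a~x) a~y)))) (zeroˡ (f y))) x≁xs)) ⟩
        f x + 0#
          ≈⟨ +-identityʳ (f x) ⟩
        f x
          ≈⟨ f-cong a~x ⟨
        f a ∎
      go (x ∷ xs) (x≁xs ∷ xs!) (there a∈xs) = begin
        sumList (λ x → indicator (a ≟ₛ x) * f x) (x ∷ xs)
          ≡⟨ sumList-∷ _ x xs ⟩
        indicator (a ≟ₛ x) * f x + sumList (λ x → indicator (a ≟ₛ x) * f x) xs
          ≈⟨ +-cong (trans (*-congʳ (indicator-no (a ≟ₛ x) a≁x)) (zeroˡ (f x))) (go xs xs! a∈xs) ⟩
        0# + f a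
          ≈⟨ +-identityˡ (f a) ⟩
        f a ∎
        where
        distinct : ∀ {ys} → All (λ z → ¬ x ~ z) ys → _∈_ S a ys → ¬ x ~ a
        distinct (x≁y ∷ _) (here a~y)  x~a = x≁y (~-trans x~a a~y)
        distinct (_ ∷ x≁)  (there a∈)  x~a = distinct x≁ a∈ x~a
        a≁x : ¬ a ~ x
        a≁x a~x = distinct x≁xs a∈xs (~-sym a~x)

  module _ {c ℓ c′ ℓ′} {S : Setoid c ℓ} {T : Setoid c′ ℓ′} (finS : Finite S) (finT : Finite T) where
    open Setoid S using () renaming (Carrier to A; _≈_ to _~_; sym to ~-sym)
    open Setoid T using () renaming (Carrier to B; _≈_ to _≋_; trans to ≋-trans; sym to ≋-sym)
    open Finite finS using () renaming (_≟_ to _~?_)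
    open Finite finT using () renaming (_≟_ to _≋?_)

    -- The enumerations are compared without reordering them. Inserting a sum over y of the
    -- indicator of f x = y and interchanging the sums leaves the size of each fibre, which is one
    -- where `Q` holds and zero elsewhere.
    sumOver-bijection : ∀ {p q} {P : Pred A p} {Q : Pred B q} (P? : Decidable P) (Q? : Decidable Q) →
      P Respects _~_ → Q Respects _≋_ →
      (f : A → B) → f Preserves _~_ ⟶ _≋_ → (∀ {x} → P x → Q (f x)) →
      (∀ {x x′} → P x → P x′ → f x ≋ f x′ → x ~ x′) → (∀ {y} → Q y → ∃ λ x → P x × f x ≋ y) →
      {F : B → Carrier} → F Preserves _≋_ ⟶ _≈_ →
      sumOver finS (λ x → indicator (P? x) * F (f x)) ≈ sumOver finT (λ y → indicator (Q? y) * F y)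
    sumOver-bijection {P = P} {Q} P? Q? P-resp Q-resp f f-cong P⇒Q injective surjective {F} F-cong = begin
      sumOver finS (λ x → indicator (P? x) * F (f x))
        ≈⟨ sumOver-cong finS (λ x → *-congˡ (sym (sumOver-δ finT F-cong (f x)))) ⟩
      sumOver finS (λ x → indicator (P? x) * sumOver finT (λ y → indicator (f x ≋? y) * F y))
        ≈⟨ sumOver-cong finS (λ x → *-sumListˡ (indicator (P? x)) _ (Finite.elements finT)) ⟩
      sumOver finS (λ x → sumOver finT (λ y → indicator (P? x) * (indicator (f x ≋? y) * F y)))
        ≈⟨ sumList-comm _ (Finite.elements finS) (Finite.elements finT) ⟩
      sumOver finT (λ y → sumOver finS (λ x → indicator (P? x) * (indicator (f x ≋? y) * F y)))
        ≈⟨ sumOver-cong finT (λ y → sumOver-cong finS λ x → sym (*-assoc _ _ (F y))) ⟩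
      sumOver finT (λ y → sumOver finS (λ x → indicator (P? x) * indicator (f x ≋? y) * F y))
        ≈⟨ sumOver-cong finT (λ y → *-sumListʳ (F y) _ (Finite.elements finS)) ⟨
      sumOver finT (λ y → sumOver finS (λ x → indicator (P? x) * indicator (f x ≋? y)) * F y)
        ≈⟨ sumOver-cong finT (λ y → *-congʳ (fibre y)) ⟩
      sumOver finT (λ y → indicator (Q? y) * F y) ∎
      where
      fibre : ∀ y → sumOver finS (λ x → indicator (P? x) * indicator (f x ≋? y)) ≈ indicator (Q? y)
      fibre y with Q? y
      ... | yes Qy = let x₀ , Px₀ , fx₀≋y = surjective Qy in begin
        sumOver finS (λ x → indicator (P? x) * indicator (f x ≋? y))
          ≈⟨ sumOver-cong finS (λ x → indicator-× (P? x) (f x ≋? y)) ⟨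
        sumOver finS (λ x → indicator (P? x ×-dec (f x ≋? y)))
          ≈⟨ sumOver-cong finS (λ x → indicator-⇔ (P? x ×-dec (f x ≋? y)) (x₀ ~? x)
               (λ (Px , fx≋y) → injective Px₀ Px (≋-trans fx₀≋y (≋-sym fx≋y)))
               (λ x₀~x → P-resp x₀~x Px₀ , ≋-trans (f-cong (~-sym x₀~x)) fx₀≋y)) ⟩
        sumOver finS (λ x → indicator (x₀ ~? x))
          ≈⟨ sumOver-cong finS (λ x → *-identityʳ _) ⟨
        sumOver finS (λ x → indicator (x₀ ~? x) * 1#)
          ≈⟨ sumOver-δ finS {λ _ → 1#} (λ _ → refl) x₀ ⟩
        1#
          ≈⟨ indicator-yes (yes Qy) Qy ⟨
        indicator (yes Qy) ∎
      ... | no ¬Qy = trans (sumList-0 (Finite.elements finS) (All.universal (λ x →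
        trans (sym (indicator-× (P? x) (f x ≋? y)))
              (indicator-no (P? x ×-dec (f x ≋? y)) λ (Px , fx≋y) → ¬Qy (Q-resp fx≋y (P⇒Q Px)))) _))
        (sym (indicator-no (no ¬Qy) ¬Qy))

-- Units, idempotents and maximal ideals of finite rings

module FiniteRings {c ℓ : Level} (T : FiniteRing c ℓ) where
  open FiniteRing T hiding (zero)
  open Algebra.Properties.Ring ring
  open Exponentiation semiring using (_^_; ^-homo-*)
  open CommutativeExponentiation commutativeSemiring using (^-distrib-*)
  open import Relation.Binary.Reasoning.Setoid setoid

  -- e is the idempotent cutting out the factor of T in which v is invertible.
  fitting-idempotent : ∀ v → ∃ λ i → ∃ λ q → ∃ λ e →
    e * e ≈ e × (v * q) * e ≈ e × v ^ i * e ≈ v ^ i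
  fitting-idempotent v
    with i , j , i<j , same ← Fin.pigeonhole {order} {suc order} ℕ.≤-refl
           (λ i → index (enumerates (v ^ toℕ i)))
    = toℕ i , q , e , absorb-e (toℕ i) , trans (*-comm p e) e*p , vⁱ-absorb (toℕ i)
    where
    -- Since v^i = v^j, multiplication by p = v^(j-i) fixes v^i. Hence it fixes e = p^i, a multiple
    -- of v^i, and e is idempotent. Taking d one less than j - i splits off a factor v from p, so
    -- that q inverts v on e.
    d = toℕ j ℕ.∸ suc (toℕ i)
    q = v ^ d
    p = v * q
    e = p ^ toℕ i

    vⁱ*p : v ^ toℕ i * p ≈ v ^ toℕ i
    vⁱ*p = begin
      v ^ toℕ i * v ^ suc d       ≈⟨ ^-homo-* v (toℕ i) (suc d) ⟨
      v ^ (toℕ i ℕ.+ suc d)       ≡⟨ ≡.cong (v ^_) (≡.trans (ℕ.+-suc (toℕ i) d) (ℕ.m+[n∸m]≡n i<j)) ⟩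
      v ^ toℕ j                   ≈⟨ index-injective setoid (enumerates _) (enumerates _) same ⟨
      v ^ toℕ i                   ∎

    vⁱ-absorb : ∀ m → v ^ toℕ i * p ^ m ≈ v ^ toℕ i
    vⁱ-absorb zero    = *-identityʳ _
    vⁱ-absorb (suc m) = trans (sym (*-assoc _ p _)) (trans (*-congʳ vⁱ*p) (vⁱ-absorb m))

    e*p : e * p ≈ e
    e*p = begin
      (v * q) ^ toℕ i * p               ≈⟨ *-congʳ (^-distrib-* v q (toℕ i)) ⟩
      (v ^ toℕ i * q ^ toℕ i) * p       ≈⟨ *-congʳ (*-comm _ _) ⟩
      (q ^ toℕ i * v ^ toℕ i) * p       ≈⟨ *-assoc _ _ p ⟩
      q ^ toℕ i * (v ^ toℕ i * p)       ≈⟨ *-congˡ vⁱ*p ⟩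
      q ^ toℕ i * v ^ toℕ i             ≈⟨ *-comm _ _ ⟩
      v ^ toℕ i * q ^ toℕ i             ≈⟨ ^-distrib-* v q (toℕ i) ⟨
      (v * q) ^ toℕ i                   ∎

    absorb-e : ∀ m → e * p ^ m ≈ e
    absorb-e zero    = *-identityʳ e
    absorb-e (suc m) = trans (sym (*-assoc e p _)) (trans (*-congʳ e*p) (absorb-e m))

  complement-* : ∀ e → e * e ≈ e → e * (1# - e) ≈ 0#
  complement-* e ee≈e = begin
    e * (1# - e)        ≈⟨ distribˡ e 1# (- e) ⟩
    e * 1# + e * - e    ≈⟨ +-cong (*-identityʳ e) (trans (sym (-‿distribʳ-* e e)) (-‿cong ee≈e)) ⟩
    e - e               ≈⟨ -‿inverseʳ e ⟩
    0#                  ∎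

  +-complement : ∀ e → e + (1# - e) ≈ 1#
  +-complement e = begin
    e + (1# - e)        ≈⟨ +-comm e _ ⟩
    1# - e + e          ≈⟨ +-assoc 1# (- e) e ⟩
    1# + (- e + e)      ≈⟨ +-congˡ (-‿inverseˡ e) ⟩
    1# + 0#             ≈⟨ +-identityʳ 1# ⟩
    1#                  ∎

  -- The inverse is `q` on the factor cut out by `e` and 1 on the complementary factor.
  patch-unit : ∀ {v q e} → e * e ≈ e → (v * q) * e ≈ e → IsUnit (v * e + (1# - e))
  patch-unit {v} {q} {e} ee≈e vqe≈e = q * e + e′ , (begin
    (v * e + e′) * (q * e + e′)
      ≈⟨ distribʳ _ (v * e) e′ ⟩
    v * e * (q * e + e′) + e′ * (q * e + e′)
      ≈⟨ +-cong (distribˡ (v * e) _ _) (distribˡ e′ _ _) ⟩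
    (v * e * (q * e) + v * e * e′) + (e′ * (q * e) + e′ * e′)
      ≈⟨ +-cong (+-cong vqe (trans (*-assoc v e e′) (trans (*-congˡ ee′) (zeroʳ v))))
                (+-cong (trans (*-comm e′ _) (trans (*-assoc q e e′) (trans (*-congˡ ee′) (zeroʳ q)))) e′e′) ⟩
    (e + 0#) + (0# + e′)
      ≈⟨ +-cong (+-identityʳ e) (+-identityˡ e′) ⟩
    e + e′
      ≈⟨ +-complement e ⟩
    1# ∎)
    where
    e′ = 1# - e
    ee′ = complement-* e ee≈e
    e′e′ : e′ * e′ ≈ e′
    e′e′ = begin
      e′ * e′             ≈⟨ +-identityˡ _ ⟨
      0# + e′ * e′        ≈⟨ +-congʳ ee′ ⟨
      e * e′ + e′ * e′    ≈⟨ distribʳ e′ e e′ ⟨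
      (e + e′) * e′       ≈⟨ *-congʳ (+-complement e) ⟩
      1# * e′             ≈⟨ *-identityˡ e′ ⟩
      e′                  ∎
    vqe : v * e * (q * e) ≈ e
    vqe = begin
      v * e * (q * e)     ≈⟨ *-assoc v e _ ⟩
      v * (e * (q * e))   ≈⟨ *-congˡ (trans (*-comm e _) (trans (*-assoc q e e) (*-congˡ ee≈e))) ⟩
      v * (q * e)         ≈⟨ *-assoc v q e ⟨
      v * q * e           ≈⟨ vqe≈e ⟩
      e                   ∎

  *-unit : ∀ {a b} → IsUnit a → IsUnit b → IsUnit (a * b)
  *-unit {a} {b} (a⁻¹ , aa⁻¹≈1) (b⁻¹ , bb⁻¹≈1) = b⁻¹ * a⁻¹ , (begin
    a * b * (b⁻¹ * a⁻¹)     ≈⟨ *-assoc a b _ ⟩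
    a * (b * (b⁻¹ * a⁻¹))   ≈⟨ *-congˡ (*-assoc b b⁻¹ a⁻¹) ⟨
    a * (b * b⁻¹ * a⁻¹)     ≈⟨ *-congˡ (trans (*-congʳ bb⁻¹≈1) (*-identityˡ a⁻¹)) ⟩
    a * a⁻¹                 ≈⟨ aa⁻¹≈1 ⟩
    1#                      ∎)

  unit-inverse : ∀ {a} ((a⁻¹ , _) : IsUnit a) → IsUnit a⁻¹
  unit-inverse {a} (a⁻¹ , aa⁻¹≈1) = a , trans (*-comm a⁻¹ a) aa⁻¹≈1

  unit-cancelˡ : ∀ {a b d} → IsUnit a → a * b ≈ a * d → b ≈ d
  unit-cancelˡ {a} {b} {d} (a⁻¹ , aa⁻¹≈1) ab≈ad = trans (sym (undo b)) (trans (*-congˡ ab≈ad) (undo d))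
    where
    undo : ∀ x → a⁻¹ * (a * x) ≈ x
    undo x = trans (sym (*-assoc a⁻¹ a x))
      (trans (*-congʳ (trans (*-comm a⁻¹ a) aa⁻¹≈1)) (*-identityˡ x))

  private
    module _ (I : Ideal commutativeRing (c ⊔ ℓ)) (y : Carrier) where
      open Ideal I

      adjoin : Ideal commutativeRing (c ⊔ ℓ)
      adjoin = record
        { Member   = λ z → ∃ λ i → Member i × ∃ λ r → z ≈ i + r * y
        ; resp     = λ z≈w (i , i∈ , r , z≈) → i , i∈ , r , trans (sym z≈w) z≈
        ; 0∈       = 0# , 0∈ , 0# , sym (trans (+-identityˡ _) (zeroˡ y))
        ; +-closed = λ {z} {w} (i , i∈ , r , z≈) (j , j∈ , s , w≈) →
            i + j , +-closed i∈ j∈ , r + s , (begin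
              z + w                       ≈⟨ +-cong z≈ w≈ ⟩
              (i + r * y) + (j + s * y)   ≈⟨ +-assoc i _ _ ⟩
              i + (r * y + (j + s * y))   ≈⟨ +-congˡ (+-assoc _ j _) ⟨
              i + (r * y + j + s * y)     ≈⟨ +-congˡ (+-congʳ (+-comm _ j)) ⟩
              i + (j + r * y + s * y)     ≈⟨ +-congˡ (+-assoc j _ _) ⟩
              i + (j + (r * y + s * y))   ≈⟨ +-assoc i j _ ⟨
              i + j + (r * y + s * y)     ≈⟨ +-congˡ (distribʳ y r s) ⟨
              i + j + (r + s) * y         ∎)
        ; *-closed = λ t {z} (i , i∈ , r , z≈) → t * i , *-closed t i∈ , t * r ,
            trans (*-congˡ z≈) (trans (distribˡ t i _) (+-congˡ (sym (*-assoc t r y))))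
        }

      adjoin-⊆ : Member ⊆ Ideal.Member adjoin
      adjoin-⊆ {z} z∈ = z , z∈ , 0# , sym (trans (+-congˡ (zeroˡ y)) (+-identityʳ z))

      adjoin-∈ : Ideal.Member adjoin y
      adjoin-∈ = 0# , 0∈ , 1# , sym (trans (+-identityˡ _) (*-identityˡ y))

      adjoin-least : (J : Ideal commutativeRing (c ⊔ ℓ)) → Member ⊆ Ideal.Member J →
                     Ideal.Member J y → Ideal.Member adjoin ⊆ Ideal.Member J
      adjoin-least J I⊆J y∈J (i , i∈ , r , z≈) =
        Ideal.resp J (sym z≈) (Ideal.+-closed J (I⊆J i∈) (Ideal.*-closed J r y∈J))

      adjoin? : Decidable Member → Decidable (Ideal.Member adjoin)
      adjoin? I? z = ∃? (λ i≈j (i∈ , r , z≈) → resp i≈j i∈ , r , trans z≈ (+-congʳ i≈j))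
        (λ i → I? i ×-dec ∃? (λ r≈s z≈ → trans z≈ (+-congˡ (*-congʳ r≈s))) (λ r → z ≟ i + r * y))

    -- One pass over a finite list takes the place of Zorn's lemma: maximality is demanded only with
    -- respect to the listed elements, and the list will be the whole enumeration.
    record Extension (I : Ideal commutativeRing (c ⊔ ℓ)) (xs : List Carrier) : Set (Level.suc (c ⊔ ℓ)) where
      field
        ideal     : Ideal commutativeRing (c ⊔ ℓ)
        proper    : IsProper commutativeRing ideal
        contains  : Ideal.Member I ⊆ Ideal.Member ideal
        saturated : All (λ y → (J : Ideal commutativeRing (c ⊔ ℓ)) → IsProper commutativeRing J → Ideal.Member ideal ⊆ Ideal.Member J →
                               Ideal.Member J y → Ideal.Member ideal y) xs

    -- An element is adjoined if this keeps 1 out. Otherwise every ideal containing it and the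
    -- current ideal contains 1, and this remains true as the ideal grows.
    extend : ∀ I → Decidable (Ideal.Member I) → IsProper commutativeRing I → ∀ xs → Extension I xs
    extend I I? 1∉I [] = record { ideal = I ; proper = 1∉I ; contains = λ i∈ → i∈ ; saturated = [] }
    extend I I? 1∉I (y ∷ ys) with adjoin? I y I? 1#
    ... | no 1∉Iy = record
      { ideal = E.ideal ; proper = E.proper
      ; contains = λ i∈ → E.contains (adjoin-⊆ I y i∈)
      ; saturated = (λ _ _ _ _ → E.contains (adjoin-∈ I y)) ∷ E.saturated
      }
      where module E = Extension (extend (adjoin I y) (adjoin? I y I?) 1∉Iy ys)
    ... | yes 1∈Iy = record
      { ideal = E.ideal ; proper = E.proper ; contains = E.contains
      ; saturated = (λ J 1∉J E⊆J y∈J → contradiction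
          (adjoin-least I y J (λ i∈ → E⊆J (E.contains i∈)) y∈J 1∈Iy) 1∉J) ∷ E.saturated
      }
      where module E = Extension (extend I I? 1∉I ys)

  maximalIdeal-above : (I : Ideal commutativeRing (c ⊔ ℓ)) → Decidable (Ideal.Member I) →
    IsProper commutativeRing I →
    ∃ λ M → IsMaximal commutativeRing M × Ideal.Member I ⊆ Ideal.Member M
  maximalIdeal-above I I? 1∉I = E.ideal , (E.proper , maximal) , E.contains
    where
    module E = Extension (extend I I? 1∉I elements)
    maximal : (J : Ideal commutativeRing (c ⊔ ℓ)) → IsProper commutativeRing J → Ideal.Member E.ideal ⊆ Ideal.Member J →
              Ideal.Member J ⊆ Ideal.Member E.ideal
    maximal J 1∉J E⊆J {z} z∈J =
      let saturated , z≈y = All.lookupAny E.saturated (enumerates z)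
      in Ideal.resp E.ideal (sym z≈y) (saturated J 1∉J E⊆J (Ideal.resp J z≈y z∈J))

  module _ (T-local : IsLocal {c} {ℓ} T) where
    private
      M         = proj₁ T-local
      M-maximal = proj₁ (proj₂ T-local)
      M-unique  = proj₂ (proj₂ T-local)

      -- A nonunit generates a proper ideal, and the maximal ideal constructed above it has to be
      -- `M`.
      nonunit∈M : ∀ {a} → ¬ IsUnit a → Ideal.Member M a
      nonunit∈M {a} a∉U =
        let J , J-maximal , a⊆J = maximalIdeal-above (principal commutativeRing a)
              (λ z → ∃? (λ r≈s z≈ → trans z≈ (*-congʳ r≈s)) (λ r → z ≟ r * a))
              (λ (b , 1≈ba) → a∉U (b , trans (*-comm a b) (sym 1≈ba)))
        in proj₁ (M-unique J J-maximal) (a⊆J (1# , sym (*-identityˡ a)))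

      unit∉M : ∀ {u} → IsUnit u → ¬ Ideal.Member M u
      unit∉M {u} (v , uv≈1) u∈M =
        proj₁ M-maximal (Ideal.resp M (trans (*-comm v u) uv≈1) (Ideal.*-closed M v u∈M))

    local-1≉0 : ¬ 1# ≈ 0#
    local-1≉0 1≈0 = proj₁ M-maximal (Ideal.resp M (sym 1≈0) (Ideal.0∈ M))

    -- Otherwise u = (u + a) - a would be a difference of nonunits and lie in `M`. It makes the set
    -- of units stable under translation by nonunits.
    local-unit+nonunit : ∀ {u a} → IsUnit u → ¬ IsUnit a → IsUnit (u + a)
    local-unit+nonunit {u} {a} u∈U a∉U = decidable-stable (isUnit? (u + a)) λ u+a∉U →
      unit∉M u∈U (Ideal.resp M (begin
        (u + a) + - a     ≈⟨ +-assoc u a (- a) ⟩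
        u + (a - a)       ≈⟨ +-congˡ (-‿inverseʳ a) ⟩
        u + 0#            ≈⟨ +-identityʳ u ⟩
        u                 ∎)
        (Ideal.+-closed M (nonunit∈M u+a∉U) (Ideal.-‿closed M (nonunit∈M a∉U))))

  factor-nonunit : ∀ {a} → ¬ IsUnit a → ∀ r → ¬ IsUnit (r * a)
  factor-nonunit {a} a∉U r (v , rav≈1) = a∉U (v * r , (begin
    a * (v * r)     ≈⟨ *-assoc a v r ⟨
    a * v * r       ≈⟨ *-comm _ r ⟩
    r * (a * v)     ≈⟨ *-assoc r a v ⟨
    r * a * v       ≈⟨ rav≈1 ⟩
    1#              ∎))

  -- Searching the finite ring turns the negated statement into a witness.
  nonzero-nonunit : ¬ 1# ≈ 0# → ¬ IsField → ∃ λ a → ¬ a ≈ 0# × ¬ IsUnit a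
  nonzero-nonunit 1≉0 ¬field = decidable-stable
    (∃? (λ a≈b (a≉0 , a∉U) → a≉0 ∘ trans a≈b , a∉U ∘ IsUnit-resp (sym a≈b))
        (λ a → ¬? (a ≟ 0#) ×-dec ¬? (isUnit? a)))
    λ none → ¬field (1≉0 , λ a a≉0 → decidable-stable (isUnit? a) λ a∉U → none (a , a≉0 , a∉U))

-- Lifting units along surjections of finite rings

module UnitLifting {c ℓ c′ ℓ′ : Level} (T : FiniteRing c ℓ) (U : FiniteRing c′ ℓ′)
  (f : FiniteRing.Carrier T → FiniteRing.Carrier U)
  (f-isHom : IsRingHomomorphism (FiniteRing.rawRing T) (FiniteRing.rawRing U) f) where
  private
    module T = FiniteRing T
    module FT = FiniteRings T
  open FiniteRing U hiding (zero)
  open IsRingHomomorphism f-isHom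
  open Exponentiation T.semiring using (_^_)
  open import Relation.Binary.Reasoning.Setoid setoid

  map-unit : ∀ {u} → T.IsUnit u → IsUnit (f u)
  map-unit {u} (v , uv≈1) = f v , trans (sym (*-homo u v)) (trans (⟦⟧-cong uv≈1) 1#-homo)

  -- Let v be any lift and e its idempotent. From v^i e = v^i and the invertibility of f(v) follows
  -- f(e) = 1, so replacing v by 1 off the factor of e makes it a unit without moving its image.
  lift-unit : (∀ y → ∃ λ x → f x ≈ y) → ∀ {y} → IsUnit y → ∃ λ w → T.IsUnit w × f w ≈ y
  lift-unit surjective {y} y∈U =
    let v , fv≈y = surjective y
        i , q , e , ee≈e , vqe≈e , vⁱe≈vⁱ = FT.fitting-idempotent v
        fe≈1 : f e ≈ 1#
        fe≈1 = cancel v (IsUnit-resp (sym fv≈y) y∈U) i (begin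
          f (v ^ i) * f e      ≈⟨ *-homo (v ^ i) e ⟨
          f (v ^ i T.* e)      ≈⟨ ⟦⟧-cong vⁱe≈vⁱ ⟩
          f (v ^ i)            ≈⟨ *-identityʳ _ ⟨
          f (v ^ i) * 1#       ∎)
    in v T.* e T.+ (T.1# T.- e) , FT.patch-unit ee≈e vqe≈e , (begin
      f (v T.* e T.+ (T.1# T.- e))      ≈⟨ +-homo _ _ ⟩
      f (v T.* e) + f (T.1# T.- e)      ≈⟨ +-cong (*-homo v e) (+-homo T.1# _) ⟩
      f v * f e + (f T.1# + f (T.- e))  ≈⟨ +-cong (*-cong fv≈y fe≈1) (+-cong 1#-homo (trans (-‿homo e) (-‿cong fe≈1))) ⟩
      y * 1# + (1# - 1#)                ≈⟨ +-cong (*-identityʳ y) (-‿inverseʳ 1#) ⟩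
      y + 0#                            ≈⟨ +-identityʳ y ⟩
      y                                 ∎)
    where
    cancel : ∀ v → IsUnit (f v) → ∀ i {a b} → f (v ^ i) * a ≈ f (v ^ i) * b → a ≈ b
    cancel v fv∈U zero {a} {b} eq = trans (sym (one a)) (trans eq (one b))
      where
      one : ∀ a → f T.1# * a ≈ a
      one a = trans (*-congʳ 1#-homo) (*-identityˡ a)
    cancel v fv∈U (suc i) {a} {b} eq = cancel v fv∈U i
      (FiniteRings.unit-cancelˡ U fv∈U (trans (sym (step a)) (trans eq (step b))))
      where
      step : ∀ a → f (v T.* v ^ i) * a ≈ f v * (f (v ^ i) * a)
      step a = trans (*-congʳ (*-homo v (v ^ i))) (*-assoc (f v) _ a)

-- Finite products of finite rings

module ProductRings {c ℓ : Level} where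

  module _ (T : FiniteRing c ℓ) (U : CommutativeRing c ℓ) (fin : Finite (CommutativeRing.setoid U)) where
    private
      module T = FiniteRing T
      module U = CommutativeRing U
      module F = Finite fin

    ×-finite : Finite (CommutativeRing.setoid (DirectProduct.commutativeRing T.commutativeRing U))
    ×-finite = record
      { _≟_        = λ (a , b) (a′ , b′) → (a T.≟ a′) ×-dec (b F.≟ b′)
      ; elements   = cartesianProduct T.elements F.elements
      ; enumerates = Enumerates.cartesianProduct⁺ T.setoid U.setoid T.enumerates F.enumerates
      ; unique     = Unique.cartesianProduct⁺ T.setoid U.setoid T.unique F.unique
      }

  ∏-finite : ∀ Ts → Finite (CommutativeRing.setoid (∏ {c} {ℓ} Ts))
  ∏-finite [] = record
    { _≟_ = λ _ _ → yes Unit.tt ; elements = Unit.tt ∷ []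
    ; enumerates = λ _ → here Unit.tt ; unique = [] ∷ [] }
  ∏-finite (T ∷ Ts) = ×-finite T (∏ Ts) (∏-finite Ts)

  ∏ᶠ : List (FiniteRing c ℓ) → FiniteRing c ℓ
  ∏ᶠ Ts = record { commutativeRing = ∏ Ts ; finite = ∏-finite Ts }

  infixr 5 _×ᶠ_
  _×ᶠ_ : FiniteRing c ℓ → FiniteRing c ℓ → FiniteRing c ℓ
  T ×ᶠ U = record
    { commutativeRing = DirectProduct.commutativeRing T.commutativeRing U.commutativeRing
    ; finite          = ×-finite T U.commutativeRing U.finite
    }
    where
    module T = FiniteRing T
    module U = FiniteRing U

-- Sums of additive characters over units

-- Phrased as cancellation rather than as a disjunction, which would amount to deciding which factor
-- is 0.
NoZeroDivisors : ∀ {k κ} → CommutativeRing k κ → Set (k ⊔ κ)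
NoZeroDivisors K = ∀ x y → x * y ≈ 0# → ¬ x ≈ 0# → y ≈ 0#
  where open CommutativeRing K

module CharacterSums {k κ : Level} (K : CommutativeRing k κ) (noZeroDivisors : NoZeroDivisors K) where
  open CommutativeRing K
  open FiniteSums K
  open Algebra.Properties.Ring ring
  open Algebra.Definitions.RawSemiring (Semiring.rawSemiring semiring) using (_^_)
  open import Relation.Binary.Reasoning.Setoid setoid

  record IsCharacter {c ℓ} (T : FiniteRing c ℓ) (χ : FiniteRing.Carrier T → Carrier) :
                     Set (c ⊔ ℓ ⊔ κ) where
    private module T = FiniteRing T
    field
      cong     : χ Preserves T._≈_ ⟶ _≈_
      additive : ∀ a b → χ (a T.+ b) ≈ χ a * χ b
      0-homo   : χ T.0# ≈ 1#

  -- The positive form of the condition that the kernel of `χ` contains no nonzero ideal: each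
  -- nonzero principal ideal comes with an element outside the kernel.
  Nondegenerate : ∀ {c ℓ} (T : FiniteRing c ℓ) → (FiniteRing.Carrier T → Carrier) → Set _
  Nondegenerate T χ = ∀ {a} → ¬ a T.≈ T.0# → ∃ λ r → ¬ χ (r T.* a) ≈ 1#
    where module T = FiniteRing T

  unitSum : ∀ {c ℓ} (T : FiniteRing c ℓ) → (FiniteRing.Carrier T → Carrier) → Carrier
  unitSum T F = sumOver T.finite (λ u → indicator (T.isUnit? u) * F u)
    where module T = FiniteRing T

  -- Here y will be a character sum that a translation multiplies by x.
  fixed⇒0 : ∀ {x y} → x * y ≈ y → ¬ x ≈ 1# → y ≈ 0#
  fixed⇒0 {x} {y} xy≈y x≉1 = noZeroDivisors (x - 1#) y
    (begin
      (x - 1#) * y          ≈⟨ distribʳ y x (- 1#) ⟩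
      x * y + - 1# * y      ≈⟨ +-cong xy≈y (-1*x≈-x y) ⟩
      y - y                 ≈⟨ -‿inverseʳ y ⟩
      0#                    ∎)
    (λ x-1≈0 → x≉1 (begin
      x                     ≈⟨ +-identityʳ x ⟨
      x + 0#                ≈⟨ +-congˡ (-‿inverseˡ 1#) ⟨
      x + (- 1# + 1#)       ≈⟨ +-assoc x (- 1#) 1# ⟨
      x - 1# + 1#           ≈⟨ +-congʳ x-1≈0 ⟩
      0# + 1#               ≈⟨ +-identityˡ 1# ⟩
      1#                    ∎))

  module _ {c ℓ} (T : FiniteRing c ℓ) where
    private
      module T = FiniteRing T
      module RP = Algebra.Properties.Ring T.ring

      translate-back : ∀ x r → (x T.- r) T.+ r T.≈ x
      translate-back x r = T.trans (T.+-assoc x (T.- r) r)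
        (T.trans (T.+-congˡ (T.-‿inverseˡ r)) (T.+-identityʳ x))

    sumOver-translate : ∀ {p} {P : Pred T.Carrier p} (P? : Decidable P) → P Respects T._≈_ → ∀ r →
      (∀ {x} → P x → P (x T.+ r)) → (∀ {x} → P x → P (x T.- r)) →
      {F : T.Carrier → Carrier} → F Preserves T._≈_ ⟶ _≈_ →
      sumOver T.finite (λ x → indicator (P? x) * F (x T.+ r)) ≈
      sumOver T.finite (λ x → indicator (P? x) * F x)
    sumOver-translate P? P-resp r P+r P-r = sumOver-bijection T.finite T.finite P? P? P-resp P-resp
      (T._+ r) T.+-congʳ P+r (λ _ _ → RP.+-cancelʳ r _ _)
      (λ {y} Py → y T.- r , P-r Py , translate-back y r)

    sumOver-shift : ∀ r {F : T.Carrier → Carrier} → F Preserves T._≈_ ⟶ _≈_ →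
                    sumOver T.finite (λ x → F (x T.+ r)) ≈ sumOver T.finite F
    sumOver-shift r {F} F-cong = begin
      sumOver T.finite (λ x → F (x T.+ r))
        ≈⟨ sumOver-cong T.finite (λ x → everything _) ⟩
      sumOver T.finite (λ x → indicator (yes tt) * F (x T.+ r))
        ≈⟨ sumOver-translate {P = λ _ → ⊤} (λ _ → yes tt) (λ _ _ → tt) r (λ _ → tt) (λ _ → tt) F-cong ⟩
      sumOver T.finite (λ x → indicator (yes tt) * F x)
        ≈⟨ sumOver-cong T.finite (λ x → everything _) ⟨
      sumOver T.finite F ∎
      where
      everything : ∀ y → y ≈ indicator (yes tt) * y
      everything y = sym (trans (*-congʳ (indicator-yes (yes tt) tt)) (*-identityˡ y))

    -- Reindexing by x ↦ x + r multiplies the sum by χ(r), which is not 1, while invariance of `P`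
    -- keeps it unchanged.
    translation-vanishing : ∀ {p} {P : Pred T.Carrier p} (P? : Decidable P) → P Respects T._≈_ → ∀ r →
      (∀ {x} → P x → P (x T.+ r)) → (∀ {x} → P x → P (x T.- r)) →
      {χ : T.Carrier → Carrier} → IsCharacter T χ → ¬ χ r ≈ 1# →
      sumOver T.finite (λ x → indicator (P? x) * χ x) ≈ 0#
    translation-vanishing P? P-resp r P+r P-r {χ} isCharacter χr≉1 = fixed⇒0 (begin
      χ r * sumOver T.finite (λ x → indicator (P? x) * χ x)
        ≈⟨ *-sumListˡ (χ r) _ T.elements ⟩
      sumOver T.finite (λ x → χ r * (indicator (P? x) * χ x))
        ≈⟨ sumOver-cong T.finite (λ x → begin
             χ r * (indicator (P? x) * χ x)    ≈⟨ *-comm _ _ ⟩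
             indicator (P? x) * χ x * χ r      ≈⟨ *-assoc _ _ _ ⟩
             indicator (P? x) * (χ x * χ r)    ≈⟨ *-congˡ (additive x r) ⟨
             indicator (P? x) * χ (x T.+ r)    ∎) ⟩
      sumOver T.finite (λ x → indicator (P? x) * χ (x T.+ r))
        ≈⟨ sumOver-translate P? P-resp r P+r P-r cong ⟩
      sumOver T.finite (λ x → indicator (P? x) * χ x) ∎) χr≉1
      where open IsCharacter isCharacter

    character-sum : ∀ {χ} → IsCharacter T χ → ∀ r → ¬ χ r ≈ 1# → sumOver T.finite χ ≈ 0#
    character-sum {χ} isCharacter r = fixed⇒0 (begin
      χ r * sumOver T.finite χ
        ≈⟨ *-sumListˡ (χ r) χ T.elements ⟩
      sumOver T.finite (λ x → χ r * χ x)
        ≈⟨ sumOver-cong T.finite (λ x → trans (*-comm _ _) (sym (additive x r))) ⟩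
      sumOver T.finite (λ x → χ (x T.+ r))
        ≈⟨ sumOver-shift r cong ⟩
      sumOver T.finite χ ∎)
      where open IsCharacter isCharacter

    multiply-character : ∀ {χ} → IsCharacter T χ → ∀ a → IsCharacter T (λ x → χ (x T.* a))
    multiply-character isCharacter a = record
      { cong     = λ x≈y → cong (T.*-congʳ x≈y)
      ; additive = λ x y → trans (cong (T.distribʳ a x y)) (additive _ _)
      ; 0-homo   = trans (cong (T.zeroˡ a)) 0-homo
      }
      where open IsCharacter isCharacter

    orthogonality : ∀ {χ} → IsCharacter T χ → Nondegenerate T χ → ∀ {a} → ¬ a T.≈ T.0# →
                    sumOver T.finite (λ x → χ (x T.* a)) ≈ 0#
    orthogonality isCharacter nondegenerate {a} a≉0 = let r , χra≉1 = nondegenerate a≉0 in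
      character-sum (multiply-character isCharacter a) r χra≉1

    module _ {χ} (isCharacter : IsCharacter T χ) (nondegenerate : Nondegenerate T χ) where
      open IsCharacter isCharacter

      field-unitSum : T.IsField → unitSum T χ ≈ - 1#
      field-unitSum (1≉0 , invertible) = +-inverseʳ-unique 1# (unitSum T χ) (begin
        1# + unitSum T χ
          ≈⟨ +-congʳ (trans (sumOver-δ T.finite cong T.0#) 0-homo) ⟨
        sumOver T.finite (λ x → indicator (T.0# T.≟ x) * χ x) + unitSum T χ
          ≈⟨ sumList-+ _ _ T.elements ⟨
        sumOver T.finite (λ x → indicator (T.0# T.≟ x) * χ x + indicator (T.isUnit? x) * χ x)
          ≈⟨ sumOver-cong T.finite (λ x → trans (sym (distribʳ (χ x) _ _)) (trans (*-congʳ (dichotomy x)) (*-identityˡ (χ x)))) ⟩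
        sumOver T.finite χ
          -- The full sum is orthogonality at the nonzero element 1.
          ≈⟨ sumOver-cong T.finite (λ x → cong (T.*-identityʳ x)) ⟨
        sumOver T.finite (λ x → χ (x T.* T.1#))
          ≈⟨ orthogonality isCharacter nondegenerate 1≉0 ⟩
        0# ∎)
        where
        dichotomy : ∀ x → indicator (T.0# T.≟ x) + indicator (T.isUnit? x) ≈ 1#
        dichotomy x with T.0# T.≟ x
        ... | yes 0≈x = trans (+-cong (indicator-yes (yes 0≈x) 0≈x) (indicator-no (T.isUnit? x) x∉U)) (+-identityʳ 1#)
          where
          x∉U : ¬ T.IsUnit x
          x∉U (y , xy≈1) = 1≉0 (T.trans (T.sym xy≈1) (T.trans (T.*-congʳ (T.sym 0≈x)) (T.zeroˡ y)))
        ... | no 0≉x  = trans (+-cong (indicator-no (no 0≉x) 0≉x)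
          (indicator-yes (T.isUnit? x) (invertible x (0≉x ∘ T.sym)))) (+-identityˡ 1#)

      local-unitSum : IsLocal {c} {ℓ} T → ¬ T.IsField → unitSum T χ ≈ 0#
      local-unitSum T-local ¬field =
        let a , a≉0 , a∉U = nonzero-nonunit (local-1≉0 T-local) ¬field
            r , χra≉1 = nondegenerate a≉0
            ra∉U = factor-nonunit a∉U r
        in translation-vanishing T.isUnit? T.IsUnit-resp (r T.* a)
             (λ u∈U → local-unit+nonunit T-local u∈U ra∉U)
             (λ u∈U → local-unit+nonunit T-local u∈U
               (λ -ra∈U → ra∉U (T.IsUnit-resp (RP.-‿involutive _) (negate-unit -ra∈U))))
             isCharacter χra≉1
        where
        open FiniteRings T
        negate-unit : ∀ {a} → T.IsUnit a → T.IsUnit (T.- a)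
        negate-unit {a} (b , ab≈1) = T.- b , T.trans
          (T.trans (T.sym (RP.-‿distribˡ-* a (T.- b)))
            (T.trans (T.-‿cong (T.sym (RP.-‿distribʳ-* a b))) (RP.-‿involutive _))) ab≈1

  fieldSign : ∀ {c ℓ} → FiniteRing c ℓ → Carrier
  fieldSign T = if does (FiniteRing.isField? T) then - 1# else 0#

  local-fieldSign : ∀ {c ℓ} (T : FiniteRing c ℓ) → IsLocal {c} {ℓ} T →
    ∀ {χ} → IsCharacter T χ → Nondegenerate T χ → unitSum T χ ≈ fieldSign T
  local-fieldSign {c} {ℓ} T T-local {χ} isCharacter nondegenerate = lemma (FiniteRing.isField? T)
    where
    lemma : (d : Dec (FiniteRing.IsField T)) → unitSum T χ ≈ (if does d then - 1# else 0#)
    lemma (yes field-T) = field-unitSum T isCharacter nondegenerate field-T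
    lemma (no ¬field)   = local-unitSum T isCharacter nondegenerate T-local ¬field

  module _ {c ℓ : Level} where
    open ProductRings {c} {ℓ}

    mobius : List (FiniteRing c ℓ) → Carrier
    mobius Ts = if does (All.all? FiniteRing.isField? Ts) then (- 1#) ^ length Ts else 0#

    mobius-∷ : ∀ T Ts → mobius (T ∷ Ts) ≈ fieldSign T * mobius Ts
    mobius-∷ T Ts = lemma (does (FiniteRing.isField? T)) (does (All.all? FiniteRing.isField? Ts))
      where
      lemma : ∀ b b′ → (if b ∧ b′ then - 1# * (- 1#) ^ length Ts else 0#) ≈
                       (if b then - 1# else 0#) * (if b′ then (- 1#) ^ length Ts else 0#)
      lemma false _     = sym (zeroˡ _)
      lemma true  false = sym (zeroʳ _)
      lemma true  true  = refl

    module _ (T U : FiniteRing c ℓ) {χ} (isCharacter : IsCharacter (T ×ᶠ U) χ) where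
      private
        module T = FiniteRing T
        module U = FiniteRing U
        module T×U = FiniteRing (T ×ᶠ U)
      open IsCharacter isCharacter

      χˡ : T.Carrier → Carrier
      χˡ t = χ (t , U.0#)

      χʳ : U.Carrier → Carrier
      χʳ u = χ (T.0# , u)

      χˡ-isCharacter : IsCharacter T χˡ
      χˡ-isCharacter = record
        { cong     = λ t≈t′ → cong (t≈t′ , U.refl)
        ; additive = λ a b → trans (cong (T.refl , U.sym (U.+-identityˡ U.0#))) (additive (a , U.0#) (b , U.0#))
        ; 0-homo   = 0-homo
        }

      χʳ-isCharacter : IsCharacter U χʳ
      χʳ-isCharacter = record
        { cong     = λ u≈u′ → cong (T.refl , u≈u′)
        ; additive = λ a b → trans (cong (T.sym (T.+-identityˡ T.0#) , U.refl)) (additive (T.0# , a) (T.0# , b))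
        ; 0-homo   = 0-homo
        }

      χˡ-nondegenerate : Nondegenerate (T ×ᶠ U) χ → Nondegenerate T χˡ
      χˡ-nondegenerate nondegenerate {a} a≉0 =
        let (r , s) , χ≉1 = nondegenerate {a , U.0#} (a≉0 ∘ proj₁)
        in r , λ χra≈1 → χ≉1 (trans (cong (T.refl , U.zeroʳ s)) χra≈1)

      χʳ-nondegenerate : Nondegenerate (T ×ᶠ U) χ → Nondegenerate U χʳ
      χʳ-nondegenerate nondegenerate {a} a≉0 =
        let (r , s) , χ≉1 = nondegenerate {T.0# , a} (a≉0 ∘ proj₂)
        in s , λ χsa≈1 → χ≉1 (trans (cong (T.zeroʳ r , U.refl)) χsa≈1)

      unit-× : ∀ t u → indicator (T×U.isUnit? (t , u)) ≈ indicator (T.isUnit? t) * indicator (U.isUnit? u)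
      unit-× t u = trans
        (indicator-⇔ (T×U.isUnit? (t , u)) (T.isUnit? t ×-dec U.isUnit? u)
          (λ ((t⁻¹ , u⁻¹) , tt⁻¹≈1 , uu⁻¹≈1) → (t⁻¹ , tt⁻¹≈1) , (u⁻¹ , uu⁻¹≈1))
          (λ ((t⁻¹ , tt⁻¹≈1) , (u⁻¹ , uu⁻¹≈1)) → (t⁻¹ , u⁻¹) , tt⁻¹≈1 , uu⁻¹≈1))
        (indicator-× (T.isUnit? t) (U.isUnit? u))

      -- Writing (t , u) as (t , 0) + (0 , u) factors the character, and units of the product are
      -- pairs of units, so the double sum separates.
      ×-unitSum : unitSum (T ×ᶠ U) χ ≈ unitSum T χˡ * unitSum U χʳ
      ×-unitSum = begin
        unitSum (T ×ᶠ U) χ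
          ≈⟨ sumList-cartesianProduct _ T.elements U.elements ⟩
        sumOver T.finite (λ t → sumOver U.finite (λ u → indicator (T×U.isUnit? (t , u)) * χ (t , u)))
          ≈⟨ sumOver-cong T.finite (λ t → sumOver-cong U.finite (factor t)) ⟩
        sumOver T.finite (λ t → sumOver U.finite (λ u →
          (indicator (T.isUnit? t) * χˡ t) * (indicator (U.isUnit? u) * χʳ u)))
          ≈⟨ sumOver-cong T.finite (λ t → *-sumListˡ _ _ U.elements) ⟨
        sumOver T.finite (λ t → (indicator (T.isUnit? t) * χˡ t) * unitSum U χʳ)
          ≈⟨ *-sumListʳ _ _ T.elements ⟨
        unitSum T χˡ * unitSum U χʳ ∎
        where
        factor : ∀ t u → indicator (T×U.isUnit? (t , u)) * χ (t , u) ≈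
                         (indicator (T.isUnit? t) * χˡ t) * (indicator (U.isUnit? u) * χʳ u)
        factor t u = begin
          indicator (T×U.isUnit? (t , u)) * χ (t , u)
            ≈⟨ *-cong (unit-× t u) (trans (cong (T.sym (T.+-identityʳ t) , U.sym (U.+-identityˡ u)))
                                          (additive (t , U.0#) (T.0# , u))) ⟩
          (i * j) * (a * b)         ≈⟨ *-assoc i j _ ⟩
          i * (j * (a * b))         ≈⟨ *-congˡ (*-assoc j a b) ⟨
          i * (j * a * b)           ≈⟨ *-congˡ (*-congʳ (*-comm j a)) ⟩
          i * (a * j * b)           ≈⟨ *-congˡ (*-assoc a j b) ⟩
          i * (a * (j * b))         ≈⟨ *-assoc i a _ ⟨
          (i * a) * (j * b)         ∎
          where
          i = indicator (T.isUnit? t)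
          j = indicator (U.isUnit? u)
          a = χˡ t
          b = χʳ u

    -- Induction on the factors. The empty product is the zero ring, whose only element is a unit
    -- with character value 1, in agreement with the zeroth power of -1.
    ∏-unitSum : ∀ Ts → All (IsLocal {c} {ℓ}) Ts → ∀ {χ} → IsCharacter (∏ᶠ Ts) χ → Nondegenerate (∏ᶠ Ts) χ →
                unitSum (∏ᶠ Ts) χ ≈ mobius Ts
    ∏-unitSum [] [] {χ} isCharacter _ = begin
      unitSum (∏ᶠ []) χ
        ≡⟨ sumList-∷ _ Unit.tt [] ⟩
      indicator (isUnit? Unit.tt) * χ Unit.tt + sumList _ []
        ≈⟨ +-cong (*-cong (indicator-yes (isUnit? Unit.tt) (Unit.tt , Unit.tt)) (IsCharacter.0-homo isCharacter))
                  (reflexive (sumList-[] _)) ⟩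
      1# * 1# + 0#
        ≈⟨ trans (+-identityʳ _) (*-identityˡ 1#) ⟩
      1# ∎
      where open FiniteRing (∏ᶠ []) using (isUnit?)
    ∏-unitSum (T ∷ Ts) (T-local ∷ Ts-local) {χ} isCharacter nondegenerate = begin
      unitSum (T ×ᶠ ∏ᶠ Ts) χ
        ≈⟨ ×-unitSum T (∏ᶠ Ts) isCharacter ⟩
      unitSum T _ * unitSum (∏ᶠ Ts) _
        ≈⟨ *-cong (local-fieldSign T T-local (χˡ-isCharacter T (∏ᶠ Ts) isCharacter)
                    (χˡ-nondegenerate T (∏ᶠ Ts) isCharacter nondegenerate))
                  (∏-unitSum Ts Ts-local (χʳ-isCharacter T (∏ᶠ Ts) isCharacter)
                    (χʳ-nondegenerate T (∏ᶠ Ts) isCharacter nondegenerate)) ⟩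
      fieldSign T * mobius Ts
        ≈⟨ mobius-∷ T Ts ⟨
      mobius (T ∷ Ts) ∎

    module _ (U : FiniteRing c ℓ) (D : LocalDecomposition U) where
      open LocalDecomposition D
      private
        module U = FiniteRing U
        module P = FiniteRing (∏ᶠ factors)
        open IsRingIsomorphism to-iso

        from : P.Carrier → U.Carrier
        from w = proj₁ (surjective w)

        to-from : ∀ w → to (from w) P.≈ w
        to-from w = proj₂ (surjective w) U.refl

        from-cong : ∀ {w w′} → w P.≈ w′ → from w U.≈ from w′
        from-cong w≈w′ = injective (P.trans (to-from _) (P.trans w≈w′ (P.sym (to-from _))))

        from-to : ∀ u → from (to u) U.≈ u
        from-to u = injective (to-from (to u))

        from-+ : ∀ w w′ → from (w P.+ w′) U.≈ from w U.+ from w′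
        from-+ w w′ = injective (P.trans (to-from _)
          (P.sym (P.trans (+-homo _ _) (P.+-cong (to-from w) (to-from w′)))))

        from-* : ∀ w w′ → from (w P.* w′) U.≈ from w U.* from w′
        from-* w w′ = injective (P.trans (to-from _)
          (P.sym (P.trans (*-homo _ _) (P.*-cong (to-from w) (to-from w′)))))

        from-0 : from P.0# U.≈ U.0#
        from-0 = injective (P.trans (to-from P.0#) (P.sym 0#-homo))

        from-1 : from P.1# U.≈ U.1#
        from-1 = injective (P.trans (to-from P.1#) (P.sym 1#-homo))

      -- The isomorphism carries units to units and the character to `χ ∘ from`. The ring and the
      -- product are enumerated independently, so the sums are matched by a bijection.
      decomposition-unitSum : ∀ {χ} → IsCharacter U χ → Nondegenerate U χ → unitSum U χ ≈ mobius factors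
      decomposition-unitSum {χ} isCharacter nondegenerate = begin
        unitSum U χ
          ≈⟨ sumOver-cong U.finite (λ u → *-congˡ (cong (from-to u))) ⟨
        unitSum U (χ ∘ from ∘ to)
          ≈⟨ sumOver-bijection U.finite P.finite U.isUnit? P.isUnit? U.IsUnit-resp P.IsUnit-resp
               to ⟦⟧-cong (UnitLifting.map-unit U (∏ᶠ factors) to isRingHomomorphism)
               (λ _ _ → injective)
               (λ {w} (v , wv≈1) → from w ,
                 (from v , U.trans (U.sym (from-* w v)) (U.trans (from-cong wv≈1) from-1)) , to-from w)
               (λ w≈w′ → cong (from-cong w≈w′)) ⟩
        unitSum (∏ᶠ factors) (χ ∘ from)
          ≈⟨ ∏-unitSum factors local
               (record
                 { cong     = λ w≈w′ → cong (from-cong w≈w′)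
                 ; additive = λ w w′ → trans (cong (from-+ w w′)) (additive (from w) (from w′))
                 ; 0-homo   = trans (cong from-0) 0-homo
                 })
               (λ {w} w≉0 →
                 let r , χ≉1 = nondegenerate {from w} λ from-w≈0 → w≉0
                       (P.trans (P.sym (to-from w)) (P.trans (⟦⟧-cong from-w≈0) 0#-homo))
                 in to r , λ χ≈1 → χ≉1 (trans (cong (U.trans (U.*-congʳ (U.sym (from-to r)))
                                                            (U.sym (from-* (to r) w)))) χ≈1)) ⟩
        mobius factors ∎
        where open IsCharacter isCharacter

  module _ {c ℓ c′ ℓ′} (T : FiniteRing c ℓ) (U : FiniteRing c′ ℓ′)
    (f : FiniteRing.Carrier T → FiniteRing.Carrier U)
    (f-isHom : IsRingHomomorphism (FiniteRing.rawRing T) (FiniteRing.rawRing U) f)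
    (f-surjective : ∀ y → ∃ λ x → FiniteRing._≈_ U (f x) y) where
    private
      module T = FiniteRing T
      module U = FiniteRing U
      module RT = FiniteRings T
      module RU = FiniteRings U
      open IsRingHomomorphism f-isHom
      open UnitLifting T U f f-isHom

    -- The number of units over `v`, as an element of K.
    fibreSize : U.Carrier → Carrier
    fibreSize v = unitSum T (λ u → indicator (f u U.≟ v))

    -- Multiplication by a lift of v carries the fibre over 1 to the fibre over v.
    fibreSize-unit : ∀ v → fibreSize v ≈ fibreSize U.1# * indicator (U.isUnit? v)
    fibreSize-unit v with U.isUnit? v
    ... | no v∉U = trans
      (sumList-0 T.elements (All.universal (λ u → trans
        (sym (indicator-× (T.isUnit? u) (f u U.≟ v)))
        (indicator-no (T.isUnit? u ×-dec (f u U.≟ v)) λ (u∈U , fu≈v) → v∉U (U.IsUnit-resp fu≈v (map-unit u∈U)))) _))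
      (sym (trans (*-congˡ (indicator-no (no v∉U) v∉U)) (zeroʳ _)))
    ... | yes v∈U = let w , w∈U , fw≈v = lift-unit f-surjective v∈U in begin
      fibreSize v
        ≈⟨ sumOver-cong T.finite (λ u → trans (sym (indicator-× (T.isUnit? u) (f u U.≟ v))) (sym (*-identityʳ _))) ⟩
      sumOver T.finite (λ u → indicator (over v u) * 1#)
        ≈⟨ sumOver-bijection T.finite T.finite (over U.1#) (over v) (over-resp U.1#) (over-resp v)
             (w T.*_) T.*-congˡ
             (λ (u∈U , fu≈1) → RT.*-unit w∈U u∈U ,
               U.trans (*-homo w _) (U.trans (U.*-cong fw≈v fu≈1) (U.*-identityʳ v)))
             (λ _ _ → RT.unit-cancelˡ w∈U)
             (λ {y} → divide w w∈U fw≈v y)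
             {λ _ → 1#} (λ _ → refl) ⟨
      sumOver T.finite (λ u → indicator (over U.1# u) * 1#)
        ≈⟨ sumOver-cong T.finite (λ u → trans (sym (indicator-× (T.isUnit? u) (f u U.≟ U.1#))) (sym (*-identityʳ _))) ⟨
      fibreSize U.1#
        ≈⟨ *-identityʳ _ ⟨
      fibreSize U.1# * 1#
        ≈⟨ *-congˡ (indicator-yes (yes v∈U) v∈U) ⟨
      fibreSize U.1# * indicator (yes v∈U) ∎
      where
      Over : U.Carrier → T.Carrier → Set _
      Over v u = T.IsUnit u × f u U.≈ v

      over : ∀ v u → Dec (Over v u)
      over v u = T.isUnit? u ×-dec (f u U.≟ v)

      over-resp : ∀ v → Over v Respects T._≈_
      over-resp v u≈u′ (u∈U , fu≈v) = T.IsUnit-resp u≈u′ u∈U , U.trans (⟦⟧-cong (T.sym u≈u′)) fu≈v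

      divide : ∀ w → T.IsUnit w → f w U.≈ v → ∀ y → Over v y → ∃ λ x → Over U.1# x × w T.* x T.≈ y
      divide w w∈U@(w⁻¹ , ww⁻¹≈1) fw≈v y (y∈U , fy≈v) = w⁻¹ T.* y ,
        (RT.*-unit (RT.unit-inverse w∈U) y∈U ,
         RU.unit-cancelˡ v∈U (U.trans (U.*-congʳ (U.sym fw≈v)) (U.trans (U.sym (*-homo w _))
           (U.trans (⟦⟧-cong w*w⁻¹y≈y) (U.trans fy≈v (U.sym (U.*-identityʳ v))))))) ,
        w*w⁻¹y≈y
        where
        w*w⁻¹y≈y : w T.* (w⁻¹ T.* y) T.≈ y
        w*w⁻¹y≈y = T.trans (T.sym (T.*-assoc w w⁻¹ y)) (T.trans (T.*-congʳ ww⁻¹≈1) (T.*-identityˡ y))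

    -- Units are grouped by their image, and all nonempty fibres have the size of the fibre over 1.
    -- The case F = 1 relates the two values of φ, the case of a character the two unit sums.
    unitSum-pullback : ∀ {F : U.Carrier → Carrier} → F Preserves U._≈_ ⟶ _≈_ →
                       unitSum T (F ∘ f) ≈ fibreSize U.1# * unitSum U F
    unitSum-pullback {F} F-cong = begin
      unitSum T (F ∘ f)
        ≈⟨ sumOver-cong T.finite (λ u → *-congˡ (sumOver-δ U.finite F-cong (f u))) ⟨
      sumOver T.finite (λ u → indicator (T.isUnit? u) * sumOver U.finite (λ v → indicator (f u U.≟ v) * F v))
        ≈⟨ sumOver-cong T.finite (λ u → trans (*-sumListˡ _ _ U.elements)
             (sumOver-cong U.finite λ v → sym (*-assoc _ _ (F v)))) ⟩
      sumOver T.finite (λ u → sumOver U.finite (λ v → indicator (T.isUnit? u) * indicator (f u U.≟ v) * F v))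
        ≈⟨ sumList-comm _ T.elements U.elements ⟩
      sumOver U.finite (λ v → sumOver T.finite (λ u → indicator (T.isUnit? u) * indicator (f u U.≟ v) * F v))
        ≈⟨ sumOver-cong U.finite (λ v → *-sumListʳ (F v) _ T.elements) ⟨
      sumOver U.finite (λ v → fibreSize v * F v)
        ≈⟨ sumOver-cong U.finite (λ v → trans (*-congʳ (fibreSize-unit v)) (*-assoc _ _ (F v))) ⟩
      sumOver U.finite (λ v → fibreSize U.1# * (indicator (U.isUnit? v) * F v))
        ≈⟨ *-sumListˡ _ _ U.elements ⟨
      fibreSize U.1# * unitSum U F ∎

-- Residues modulo n and the character attached to a functional

module Residues (n : ℕ) .{{_ : NonZero n}} where
  open CommutativeRing (ℤ/ n) using () renaming (_≈_ to _≈ₙ_) public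

  -- The residues differ by a multiple k n of absolute value below n, which forces k = 0.
  %ℕ-cong : ∀ {a b} → a ≈ₙ b → a %ℕ n ≡ b %ℕ n
  %ℕ-cong {a} {b} (q , a-b≡qn) = ℤ.+-injective (ℤ.i-j≡0⇒i≡j _ _ (ℤ.∣i∣≡0⇒i≡0 ∣r-s∣≡0))
    where
    r = a %ℕ n
    s = b %ℕ n
    k = (q ℤ.- a /ℕ n) ℤ.+ b /ℕ n

    r-s≡kn : + r ℤ.- + s ≡ k ℤ.* + n
    r-s≡kn = begin
      + r ℤ.- + s
        ≡⟨ solve 5 (λ r s A B n → r :- s :=
             ((r :+ A :* n) :- (s :+ B :* n)) :- A :* n :+ B :* n) ≡.refl (+ r) (+ s) (a /ℕ n) (b /ℕ n) (+ n) ⟩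
      (+ r ℤ.+ (a /ℕ n) ℤ.* + n) ℤ.- (+ s ℤ.+ (b /ℕ n) ℤ.* + n) ℤ.- (a /ℕ n) ℤ.* + n ℤ.+ (b /ℕ n) ℤ.* + n
        ≡⟨ ≡.cong₂ (λ x y → (x ℤ.- y) ℤ.- (a /ℕ n) ℤ.* + n ℤ.+ (b /ℕ n) ℤ.* + n)
             (a≡a%ℕn+[a/ℕn]*n a n) (a≡a%ℕn+[a/ℕn]*n b n) ⟨
      (a ℤ.- b) ℤ.- (a /ℕ n) ℤ.* + n ℤ.+ (b /ℕ n) ℤ.* + n
        ≡⟨ ≡.cong (λ x → x ℤ.- (a /ℕ n) ℤ.* + n ℤ.+ (b /ℕ n) ℤ.* + n) a-b≡qn ⟩
      q ℤ.* + n ℤ.- (a /ℕ n) ℤ.* + n ℤ.+ (b /ℕ n) ℤ.* + n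
        ≡⟨ solve 4 (λ q A B n → q :* n :- A :* n :+ B :* n := ((q :- A) :+ B) :* n) ≡.refl
             q (a /ℕ n) (b /ℕ n) (+ n) ⟩
      k ℤ.* + n ∎
      where
      open ≡.≡-Reasoning
      open ℤSolver.+-*-Solver

    ∣k∣n<n : ℤ.∣ k ∣ ℕ.* n ℕ.< 1 ℕ.* n
    ∣k∣n<n = begin-strict
      ℤ.∣ k ∣ ℕ.* n         ≡⟨ ℤ.abs-* k (+ n) ⟨
      ℤ.∣ k ℤ.* + n ∣       ≡⟨ ≡.cong ℤ.∣_∣ r-s≡kn ⟨
      ℤ.∣ + r ℤ.- + s ∣     ≡⟨ ≡.cong ℤ.∣_∣ (ℤ.m-n≡m⊖n r s) ⟩
      ℤ.∣ r ℤ.⊖ s ∣         ≤⟨ ℤ.∣m⊝n∣≤m⊔n r s ⟩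
      r ℕ.⊔ s               <⟨ ℕ.⊔-lub (n%ℕd<d a n) (n%ℕd<d b n) ⟩
      n                     ≡⟨ ℕ.*-identityˡ n ⟨
      1 ℕ.* n               ∎
      where open ℕ.≤-Reasoning

    ∣r-s∣≡0 : ℤ.∣ + r ℤ.- + s ∣ ≡ 0
    ∣r-s∣≡0 = begin
      ℤ.∣ + r ℤ.- + s ∣     ≡⟨ ≡.cong ℤ.∣_∣ r-s≡kn ⟩
      ℤ.∣ k ℤ.* + n ∣       ≡⟨ ℤ.abs-* k (+ n) ⟩
      ℤ.∣ k ∣ ℕ.* n         ≡⟨ ≡.cong (ℕ._* n) (ℕ.n<1⇒n≡0 (ℕ.*-cancelʳ-< n ℤ.∣ k ∣ 1 ∣k∣n<n)) ⟩
      0 ∎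
      where open ≡.≡-Reasoning

  %ℕ-≈ₙ : ∀ a → a ≈ₙ + (a %ℕ n)
  %ℕ-≈ₙ a = a /ℕ n , (begin
    a ℤ.- + (a %ℕ n)
      ≡⟨ ≡.cong (ℤ._- + (a %ℕ n)) (a≡a%ℕn+[a/ℕn]*n a n) ⟩
    + (a %ℕ n) ℤ.+ (a /ℕ n) ℤ.* + n ℤ.- + (a %ℕ n)
      ≡⟨ solve 2 (λ r x → r :+ x :- r := x) ≡.refl (+ (a %ℕ n)) ((a /ℕ n) ℤ.* + n) ⟩
    (a /ℕ n) ℤ.* + n ∎)
    where
    open ≡.≡-Reasoning
    open ℤSolver.+-*-Solver

module RootsOfUnity {k κ : Level} (K : CommutativeRing k κ) (noZeroDivisors : NoZeroDivisors K)
  (n : ℕ) .{{_ : NonZero n}} (ζ : CommutativeRing.Carrier K) where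
  open CommutativeRing K hiding (zero)
  open Exponentiation semiring
  open Algebra.Properties.Ring ring
  open Residues n
  open CharacterSums K noZeroDivisors
  open FiniteSums K
  open import Relation.Binary.Reasoning.Setoid setoid

  1-^ : ∀ m → 1# ^ m ≈ 1#
  1-^ zero    = refl
  1-^ (suc m) = trans (*-identityˡ _) (1-^ m)

  module _ (ζⁿ≈1 : ζ ^ n ≈ 1#) where

    ^-% : ∀ m → ζ ^ m ≈ ζ ^ (m ℕ.% n)
    ^-% m = begin
      ζ ^ m                                       ≡⟨ ≡.cong (ζ ^_) (ℕ.m≡m%n+[m/n]*n m n) ⟩
      ζ ^ (m ℕ.% n ℕ.+ (m ℕ./ n) ℕ.* n)           ≈⟨ ^-homo-* ζ (m ℕ.% n) _ ⟩
      ζ ^ (m ℕ.% n) * ζ ^ ((m ℕ./ n) ℕ.* n)       ≡⟨ ≡.cong (λ j → ζ ^ (m ℕ.% n) * ζ ^ j) (ℕ.*-comm (m ℕ./ n) n) ⟩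
      ζ ^ (m ℕ.% n) * ζ ^ (n ℕ.* (m ℕ./ n))       ≈⟨ *-congˡ (^-assocʳ ζ n (m ℕ./ n)) ⟨
      ζ ^ (m ℕ.% n) * (ζ ^ n) ^ (m ℕ./ n)         ≈⟨ *-congˡ (trans (^-congˡ (m ℕ./ n) ζⁿ≈1) (1-^ (m ℕ./ n))) ⟩
      ζ ^ (m ℕ.% n) * 1#                          ≈⟨ *-identityʳ _ ⟩
      ζ ^ (m ℕ.% n)                               ∎

    ^-%ℕ : ∀ {a} m → a ≈ₙ + m → ζ ^ (a %ℕ n) ≈ ζ ^ m
    ^-%ℕ {a} m a≈m = trans (reflexive (≡.cong (ζ ^_) (%ℕ-cong {a} {+ m} a≈m))) (sym (^-% m))

    module _ (ζᵐ≉1 : ∀ m → 0 ℕ.< m → m ℕ.< n → ¬ ζ ^ m ≈ 1#) where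

      module _ {c ℓ} (A : SymmetricAlgebra n c ℓ) where
        private
          module A = SymmetricAlgebra A
          module Z = CommutativeRing (ℤ/ n)

        character : A.Carrier → Carrier
        character a = ζ ^ (A.ψ a %ℕ n)

        character-isCharacter : IsCharacter A.finiteRing character
        character-isCharacter = record
          { cong     = λ {a} {b} a≈b → reflexive (≡.cong (ζ ^_) (%ℕ-cong {A.ψ a} {A.ψ b} (A.ψ-cong a≈b)))
          ; additive = λ a b → trans
              (^-%ℕ {A.ψ (a A.+ b)} (A.ψ a %ℕ n ℕ.+ A.ψ b %ℕ n)
                (Z.trans {A.ψ (a A.+ b)} {A.ψ a ℤ.+ A.ψ b} {+ (A.ψ a %ℕ n ℕ.+ A.ψ b %ℕ n)} (A.ψ-additive a b)
                  (Z.+-cong {A.ψ a} {+ (A.ψ a %ℕ n)} {A.ψ b} {+ (A.ψ b %ℕ n)} (%ℕ-≈ₙ (A.ψ a)) (%ℕ-≈ₙ (A.ψ b)))))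
              (^-homo-* ζ (A.ψ a %ℕ n) (A.ψ b %ℕ n))
          -- Since 0 is 0 times itself, homogeneity for the scalar 0 gives ψ(0) = 0 modulo n.
          ; 0-homo   = ^-%ℕ {A.ψ A.0#} 0
              (Z.trans {A.ψ A.0#} {A.ψ (A.ι 0ℤ A.* A.0#)} {0ℤ} (A.ψ-cong (A.sym (A.zeroʳ (A.ι 0ℤ)))) (A.ψ-homogeneous 0ℤ A.0#))
          }

        -- If ψ were 0 modulo n at every r a, the ideal Ra would lie in its kernel and a would be 0.
        -- Finite search yields an r, and primitivity of ζ keeps the power with that residue,
        -- between 1 and n - 1, away from 1.
        character-nondegenerate : Nondegenerate A.finiteRing character
        character-nondegenerate {a} a≉0 = let r , ψra≢0 = witness in
          r , ζᵐ≉1 (A.ψ (r A.* a) %ℕ n) (ℕ.n≢0⇒n>0 ψra≢0) (n%ℕd<d (A.ψ (r A.* a)) n)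
          where
          ψ-zero : ∀ {z} → A.ψ z %ℕ n ≡ 0 → A.ψ z A.≈ₙ 0ℤ
          ψ-zero {z} eq = ≡.subst (λ m → A.ψ z A.≈ₙ + m) eq (%ℕ-≈ₙ (A.ψ z))

          ψ-resp : ∀ {y z} → y A.≈ z → A.ψ y %ℕ n ≡ A.ψ z %ℕ n
          ψ-resp {y} {z} y≈z = %ℕ-cong {A.ψ y} {A.ψ z} (A.ψ-cong y≈z)

          witness : ∃ λ r → A.ψ (r A.* a) %ℕ n ≢ 0
          witness = decidable-stable
            (A.∃? (λ r≈s ≢0 eq → ≢0 (≡.trans (ψ-resp (A.*-congʳ r≈s)) eq)) (λ r → ¬? (A.ψ (r A.* a) %ℕ n ℕ.≟ 0)))
            λ none → a≉0 (A.nondegenerate (principal A.commutativeRing a)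
              (λ {z} (r , z≈ra) → ψ-zero {z} (≡.trans (ψ-resp z≈ra)
                (decidable-stable (A.ψ (r A.* a) %ℕ n ℕ.≟ 0) λ ≢0 → none (r , ≢0))))
              (A.1# , A.sym (A.*-identityˡ a)))

-- Characteristic polynomials of gcd-graphs and values of Ramanujan sums

lookup-injective : ∀ {c ℓ} {S : Setoid c ℓ} {xs} → Unique S xs → ∀ i j →
                   Setoid._≈_ S (List.lookup xs i) (List.lookup xs j) → i ≡ j
lookup-injective {S = S} (_ ∷ _)   zero    zero    _   = ≡.refl
lookup-injective {S = S} (x≉ ∷ _)  zero    (suc j) x≈y = contradiction x≈y (All.lookup x≉ (∈-lookup j))
lookup-injective {S = S} (y≉ ∷ _)  (suc i) zero    x≈y = contradiction (Setoid.sym S x≈y) (All.lookup y≉ (∈-lookup i))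
lookup-injective {S = S} (_ ∷ xs!) (suc i) (suc j) x≈y = ≡.cong suc (lookup-injective {S = S} xs! i j x≈y)

CharacteristicZero : ∀ {k κ} → CommutativeRing k κ → Set κ
CharacteristicZero K = ∀ m → ¬ (suc m · 1#) ≈ 0#
  where
  open CommutativeRing K
  open Algebra.Definitions.RawSemiring (Semiring.rawSemiring semiring) using () renaming (_×_ to _·_)

module Spectra {k κ : Level} (K : CommutativeRing k κ) (noZeroDivisors : NoZeroDivisors K)
  (characteristicZero : CharacteristicZero K) where
  open CommutativeRing K hiding (zero)
  open Algebra.Definitions.RawSemiring (Semiring.rawSemiring semiring) using (product; _^_) renaming (_×_ to _·_)
  open Algebra.Properties.Semiring.Sum semiring
  open Algebra.Properties.Ring ring
  open Determinants K
  open FiniteSums K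
  open CharacterSums K noZeroDivisors
  open import Relation.Binary.Reasoning.Setoid setoid

  -- The substitute for division by an element that is only known to be nonzero.
  cancelˡ : ∀ {x y z} → ¬ x ≈ 0# → x * y ≈ x * z → y ≈ z
  cancelˡ {x} {y} {z} x≉0 xy≈xz = begin
    y               ≈⟨ +-identityʳ y ⟨
    y + 0#          ≈⟨ +-congˡ (-‿inverseˡ z) ⟨
    y + (- z + z)   ≈⟨ +-assoc y (- z) z ⟨
    y - z + z       ≈⟨ +-congʳ (noZeroDivisors x (y - z) (begin
      x * (y - z)       ≈⟨ distribˡ x y (- z) ⟩
      x * y + x * - z   ≈⟨ +-cong xy≈xz (sym (-‿distribʳ-* x z)) ⟩
      x * z - x * z     ≈⟨ -‿inverseʳ _ ⟩
      0#                ∎) x≉0) ⟩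
    0# + z          ≈⟨ +-identityˡ z ⟩
    z               ∎

  ·1-nonzero : ∀ m .{{_ : NonZero m}} → ¬ (m · 1#) ≈ 0#
  ·1-nonzero (suc m) = characteristicZero m

  product-nonzero : ∀ n {x} → ¬ x ≈ 0# → ¬ product {n} (λ _ → x) ≈ 0#
  product-nonzero zero        x≉0 1≈0 = characteristicZero 0 (trans (+-identityʳ 1#) 1≈0)
  product-nonzero (suc n) {x} x≉0 eq  = product-nonzero n x≉0 (noZeroDivisors x _ eq x≉0)

  sumList-1 : ∀ {a} {A : Set a} (xs : List A) → sumList (λ _ → 1#) xs ≈ length xs · 1#
  sumList-1 []       = reflexive (sumList-[] (λ _ → 1#))
  sumList-1 (x ∷ xs) = trans (reflexive (sumList-∷ (λ _ → 1#) x xs)) (+-congˡ (sumList-1 xs))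

  module _ {c ℓ} (T : FiniteRing c ℓ) where
    private module T = FiniteRing T

    unitSum-units : ∀ F → sumList F T.units ≈ unitSum T F
    unitSum-units F = sumList-filter T.isUnit? F T.elements

    unitSum-1 : unitSum T (λ _ → 1#) ≈ T.φ · 1#
    unitSum-1 = trans (sym (unitSum-units (λ _ → 1#))) (sumList-1 T.units)

    möbius : Carrier
    möbius = if does (T.order ℕ.≟ 1) then 1# else mobius (LocalDecomposition.factors (decompose T))

    -- In the zero ring 0 is a unit and the sum is χ(0) = 1. `μ` tests for this ring before it
    -- consults the decomposition, hence the separate argument.
    trivial-unitSum : T.order ≡ 1 → ∀ {χ} → IsCharacter T χ → unitSum T χ ≈ 1#
    trivial-unitSum order≡1 {χ} isCharacter = go T.elements order≡1 T.enumerates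
      where
      go : ∀ xs → length xs ≡ 1 → (∀ x → _∈_ T.setoid x xs) →
           sumList (λ u → indicator (T.isUnit? u) * χ u) xs ≈ 1#
      go (e ∷ []) _ all with all T.1# | all T.0#
      ... | here 1≈e | here 0≈e = begin
        sumList (λ u → indicator (T.isUnit? u) * χ u) (e ∷ [])
          ≡⟨ sumList-∷ _ e [] ⟩
        indicator (T.isUnit? e) * χ e + sumList _ []
          ≈⟨ +-cong (*-cong (indicator-yes (T.isUnit? e) (T.IsUnit-resp 1≈e (T.1# , T.*-identityˡ T.1#)))
                            (trans (cong (T.sym 0≈e)) 0-homo))
                    (reflexive (sumList-[] _)) ⟩
        1# * 1# + 0#
          ≈⟨ trans (+-identityʳ _) (*-identityˡ 1#) ⟩
        1# ∎
        where open IsCharacter isCharacter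

    möbius-unitSum : ∀ {χ} → IsCharacter T χ → Nondegenerate T χ → unitSum T χ ≈ möbius
    möbius-unitSum {χ} isCharacter nondegenerate = cases (T.order ℕ.≟ 1)
      where
      cases : (d : Dec (T.order ≡ 1)) → unitSum T χ ≈
        (if does d then 1# else mobius (LocalDecomposition.factors (decompose T)))
      cases (yes order≡1) = trivial-unitSum order≡1 isCharacter
      cases (no _)        = decomposition-unitSum T (decompose T) isCharacter nondegenerate

  module _ {k : ℕ} {p q} {P : Pred (Fin k) p} {Q : Pred (Fin k) q} where

    -- A union of disjoint conditions: at most one index contributes to the sum.
    indicator-∃ : (d : Dec (∃ P)) (Q? : Decidable Q) → (∀ i → P i → Q i) → (∀ i → Q i → P i) →
      (∀ {i j} → P i → P j → i ≡ j) → indicator d ≈ sum (λ i → indicator (Q? i))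
    indicator-∃ (no none) Q? P⇒Q Q⇒P at-most-one = trans (indicator-no (no none) none)
      (sym (sum-0 λ i → indicator-no (Q? i) λ Qi → none (i , Q⇒P i Qi)))
    indicator-∃ (yes (i , Pi)) Q? P⇒Q Q⇒P at-most-one = begin
      indicator (yes (i , Pi))                   ≈⟨ indicator-yes (yes (i , Pi)) (i , Pi) ⟩
      1#                                         ≈⟨ sum-identityˡ (λ _ → 1#) i ⟨
      sum (λ j → identity i j * 1#)              ≈⟨ sum-cong-≋ (λ j → trans (*-identityʳ _) (only j)) ⟩
      sum (λ j → indicator (Q? j))               ∎
      where
      only : ∀ j → identity i j ≈ indicator (Q? j)
      only j with i Fin.≟ j
      ... | yes ≡.refl = sym (indicator-yes (Q? i) (P⇒Q i Pi))
      ... | no i≢j     = sym (indicator-no (Q? j) λ Qj → i≢j (at-most-one Pi (Q⇒P j Qj)))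

  module _ (n : ℕ) .{{_ : NonZero n}} (ζ : Carrier) (ζⁿ≈1 : ζ ^ n ≈ 1#)
    (ζᵐ≉1 : ∀ m → 0 ℕ.< m → m ℕ.< n → ¬ ζ ^ m ≈ 1#) where
    open RootsOfUnity K noZeroDivisors n ζ

    module _ {c ℓ} (A : SymmetricAlgebra n c ℓ) where
      private
        module A = SymmetricAlgebra A
        module AR = Algebra.Properties.Ring A.ring
        χ : A.Carrier → Carrier
        χ = character ζⁿ≈1 ζᵐ≉1 A

        χ-isCharacter : IsCharacter A.finiteRing χ
        χ-isCharacter = character-isCharacter ζⁿ≈1 ζᵐ≉1 A

        χ-nondegenerate : Nondegenerate A.finiteRing χ
        χ-nondegenerate = character-nondegenerate ζⁿ≈1 ζᵐ≉1 A

      open IsCharacter χ-isCharacter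

      -- With its converse below, this is the isomorphism of R/Ann(y) with Ry given by
      -- multiplication by y.
      ≈Ann⇒*-≈ : ∀ {a b y} → (a A.- b) A.* y A.≈ A.0# → a A.* y A.≈ b A.* y
      ≈Ann⇒*-≈ {a} {b} {y} eq = AR.x∙y⁻¹≈ε⇒x≈y (a A.* y) (b A.* y)
        (A.trans (A.sym (A.trans (A.distribʳ y a (A.- b)) (A.+-congˡ (A.sym (AR.-‿distribˡ-* b y))))) eq)

      *-≈⇒≈Ann : ∀ {a b y} → a A.* y A.≈ b A.* y → (a A.- b) A.* y A.≈ A.0#
      *-≈⇒≈Ann {a} {b} {y} eq = A.trans (A.distribʳ y a (A.- b))
        (A.trans (A.+-congˡ (A.sym (AR.-‿distribˡ-* b y))) (A.trans (A.+-congʳ eq) (A.-‿inverseʳ _)))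

      ramanujanSum : A.Carrier → A.Carrier → Carrier
      ramanujanSum x g = unitSum (A.finiteRing /Ann x) (λ u → χ ((g A.* u) A.* x))

      -- As Ann(x) is contained in Ann(gx), the identity of the carrier is a surjection T → U. The
      -- summand depends on u only through u (gx), hence only on its image in U. Cross-multiplied,
      -- the formula involves no division in K.
      ramanujanSum-möbius : ∀ x g → let T = A.finiteRing /Ann x ; U = A.finiteRing /Ann (g A.* x) in
        (FiniteRing.φ U · 1#) * ramanujanSum x g ≈ (FiniteRing.φ T · 1#) * möbius U
      ramanujanSum-möbius x g = begin
        (U.φ · 1#) * ramanujanSum x g
          ≈⟨ *-congˡ (sumOver-cong T.finite (λ u → *-congˡ (cong (regroup u)))) ⟩
        (U.φ · 1#) * unitSum T (λ u → χ (u A.* (g A.* x)))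
          ≈⟨ *-congˡ (unitSum-pullback T U id projection id-surjective (λ {a} {b} eq → cong (≈Ann⇒*-≈ {a} {b} eq))) ⟩
        (U.φ · 1#) * (N * unitSum U (λ u → χ (u A.* (g A.* x))))
          -- The summand is the character of the algebra R/Ann(gx) with its own non-degenerate
          -- functional.
          ≈⟨ *-congˡ (*-congˡ (möbius-unitSum U
               (character-isCharacter ζⁿ≈1 ζᵐ≉1 (A /Annˢ (g A.* x)))
               (character-nondegenerate ζⁿ≈1 ζᵐ≉1 (A /Annˢ (g A.* x))))) ⟩
        (U.φ · 1#) * (N * möbius U)
          ≈⟨ *-assoc _ N _ ⟨
        (U.φ · 1#) * N * möbius U
          ≈⟨ *-congʳ (*-comm _ N) ⟩
        N * (U.φ · 1#) * möbius U
          -- The fibre size N is eliminated by the pullback formula for the constant 1, which reads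
          -- φ(T) = N φ(U).
          ≈⟨ *-congʳ (*-congˡ (unitSum-1 U)) ⟨
        N * unitSum U (λ _ → 1#) * möbius U
          ≈⟨ *-congʳ (unitSum-pullback T U id projection id-surjective (λ _ → refl)) ⟨
        unitSum T (λ _ → 1#) * möbius U
          ≈⟨ *-congʳ (unitSum-1 T) ⟩
        (T.φ · 1#) * möbius U ∎
        where
        T = A.finiteRing /Ann x
        U = A.finiteRing /Ann (g A.* x)
        module T = FiniteRing T
        module U = FiniteRing U

        regroup : ∀ u → (g A.* u) A.* x A.≈ u A.* (g A.* x)
        regroup u = A.trans (A.*-congʳ (A.*-comm g u)) (A.*-assoc u g x)

        projection : IsRingHomomorphism T.rawRing U.rawRing id
        projection = record
          { isSemiringHomomorphism = record
            { isNearSemiringHomomorphism = record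
              { +-isMonoidHomomorphism = record
                { isMagmaHomomorphism = record
                  { isRelHomomorphism = record { cong = λ {a} {b} eq →
                      A.trans (A.sym (regroup (a A.- b)))
                        (A.trans (A.*-assoc g (a A.- b) x) (A.trans (A.*-congˡ eq) (A.zeroʳ g))) }
                  ; homo = λ a b → U.refl
                  }
                ; ε-homo = U.refl
                }
              ; *-homo = λ a b → U.refl
              }
            ; 1#-homo = U.refl
            }
          ; -‿homo = λ a → U.refl
          }

        id-surjective : ∀ y → ∃ λ x → x U.≈ y
        id-surjective y = y , U.refl

        N = fibreSize T U id projection id-surjective U.1#

      module _ {k : ℕ} (D : PrincipalIdeals A.finiteRing k) where
        open PrincipalIdeals D
        open Graph (gcdGraph A.finiteRing D) using (Adj; adj?; adj-resp; adj-sym)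

        private
          ⟪_⟫ : A.Carrier → Pred A.Carrier _
          ⟪ x ⟫ = ⟨_⟩ A.finiteRing x

          module T i = FiniteRing (A.finiteRing /Ann generator i)

          -- The unit is taken in R/Ann(xᵢ), over which the Ramanujan sum runs; there `s` determines
          -- it.
          Associated : Fin k → A.Carrier → Set _
          Associated i s = ∃ λ u → T.IsUnit i u × s A.≈ u A.* generator i

          associated? : ∀ i → Decidable (Associated i)
          associated? i s = T.∃? i
            (λ {u} {v} u~v (u∈U , s≈ux) → T.IsUnit-resp i {u} {v} u~v u∈U , A.trans s≈ux (≈Ann⇒*-≈ u~v))
            (λ u → T.isUnit? i u ×-dec (s A.≟ u A.* generator i))

          associated⇒≐ : ∀ i {s} → Associated i s → ⟪ s ⟫ ≐ ⟪ generator i ⟫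
          associated⇒≐ i {s} (u , (v , uv~1) , s≈ux) =
            (λ (a , z≈as) → a A.* u , A.trans z≈as (A.trans (A.*-congˡ s≈ux) (A.sym (A.*-assoc a u _)))) ,
            (λ (a , z≈ax) → a A.* v , A.trans z≈ax (A.trans (A.*-congˡ (A.sym vs≈x)) (A.sym (A.*-assoc a v s))))
            where
            vs≈x : v A.* s A.≈ generator i
            vs≈x = A.trans (A.*-congˡ s≈ux) (A.trans (A.sym (A.*-assoc v u _))
              (A.trans (A.*-congʳ (A.*-comm v u)) (A.trans (≈Ann⇒*-≈ uv~1) (A.*-identityˡ _))))

          -- From s = u x and x = v s follows (v u) x = x, which says that u v = 1 modulo Ann(x).
          ≐⇒associated : ∀ i {s} → ⟪ s ⟫ ≐ ⟪ generator i ⟫ → Associated i s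
          ≐⇒associated i {s} (s⊆x , x⊆s) =
            let u , s≈ux = s⊆x (A.1# , A.sym (A.*-identityˡ s))
                v , x≈vs = x⊆s (A.1# , A.sym (A.*-identityˡ (generator i)))
            in u , (v , *-≈⇒≈Ann (A.trans (A.*-congʳ (A.*-comm u v)) (A.trans (A.*-assoc v u _)
                 (A.trans (A.*-congˡ (A.sym s≈ux)) (A.trans (A.sym x≈vs) (A.sym (A.*-identityˡ _))))))) ,
               s≈ux

          -- The ideals Rxᵢ are distinct, so a difference generates at most one of them.
          adj-indicator : ∀ s x → indicator (adj? (s A.+ x) x) ≈ sum (λ i → indicator (associated? i s))
          adj-indicator s x = indicator-∃ (adj? (s A.+ x) x) (λ i → associated? i s)
            (λ i eq → ≐⇒associated i (≐-resp s+x-x≈s eq))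
            (λ i s∈ → ≐-resp (A.sym s+x-x≈s) (associated⇒≐ i s∈))
            (λ {i} {j} (⊆ᵢ , ⊇ᵢ) (⊆ⱼ , ⊇ⱼ) → unique-index i j (⊆ⱼ ∘ ⊇ᵢ , ⊆ᵢ ∘ ⊇ⱼ))
            where
            s+x-x≈s : (s A.+ x) A.- x A.≈ s
            s+x-x≈s = A.trans (A.+-assoc s x _) (A.trans (A.+-congˡ (A.-‿inverseʳ x)) (A.+-identityʳ s))

            ≐-resp : ∀ {y z i} → y A.≈ z → ⟪ y ⟫ ≐ ⟪ generator i ⟫ → ⟪ z ⟫ ≐ ⟪ generator i ⟫
            ≐-resp y≈z (y⊆ , ⊆y) =
              (λ (a , w≈az) → y⊆ (a , A.trans w≈az (A.*-congˡ (A.sym y≈z)))) ,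
              (λ w∈ → let a , w≈ay = ⊆y w∈ in a , A.trans w≈ay (A.*-congˡ y≈z))

            unique-index : ∀ i j → ⟪ generator i ⟫ ≐ ⟪ generator j ⟫ → i ≡ j
            unique-index i j eq with i Fin.≟ j
            ... | yes i≡j = i≡j
            ... | no i≢j  = contradiction eq (distinct i≢j)

        eigenvalue : A.Carrier → Carrier
        eigenvalue g = sum λ i → ramanujanSum (generator i) g

        generators-sum : ∀ i g →
          sumOver A.finite (λ s → indicator (associated? i s) * χ (s A.* g)) ≈ ramanujanSum (generator i) g
        generators-sum i g = sym (begin
          ramanujanSum x g
            ≈⟨ sumOver-cong (T.finite i) (λ u → *-congˡ (cong (regroup u))) ⟩
          unitSum (A.finiteRing /Ann x) (λ u → χ ((u A.* x) A.* g))
            ≈⟨ sumOver-bijection (T.finite i) A.finite (T.isUnit? i) (associated? i)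
                 (λ {u} {v} → T.IsUnit-resp i {u} {v})
                 (λ s≈t (u , u∈U , s≈ux) → u , u∈U , A.trans (A.sym s≈t) s≈ux)
                 (A._* x) (λ {u} {v} → ≈Ann⇒*-≈ {u} {v})
                 (λ {u} u∈U → u , u∈U , A.refl)
                 (λ {u} {v} _ _ → *-≈⇒≈Ann {u} {v})
                 (λ (u , u∈U , s≈ux) → u , u∈U , A.sym s≈ux)
                 {λ s → χ (s A.* g)} (λ s≈t → cong (A.*-congʳ s≈t)) ⟩
          sumOver A.finite (λ s → indicator (associated? i s) * χ (s A.* g)) ∎)
          where
          x = generator i
          regroup : ∀ u → (g A.* u) A.* x A.≈ (u A.* x) A.* g
          regroup u = A.trans (A.*-assoc g u x) (A.*-comm g (u A.* x))

        adjacency-eigenvector : ∀ x g →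
          sumOver A.finite (λ y → indicator (adj? x y) * χ (y A.* g)) ≈ eigenvalue g * χ (x A.* g)
        adjacency-eigenvector x g = begin
          sumOver A.finite (λ y → indicator (adj? x y) * χ (y A.* g))
            -- Adjacency of x and y is read off from x - y; by symmetry it can be read off from y -
            -- x, which becomes s after the substitution y = s + x.
            ≈⟨ sumOver-cong A.finite (λ y → *-congʳ (indicator-⇔ (adj? x y) (adj? y x) adj-sym adj-sym)) ⟩
          sumOver A.finite (λ y → indicator (adj? y x) * χ (y A.* g))
            ≈⟨ sumOver-shift A.finiteRing x (λ {y} {z} y≈z → *-cong
                 (indicator-⇔ (adj? y x) (adj? z x) (adj-resp y≈z A.refl) (adj-resp (A.sym y≈z) A.refl))
                 (cong (A.*-congʳ y≈z))) ⟨
          sumOver A.finite (λ s → indicator (adj? (s A.+ x) x) * χ ((s A.+ x) A.* g))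
            ≈⟨ sumOver-cong A.finite (λ s → begin
                 indicator (adj? (s A.+ x) x) * χ ((s A.+ x) A.* g)
                   ≈⟨ *-cong (adj-indicator s x) (trans (cong (A.distribʳ g s x)) (additive _ _)) ⟩
                 sum (λ i → indicator (associated? i s)) * (χ (s A.* g) * χ (x A.* g))
                   ≈⟨ *-assoc _ _ _ ⟨
                 sum (λ i → indicator (associated? i s)) * χ (s A.* g) * χ (x A.* g)
                   ≈⟨ *-congʳ (*-distribʳ-sum (χ (s A.* g)) (λ i → indicator (associated? i s))) ⟩
                 sum (λ i → indicator (associated? i s) * χ (s A.* g)) * χ (x A.* g) ∎) ⟩
          sumOver A.finite (λ s → sum (λ i → indicator (associated? i s) * χ (s A.* g)) * χ (x A.* g))
            ≈⟨ *-sumListʳ _ _ A.elements ⟨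
          sumOver A.finite (λ s → sum (λ i → indicator (associated? i s) * χ (s A.* g))) * χ (x A.* g)
            ≈⟨ *-congʳ (sumList-sum {m = k} _ A.elements) ⟩
          sum (λ i → sumOver A.finite (λ s → indicator (associated? i s) * χ (s A.* g))) * χ (x A.* g)
            ≈⟨ *-congʳ (sum-cong-≋ (λ i → generators-sum i g)) ⟩
          eigenvalue g * χ (x A.* g) ∎

        private
          vertex : Fin A.order → A.Carrier
          vertex = List.lookup A.elements

          -- `P` is the character table of the additive group, indexed through the pairing χ(xy).
          -- `Q` is its conjugate transpose: χ(-a) stands for the conjugate of χ(a), and the pairing
          -- is symmetric.
          P Q : Square A.order
          P i l = χ (vertex i A.* vertex l)
          Q i l = χ (A.- (vertex i A.* vertex l))

          QP : ∀ x g → sumOver A.finite (λ y → χ (A.- (x A.* y)) * χ (y A.* g)) ≈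
                       sumOver A.finite (λ y → χ (y A.* (g A.- x)))
          QP x g = sumOver-cong A.finite λ y → trans (sym (additive _ _)) (cong (distribute y))
            where
            distribute : ∀ y → A.- (x A.* y) A.+ y A.* g A.≈ y A.* (g A.- x)
            distribute y = A.trans (A.+-comm _ _) (A.trans
              (A.+-congˡ (A.trans (A.-‿cong (A.*-comm x y)) (AR.-‿distribʳ-* y x)))
              (A.sym (A.distribˡ y g (A.- x))))

          -- The entry is the sum of χ(y (b - a)) over y, for a and b the vertices with indices i
          -- and l. On the diagonal every term is 1. Off it the vertices differ, because the
          -- enumeration has no repetitions, and orthogonality applies.
          inverse : ∀ i l → sum (λ j → Q i j * P j l) ≈ (A.order · 1#) * identity i l
          inverse i l = begin
            sum (λ j → Q i j * P j l)
              ≡⟨ sumList-lookup (λ y → χ (A.- (vertex i A.* y)) * χ (y A.* vertex l)) A.elements ⟩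
            sumOver A.finite (λ y → χ (A.- (vertex i A.* y)) * χ (y A.* vertex l))
              ≈⟨ QP (vertex i) (vertex l) ⟩
            sumOver A.finite (λ y → χ (y A.* (vertex l A.- vertex i)))
              ≈⟨ cases ⟩
            (A.order · 1#) * identity i l ∎
            where
            cases : sumOver A.finite (λ y → χ (y A.* (vertex l A.- vertex i))) ≈ (A.order · 1#) * identity i l
            cases with i Fin.≟ l
            ... | yes ≡.refl = trans
              (sumOver-cong A.finite (λ y → trans
                (cong (A.trans (A.*-congˡ (A.-‿inverseʳ (vertex i))) (A.zeroʳ y))) 0-homo))
              (trans (sumList-1 A.elements) (sym (*-identityʳ _)))
            ... | no i≢l = trans
              (orthogonality A.finiteRing χ-isCharacter χ-nondegenerate
                (λ l-i≈0 → i≢l (≡.sym (lookup-injective {S = A.setoid} A.unique l i (AR.x∙y⁻¹≈ε⇒x≈y _ _ l-i≈0)))))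
              (sym (zeroʳ _))

        module _ (t : Carrier) where

          characteristicMatrix : Square A.order
          characteristicMatrix i j = (if does (i Fin.≟ j) then t else 0#) +
            - (if does (adj? (vertex i) (vertex j)) then 1# else 0#)

          private
            scalar : ∀ (i j : Fin A.order) → (if does (i Fin.≟ j) then t else 0#) ≈ identity i j * t
            scalar i j with does (i Fin.≟ j)
            ... | true  = sym (*-identityˡ t)
            ... | false = sym (zeroˡ t)

            diagonal : ∀ i l → sum (λ j → characteristicMatrix i j * P j l) ≈
                               (t + - eigenvalue (vertex l)) * P i l
            diagonal i l = begin
              sum (λ j → characteristicMatrix i j * P j l)
                ≈⟨ sum-cong-≋ (λ j → entry j) ⟩
              sum (λ j → identity i j * (t * P j l) + - 1# * (a j * P j l))
                ≈⟨ sum-linear (- 1#) (λ j → identity i j * (t * P j l)) (λ j → a j * P j l) ⟩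
              sum (λ j → identity i j * (t * P j l)) + - 1# * sum (λ j → a j * P j l)
                ≈⟨ +-cong (sum-identityˡ (λ j → t * P j l) i) (-1*x≈-x _) ⟩
              t * P i l - sum (λ j → a j * P j l)
                ≡⟨ ≡.cong (λ s → t * P i l - s)
                     (sumList-lookup (λ y → indicator (adj? (vertex i) y) * χ (y A.* vertex l)) A.elements) ⟩
              t * P i l - sumOver A.finite (λ y → indicator (adj? (vertex i) y) * χ (y A.* vertex l))
                ≈⟨ +-congˡ (-‿cong (adjacency-eigenvector (vertex i) (vertex l))) ⟩
              t * P i l - eigenvalue (vertex l) * P i l
                ≈⟨ +-congˡ (-‿distribˡ-* _ _) ⟩
              t * P i l + - eigenvalue (vertex l) * P i l
                ≈⟨ distribʳ _ _ _ ⟨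
              (t + - eigenvalue (vertex l)) * P i l ∎
              where
              a : Fin A.order → Carrier
              a j = indicator (adj? (vertex i) (vertex j))

              entry : ∀ j → characteristicMatrix i j * P j l ≈ identity i j * (t * P j l) + - 1# * (a j * P j l)
              entry j = trans (distribʳ _ _ _) (+-cong
                (trans (*-congʳ (scalar i j)) (*-assoc _ t _))
                (trans (*-congʳ (trans (-‿cong (reflexive (indicator-if (adj? (vertex i) (vertex j)))))
                  (sym (-1*x≈-x (a j))))) (*-assoc (- 1#) (a j) _)))

          -- The columns of `P` diagonalise the matrix. The remaining factor, |R| to the power |R|,
          -- is nonzero in characteristic 0 and cancels.
          characteristicPolynomial : determinant characteristicMatrix ≈
                                     product (λ i → t + - eigenvalue (vertex i))
          characteristicPolynomial = cancelˡ (product-nonzero A.order (·1-nonzero A.order {{nonempty A.elements (A.enumerates A.0#)}}))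
            (determinant-diagonalized {A.order} characteristicMatrix P Q (λ i → t + - eigenvalue (vertex i))
              (A.order · 1#) diagonal inverse)
            where
            nonempty : ∀ xs → _∈_ A.setoid A.0# xs → NonZero (length xs)
            nonempty (_ ∷ _) _ = _

-- Integers and fractions inside ℚ

module Rationals where

  /1-* : ∀ i j → (i ℤ.* j) ℚ./ 1 ≡ (i ℚ./ 1) ℚ.* (j ℚ./ 1)
  /1-* i j = ℚ.toℚᵘ-injective (begin
    ℚ.toℚᵘ ((i ℤ.* j) ℚ./ 1)                    ≈⟨ ℚ.toℚᵘ-fromℚᵘ (mkℚᵘ (i ℤ.* j) 0) ⟩
    mkℚᵘ i 0 ℚᵘ.* mkℚᵘ j 0                      ≈⟨ ℚᵘ.*-cong (ℚ.toℚᵘ-fromℚᵘ (mkℚᵘ i 0)) (ℚ.toℚᵘ-fromℚᵘ (mkℚᵘ j 0)) ⟨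
    ℚ.toℚᵘ (i ℚ./ 1) ℚᵘ.* ℚ.toℚᵘ (j ℚ./ 1)      ≈⟨ ℚ.toℚᵘ-homo-* (i ℚ./ 1) (j ℚ./ 1) ⟨
    ℚ.toℚᵘ ((i ℚ./ 1) ℚ.* (j ℚ./ 1))            ∎)
    where open ℚᵘ.≃-Reasoning

  /1-suc : ∀ m → (+ suc m) ℚ./ 1 ≡ 1ℚ ℚ.+ (+ m) ℚ./ 1
  /1-suc m = ℚ.toℚᵘ-injective (begin
    ℚ.toℚᵘ ((+ suc m) ℚ./ 1)                    ≈⟨ ℚ.toℚᵘ-fromℚᵘ (mkℚᵘ (+ suc m) 0) ⟩
    mkℚᵘ (+ suc m) 0                            ≈⟨ *≡* (≡.cong (ℤ._* + 1) (≡.cong (λ x → 1ℤ ℤ.+ x) (≡.sym (ℤ.*-identityʳ (+ m))))) ⟩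
    ℚ.toℚᵘ 1ℚ ℚᵘ.+ mkℚᵘ (+ m) 0                 ≈⟨ ℚᵘ.+-congʳ (ℚ.toℚᵘ 1ℚ) (ℚ.toℚᵘ-fromℚᵘ (mkℚᵘ (+ m) 0)) ⟨
    ℚ.toℚᵘ 1ℚ ℚᵘ.+ ℚ.toℚᵘ ((+ m) ℚ./ 1)         ≈⟨ ℚ.toℚᵘ-homo-+ 1ℚ ((+ m) ℚ./ 1) ⟨
    ℚ.toℚᵘ (1ℚ ℚ.+ (+ m) ℚ./ 1)                 ∎)
    where open ℚᵘ.≃-Reasoning

  -- The quotient is normalised by a gcd, so the identity is checked on unnormalised fractions.
  /-*-cancel : ∀ a b .{{_ : NonZero b}} → ((+ b) ℚ./ 1) ℚ.* ((+ a) ℚ./ b) ≡ (+ a) ℚ./ 1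
  /-*-cancel a (suc b) = ℚ.toℚᵘ-injective (begin
    ℚ.toℚᵘ (((+ suc b) ℚ./ 1) ℚ.* ((+ a) ℚ./ suc b))
      ≈⟨ ℚ.toℚᵘ-homo-* ((+ suc b) ℚ./ 1) ((+ a) ℚ./ suc b) ⟩
    ℚ.toℚᵘ ((+ suc b) ℚ./ 1) ℚᵘ.* ℚ.toℚᵘ ((+ a) ℚ./ suc b)
      ≈⟨ ℚᵘ.*-cong (ℚ.toℚᵘ-fromℚᵘ (mkℚᵘ (+ suc b) 0)) (ℚ.toℚᵘ-fromℚᵘ (mkℚᵘ (+ a) b)) ⟩
    mkℚᵘ (+ suc b) 0 ℚᵘ.* mkℚᵘ (+ a) b
      ≈⟨ *≡* (≡.trans (ℤ.*-identityʳ _) (≡.trans (ℤ.*-comm (+ suc b) (+ a))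
           (≡.cong (λ m → + a ℤ.* + suc m) (≡.sym (ℕ-identity b))))) ⟩
    mkℚᵘ (+ a) 0
      ≈⟨ ℚ.toℚᵘ-fromℚᵘ (mkℚᵘ (+ a) 0) ⟨
    ℚ.toℚᵘ ((+ a) ℚ./ 1) ∎)
    where
    open ℚᵘ.≃-Reasoning
    import Data.Nat.Properties as ℕ
    ℕ-identity : ∀ b → b ℕ.+ 0 ≡ b
    ℕ-identity = ℕ.+-identityʳ

-- The formulas in terms of φ, μ and rational numbers

module RationalSpectra {k κ : Level} (K : CommutativeRing k κ) (noZeroDivisors : NoZeroDivisors K)
  (ρ : ℚ → CommutativeRing.Carrier K)
  (ρ-isHom : IsRingHomomorphism ℚ.+-*-rawRing (CommutativeRing.rawRing K) ρ)
  (ρ-nonzero : ∀ {p} → CommutativeRing._≈_ K (ρ p) (CommutativeRing.0# K) → p ≡ 0ℚ) where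
  open CommutativeRing K hiding (zero)
  open Algebra.Definitions.RawSemiring (Semiring.rawSemiring semiring) using (product; sum; _^_) renaming (_×_ to _·_)
  open Algebra.Properties.Semiring.Sum semiring using (sum-cong-≋)
  open IsRingHomomorphism ρ-isHom
  open Rationals
  open Determinants K using (Square; determinant; determinant-cong; determinant-unique)
  open FiniteSums K
  open CharacterSums K noZeroDivisors
  open import Relation.Binary.Reasoning.Setoid setoid

  ρ-ℕ : ∀ m → m · 1# ≈ ρ ((+ m) ℚ./ 1)
  ρ-ℕ zero    = sym 0#-homo
  ρ-ℕ (suc m) = begin
    1# + m · 1#                     ≈⟨ +-cong (sym 1#-homo) (ρ-ℕ m) ⟩
    ρ 1ℚ + ρ ((+ m) ℚ./ 1)          ≈⟨ +-homo 1ℚ ((+ m) ℚ./ 1) ⟨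
    ρ (1ℚ ℚ.+ (+ m) ℚ./ 1)          ≡⟨ ≡.cong ρ (/1-suc m) ⟨
    ρ ((+ suc m) ℚ./ 1)             ∎

  -- If m + 1 were 0 in K, it would be 0 in ℚ by `ρ-nonzero`, and multiplying by 1/(m + 1) would
  -- give 1 = 0 there.
  characteristicZero : CharacteristicZero K
  characteristicZero m m+1≈0 = contradiction (0≡1 m (ρ-nonzero (trans (sym (ρ-ℕ (suc m))) m+1≈0))) λ ()
    where
    0≡1 : ∀ m → (+ suc m) ℚ./ 1 ≡ 0ℚ → 0ℚ ≡ 1ℚ
    0≡1 m m+0≡1 = ≡.trans (≡.sym (ℚ.*-zeroˡ ((+ 1) ℚ./ suc m)))
      (≡.trans (≡.cong (ℚ._* ((+ 1) ℚ./ suc m)) (≡.sym m+0≡1)) (/-*-cancel 1 (suc m)))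

  open Spectra K noZeroDivisors characteristicZero

  ρ-sign : ∀ l → (- 1#) ^ l ≈ ρ ((-1ℤ ℤ.^ l) ℚ./ 1)
  ρ-sign zero    = sym 1#-homo
  ρ-sign (suc l) = begin
    - 1# * (- 1#) ^ l                           ≈⟨ *-cong (sym (trans (-‿homo 1ℚ) (-‿cong 1#-homo))) (ρ-sign l) ⟩
    ρ (-1ℤ ℚ./ 1) * ρ ((-1ℤ ℤ.^ l) ℚ./ 1)       ≈⟨ *-homo (-1ℤ ℚ./ 1) ((-1ℤ ℤ.^ l) ℚ./ 1) ⟨
    ρ ((-1ℤ ℚ./ 1) ℚ.* ((-1ℤ ℤ.^ l) ℚ./ 1))     ≡⟨ ≡.cong ρ (/1-* -1ℤ (-1ℤ ℤ.^ l)) ⟨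
    ρ ((-1ℤ ℤ.^ suc l) ℚ./ 1)                   ∎

  -- Both sides branch on the same two tests. With the outcomes and the number of factors
  -- generalised, they are compared case by case, whatever the decomposition is.
  möbius-μ : ∀ {c ℓ} (T : FiniteRing c ℓ) → möbius T ≈ ρ (μ T ℚ./ 1)
  möbius-μ T = cases (does (FiniteRing.order T ℕ.≟ 1)) (does (All.all? FiniteRing.isField? factors)) (length factors)
    where
    open LocalDecomposition (decompose T)
    cases : ∀ b b′ l → (if b then 1# else (if b′ then (- 1#) ^ l else 0#)) ≈
                       ρ ((if b then 1ℤ else (if b′ then -1ℤ ℤ.^ l else 0ℤ)) ℚ./ 1)
    cases true  _     l = sym 1#-homo
    cases false true  l = ρ-sign l
    cases false false l = sym 0#-homo

  product-lookup : ∀ {a} {A : Set a} (f : A → Carrier) xs →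
                   product (λ i → f (List.lookup xs i)) ≡ foldr _*_ 1# (map f xs)
  product-lookup f []       = ≡.refl
  product-lookup f (x ∷ xs) = ≡.cong (f x *_) (product-lookup f xs)

  foldr-*-cong : ∀ {a} {A : Set a} {f g : A → Carrier} → (∀ x → f x ≈ g x) →
                 ∀ xs → foldr _*_ 1# (map f xs) ≈ foldr _*_ 1# (map g xs)
  foldr-*-cong f≈g []       = refl
  foldr-*-cong f≈g (x ∷ xs) = *-cong (f≈g x) (foldr-*-cong f≈g xs)

  module _ (n : ℕ) .{{_ : NonZero n}} (ζ : Carrier) (ζⁿ≈1 : ζ ^ n ≈ 1#)
    (ζᵐ≉1 : ∀ m → 0 ℕ.< m → m ℕ.< n → ¬ ζ ^ m ≈ 1#) {c ℓ} (A : SymmetricAlgebra n c ℓ) where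
    private module A = SymmetricAlgebra A

    -- The unfolded form of `ramanujan` at `A /Annˢ x`, where ψₓ(gu) reads ψ((gu)x).
    ramanujanList : A.Carrier → A.Carrier → Carrier
    ramanujanList x g = foldr _+_ 0#
      (map (λ u → ζ ^ (A.ψ ((g A.* u) A.* x) %ℕ n)) (FiniteRing.units (A.finiteRing /Ann x)))

    ramanujanList-sum : ∀ x g → ramanujanList x g ≈ ramanujanSum n ζ ζⁿ≈1 ζᵐ≉1 A x g
    ramanujanList-sum x g = trans (reflexive (foldr-sumList _ _)) (unitSum-units (A.finiteRing /Ann x) _)

    -- Multiplication by φ(U), which is nonzero in K, turns the ratio into φ(T) and reduces the
    -- claim to the cross-multiplied formula.
    ramanujanList-value : ∀ x g → let T = A.finiteRing /Ann x ; U = A.finiteRing /Ann (g A.* x) in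
      ramanujanList x g ≈ ρ (φ-ratio T U ℚ.* (μ U ℚ./ 1))
    ramanujanList-value x g = cancelˡ (·1-nonzero U.φ {{U.φ≢0}}) (begin
      (U.φ · 1#) * ramanujanList x g
        ≈⟨ *-congˡ (ramanujanList-sum x g) ⟩
      (U.φ · 1#) * ramanujanSum n ζ ζⁿ≈1 ζᵐ≉1 A x g
        ≈⟨ ramanujanSum-möbius n ζ ζⁿ≈1 ζᵐ≉1 A x g ⟩
      (T.φ · 1#) * möbius U
        ≈⟨ *-cong (ρ-ℕ T.φ) (möbius-μ U) ⟩
      ρ ((+ T.φ) ℚ./ 1) * ρ (μ U ℚ./ 1)
        ≈⟨ *-homo _ _ ⟨
      ρ (((+ T.φ) ℚ./ 1) ℚ.* (μ U ℚ./ 1))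
        ≡⟨ ≡.cong (λ q → ρ (q ℚ.* (μ U ℚ./ 1))) (/-*-cancel T.φ U.φ {{U.φ≢0}}) ⟨
      ρ (((+ U.φ) ℚ./ 1) ℚ.* φ-ratio T U ℚ.* (μ U ℚ./ 1))
        ≡⟨ ≡.cong ρ (ℚ.*-assoc ((+ U.φ) ℚ./ 1) (φ-ratio T U) (μ U ℚ./ 1)) ⟩
      ρ (((+ U.φ) ℚ./ 1) ℚ.* (φ-ratio T U ℚ.* (μ U ℚ./ 1)))
        ≈⟨ *-homo _ _ ⟩
      ρ ((+ U.φ) ℚ./ 1) * ρ (φ-ratio T U ℚ.* (μ U ℚ./ 1))
        ≈⟨ *-congʳ (ρ-ℕ U.φ) ⟨
      (U.φ · 1#) * ρ (φ-ratio T U ℚ.* (μ U ℚ./ 1)) ∎)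
      where
      T = A.finiteRing /Ann x
      U = A.finiteRing /Ann (g A.* x)
      module T = FiniteRing T
      module U = FiniteRing U

    module _ {j : ℕ} (D : PrincipalIdeals A.finiteRing j) where
      open PrincipalIdeals D

      -- Every operation is a parameter, equal to that of K.  At ℂ each of these
      -- equalities then holds by refl, whereas comparing whole expressions over ℂ
      -- would unfold the Cauchy proofs inside them.
      spectrum-transport :
        {_≈′_ : Carrier → Carrier → Set κ} {_+′_ _*′_ : Carrier → Carrier → Carrier} { -′_ : Carrier → Carrier}
        {0′ 1′ : Carrier} {sum′ sum″ : ∀ m → (Fin m → Carrier) → Carrier} {_^′_ : Carrier → ℕ → Carrier} →
        _≈′_ ≡ _≈_ → _+′_ ≡ _+_ → _*′_ ≡ _*_ → -′_ ≡ -_ → 0′ ≡ 0# → 1′ ≡ 1# →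
        sum′ ≡ (λ m → sum {m}) → sum″ ≡ (λ m → sum {m}) → _^′_ ≡ _^_ →
        (det′ : ∀ m → Square m → Carrier) → (∀ M → det′ zero M ≡ 1′) →
        (∀ m M → det′ (suc m) M ≡
           sum′ (suc m) λ j → (((-′ 1′) ^′ toℕ j) *′ M zero j) *′ det′ m (λ i l → M (suc i) (punchIn j l))) →
        (G : Graph c ℓ (c ⊔ ℓ)) → G ≡ gcdGraph A.finiteRing D →
        (adjacency : (G : Graph c ℓ (c ⊔ ℓ)) → Square (Finite.order (Graph.finite G))) →
        (∀ G i l → let open Finite (Graph.finite G) in adjacency G i l ≡
           (if does (Graph.adj? G (List.lookup elements i) (List.lookup elements l)) then 1′ else 0′)) →
        (scalar : ∀ m → Carrier → Square m) →
        (∀ m t i l → scalar m t i l ≡ (if does (i Fin.≟ l) then t else 0′)) →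
        (charPoly′ : ∀ m → Square m → Carrier → Carrier) →
        (∀ m M t → charPoly′ m M t ≡ det′ m (λ i l → scalar m t i l +′ (-′ M i l))) →
        (ram : Fin j → A.Carrier → Carrier) →
        (∀ i g → ram i g ≡ foldr _+′_ 0′ (map (λ u → ζ ^′ (A.ψ ((g A.* u) A.* generator i) %ℕ n))
                             (FiniteRing.units (A.finiteRing /Ann generator i)))) →
        (vertices : List A.Carrier) → vertices ≡ A.elements →
        ∀ t → charPoly′ (Finite.order (Graph.finite G)) (adjacency G) t ≈′
              foldr _*′_ 1′ (map (λ e → t +′ (-′ e)) (map (λ g → sum″ j λ i → ram i g) vertices))
      spectrum-transport ≡.refl ≡.refl ≡.refl ≡.refl ≡.refl ≡.refl ≡.refl ≡.refl ≡.refl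
        det′ det′-zero det′-suc _ ≡.refl adjacency adjacency≡ scalar scalar≡ charPoly′ charPoly′≡ ram ram≡ _ ≡.refl t = begin
        charPoly′ A.order (adjacency G) t
          ≡⟨ charPoly′≡ A.order (adjacency G) t ⟩
        det′ A.order (λ i l → scalar A.order t i l + - adjacency G i l)
          ≈⟨ determinant-unique (λ {m} → det′ m) det′-zero (λ {m} → det′-suc m) _ ⟩
        determinant (λ i l → scalar A.order t i l + - adjacency G i l)
          ≈⟨ determinant-cong {A.order} (λ i l →
               +-cong (reflexive (scalar≡ A.order t i l)) (-‿cong (reflexive (adjacency≡ G i l)))) ⟩
        determinant (characteristicMatrix n ζ ζⁿ≈1 ζᵐ≉1 A D t)
          ≈⟨ characteristicPolynomial n ζ ζⁿ≈1 ζᵐ≉1 A D t ⟩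
        product (λ i → t + - eigenvalue n ζ ζⁿ≈1 ζᵐ≉1 A D (List.lookup A.elements i))
          ≡⟨ product-lookup (λ g → t + - eigenvalue n ζ ζⁿ≈1 ζᵐ≉1 A D g) A.elements ⟩
        foldr _*_ 1# (map (λ g → t + - eigenvalue n ζ ζⁿ≈1 ζᵐ≉1 A D g) A.elements)
          ≈⟨ foldr-*-cong (λ g → +-congˡ (-‿cong (sum-cong-≋ {j} λ i →
               trans (reflexive (ram≡ i g)) (ramanujanList-sum (generator i) g)))) A.elements ⟨
        foldr _*_ 1# (map (λ g → t + - sum (λ i → ram i g)) A.elements)
          ≡⟨ ≡.cong (foldr _*_ 1#) (map-∘ A.elements) ⟩
        foldr _*_ 1# (map (λ e → t + - e) (map (λ g → sum (λ i → ram i g)) A.elements)) ∎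
        where G = gcdGraph A.finiteRing D

-- The spectrum over the complex numbers

open ComplexNumbers

ℚ⇒ℂ-isHom : IsRingHomomorphism ℚ.+-*-rawRing ℂ-ring.rawRing ℚ⇒ℂ
ℚ⇒ℂ-isHom = record
  { isSemiringHomomorphism = record
    { isNearSemiringHomomorphism = record
      { +-isMonoidHomomorphism = record
        { isMagmaHomomorphism = record
          { isRelHomomorphism = record { cong = ℚ⇒ℂ-cong }
          ; homo = ℚ⇒ℂ-+
          }
        ; ε-homo = ℂ-ring.refl {0ᶜ}
        }
      ; *-homo = ℚ⇒ℂ-*
      }
    ; 1#-homo = ℂ-ring.refl {1ᶜ}
    }
  ; -‿homo = ℚ⇒ℂ-neg
  }

open RationalSpectra ℂ-commutativeRing ℂ-noZeroDivisors ℚ⇒ℂ ℚ⇒ℂ-isHom ℚ⇒ℂ-injective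

theorem4p16 : ∀ {c ℓ} (n : ℕ) .{{_ : NonZero n}} (ζ : ℂ) → IsPrimitiveRoot n ζ →
    (R : SymmetricAlgebra n c ℓ) → let open SymmetricAlgebra R in
    (k : ℕ) (D : PrincipalIdeals finiteRing k) → let x = PrincipalIdeals.generator D in
    IsSpectrum (gcdGraph finiteRing D)
    (map (λ g → ∑ (λ i → ramanujan ζ (R /Annˢ x i) g)) elements)
    ×
    (∀ (g : Carrier) (i : Fin k) →
    ramanujan ζ (R /Annˢ x i) g
    ≈ᶜ
    ℚ⇒ℂ (φ-ratio (finiteRing /Ann x i) (finiteRing /Ann (g * x i))
    ℚ.* (μ (finiteRing /Ann (g * x i)) ℚ./ 1)))
theorem4p16 n ζ (ζⁿ≈1 , ζᵐ≉1) R k D =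
  -- The operations are spelled the way they occur in the unfolded clauses of Defs.
  spectrum-transport n ζ ζⁿ≈1 ζᵐ≉1 R D
    {RawRing._≈_ ℂ-rawRing} {RawRing._+_ ℂ-rawRing} {RawRing._*_ ℂ-rawRing} {RawRing.-_ ℂ-rawRing}
    {RawRing.0# ℂ-rawRing} {RawRing.1# ℂ-rawRing}
    {λ m → Algebra.Definitions.RawMonoid.sum
      (RawNearSemiring.+-rawMonoid (RawSemiring.rawNearSemiring (RawRing.rawSemiring ℂ-rawRing))) {m}}
    {λ m → ∑ {m}} {Algebra.Definitions.RawSemiring._^_ (RawRing.rawSemiring ℂ-rawRing)}
    ≡.refl ≡.refl ≡.refl ≡.refl ≡.refl ≡.refl ≡.refl ≡.refl ≡.refl
    (λ m → det {m}) (λ _ → ≡.refl) (λ _ _ → ≡.refl)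
    (gcdGraph (SymmetricAlgebra.finiteRing R) D) ≡.refl adjacencyMatrix (λ _ _ _ → ≡.refl)
    (λ m t i l → if_then_else_ {A = ℂ} (does (i Fin.≟ l)) t (RawRing.0# ℂ-rawRing)) (λ _ _ _ _ → ≡.refl)
    (λ m → charPoly {m}) (λ _ _ _ → ≡.refl)
    (λ i g → ramanujan ζ (R /Annˢ PrincipalIdeals.generator D i) g) (λ _ _ → ≡.refl)
    (SymmetricAlgebra.elements R) ≡.refl ,
  λ g i → ramanujanList-value n ζ ζⁿ≈1 ζᵐ≉1 R (PrincipalIdeals.generator D i) g
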